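{- Let $x=(x_1,x_2,\dots)$ and $y=(y_1,y_2,\dots)$ be two sets of variables and let $\mathcal P$ be the set of all partitions. Then $$\prod_{i,\,j\geqslant 1}\frac{1-a_i\,y_j}{1-x_i\,y_j}=\sum_{\lambda\in\mathcal P}s_\lambda(x\|a)\,\widehat s_\lambda(y\|a),$$ where $s_\lambda(x\|a)$ are the double Schur functions and $\widehat s_\lambda(y\|a)$ are the dual Schur functions.
   Context: Let $a=(a_i)_{i\in\mathbb Z}$ be a sequence of commuting indeterminates and $\mathbb Q[a]$ the polynomial ring in the $a_i$. The ring $\Lambda(x\|a)$: its elements are sequences $P=(P_0,P_1,P_2,\dots)$, where $P_n$ is a symmetric polynomial in $x_1,\dots,x_n$ with coefficients in $\mathbb Q[a]$, the total degrees of the $P_n$ in the $x_i$ are bounded, and $P_n(x_1,\dots,x_{n-1},a_n)=P_{n-1}(x_1,\dots,x_{n-1})$ for all $n\geqslant 1$; multiplication is componentwise. Double Schur functions: for a partition $\lambda$ with length $\ell(\lambda)\leqslant n$, $$s_\lambda(x_1,\dots,x_n\|a)=\frac{\det\big[(x_i\|a)^{\lambda_j+n-j}\big]_{i,j=1}^n}{\prod_{1\leqslant i<j\leqslant n}(x_i-x_j)},\qquad (x_i\|a)^r=(x_i-a_n)(x_i-a_{n-1})\cdots(x_i-a_{n-r+1}),\ (x_i\|a)^0=1,$$ and $s_\lambda(x_1,\dots,x_n\|a)=0$ if $\ell(\lambda)>n$. This sequence (over $n$) is the element $s_\lambda(x\|a)\in\Lambda(x\|a)$. Dual Schur functions: let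 $\widehat\Lambda(y\|a)$ be the ring of formal (possibly infinite) sums $\sum_{\lambda}c_\lambda(a)s_\lambda(y)$, $c_\lambda(a)\in\mathbb Q[a]$, where $s_\lambda(y)$ are the ordinary Schur functions. Let $d$ be the number of boxes on the main diagonal of $\lambda$. For $n\geqslant\ell(\lambda)$, $$\widehat s_\lambda(y_1,\dots,y_n\|a)=\frac{\det[A_{ij}]_{i,j=1}^n}{\prod_{1\leqslant i<j\leqslant n}(y_i-y_j)},$$ where $A_{ij}=\dfrac{y_i^{\lambda_j+n-j}}{(1-a_0y_i)(1-a_{ -1}y_i)\cdots(1-a_{j-\lambda_j}y_i)}$ for $1\leqslant j\leqslant d$ and $A_{ij}=y_i^{\lambda_j+n-j}(1-a_1y_i)(1-a_2y_i)\cdots(1-a_{j-\lambda_j-1}y_i)$ for $d<j\leqslant n$ (expanded as power series in $y$); it is set to $0$ if $\ell(\lambda)>n$. These are compatible with setting $y_n=0$ and define the element $\widehat s_\lambda(y\|a)\in\widehat\Lambda(y\|a)$. Meaning of the identity: for each $n$ replace $x$ by $(x_1,\dots,x_n)$, with $i$ in the product running over $1,\dots,n$; this is then an identity of formal power series in $y$. The coefficients of monomials in $y$, for $n=0,1,2,\dots$, form elements of $\Lambda(x\|a)$. -}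

module Defs where

open import Algebra.Bundles using (CommutativeRing; Semiring)
import Algebra.Definitions.RawSemiring
import Algebra.Properties.Ring
import Algebra.Properties.Semiring.Sum
import Relation.Binary.Reasoning.Setoid
open import Data.Bool.Base using (if_then_else_)
open import Data.Fin.Base as Fin using (Fin; toℕ; punchIn)
import Data.Fin.Properties as Finₚ
open Finₚ using (toℕ≤pred[n])
open import Data.Integer.Base as ℤ using (ℤ)
open import Data.List.Base as List
  using (List; []; _∷_; length; filter; upTo; allFin; cartesianProduct; foldr; foldl)
open import Data.List.Membership.Propositional using (_∉_)
open import Data.List.Relation.Unary.All as All using (All; []; _∷_)
open import Data.List.Relation.Unary.All.Properties using (all-filter)
open import Data.List.Relation.Unary.Linked using (Linked)
open import Data.List.Relation.Unary.Unique.Propositional using (Unique)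
open import Data.Nat.Base as ℕ using (ℕ; zero; suc; _∸_; z≤n; s≤s)
import Data.Nat.Properties as ℕₚ
open import Data.Product.Base using (_×_; _,_; Σ-syntax)
open import Data.Rational.Base as ℚ using (ℚ)
open import Data.Vec.Base as Vec using (Vec; []; _∷_; lookup; updateAt; _[_]≔_; replicate; zipWith)
import Data.Vec.Properties as Vecₚ
open import Level using (Level; _⊔_; 0ℓ)
open import Function.Base using (_∘_)
open import Relation.Binary.PropositionalEquality as ≡ using (_≡_; _≢_)
open import Relation.Nullary using (¬_; Dec; does; yes; no; contradiction)

private variable
  c ℓ : Level

-- ℚ[a] is presented as the free commutative ℚ-algebra on ℤ: polynomial
-- expressions modulo the congruence generated by the commutative ring
-- axioms and the arithmetic of ℚ.

infixl 6 _⊕_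
infixl 7 _⊗_
infix  8 ⊖_
infix  4 _∼_

data Expr : Set where
  con     : ℚ → Expr
  ind     : ℤ → Expr
  _⊕_ _⊗_ : Expr → Expr → Expr
  ⊖_      : Expr → Expr

data _∼_ : Expr → Expr → Set where
  ∼-refl  : ∀ {p} → p ∼ p
  ∼-sym   : ∀ {p q} → p ∼ q → q ∼ p
  ∼-trans : ∀ {p q r} → p ∼ q → q ∼ r → p ∼ r

  ⊕-cong : ∀ {p p′ q q′} → p ∼ p′ → q ∼ q′ → p ⊕ q ∼ p′ ⊕ q′
  ⊗-cong : ∀ {p p′ q q′} → p ∼ p′ → q ∼ q′ → p ⊗ q ∼ p′ ⊗ q′
  ⊖-cong : ∀ {p p′} → p ∼ p′ → ⊖ p ∼ ⊖ p′

  ⊕-assoc     : ∀ p q r → (p ⊕ q) ⊕ r ∼ p ⊕ (q ⊕ r)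
  ⊕-comm      : ∀ p q → p ⊕ q ∼ q ⊕ p
  ⊕-identityˡ : ∀ p → con ℚ.0ℚ ⊕ p ∼ p
  ⊕-inverseˡ  : ∀ p → ⊖ p ⊕ p ∼ con ℚ.0ℚ

  ⊗-assoc     : ∀ p q r → (p ⊗ q) ⊗ r ∼ p ⊗ (q ⊗ r)
  ⊗-comm      : ∀ p q → p ⊗ q ∼ q ⊗ p
  ⊗-identityˡ : ∀ p → con ℚ.1ℚ ⊗ p ∼ p
  distribˡ    : ∀ p q r → p ⊗ (q ⊕ r) ∼ p ⊗ q ⊕ p ⊗ r

  con-+ : ∀ u v → con (u ℚ.+ v) ∼ con u ⊕ con v
  con-* : ∀ u v → con (u ℚ.* v) ∼ con u ⊗ con v

ℚ[a] : CommutativeRing 0ℓ 0ℓ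
ℚ[a] = record
  { Carrier = Expr ; _≈_ = _∼_ ; _+_ = _⊕_ ; _*_ = _⊗_ ; -_ = ⊖_
  ; 0# = con ℚ.0ℚ ; 1# = con ℚ.1ℚ
  ; isCommutativeRing = record
    { isRing = record
      { +-isAbelianGroup = record
        { isGroup = record
          { isMonoid = record
            { isSemigroup = record
              { isMagma = record
                { isEquivalence = record { refl = ∼-refl ; sym = ∼-sym ; trans = ∼-trans }
                ; ∙-cong = ⊕-cong }
              ; assoc = ⊕-assoc }
            ; identity = ⊕-identityˡ , λ p → ∼-trans (⊕-comm p _) (⊕-identityˡ p) }
          ; inverse = ⊕-inverseˡ , λ p → ∼-trans (⊕-comm p _) (⊕-inverseˡ p)
          ; ⁻¹-cong = ⊖-cong }
        ; comm = ⊕-comm }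
      ; *-cong = ⊗-cong
      ; *-assoc = ⊗-assoc
      ; *-identity = ⊗-identityˡ , λ p → ∼-trans (⊗-comm p _) (⊗-identityˡ p)
      ; distrib = distribˡ , λ p q r →
          ∼-trans (⊗-comm _ p) (∼-trans (distribˡ p q r) (⊕-cong (⊗-comm p q) (⊗-comm p r))) }
    ; *-comm = ⊗-comm } }

Exponent : ℕ → Set
Exponent = Vec ℕ

𝟎 : ∀ {n} → Exponent n
𝟎 = replicate _ 0

degree : ∀ {n} → Exponent n → ℕ
degree = Vec.sum

_·e_ : ∀ {n} → ℕ → Fin n → Exponent n
k ·e j = 𝟎 [ j ]≔ k

infix 4 _≟ᵉ_
_≟ᵉ_ : ∀ {n} (α β : Exponent n) → Dec (α ≡ β)
_≟ᵉ_ = Vecₚ.≡-dec ℕₚ._≟_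

-- α - k eⱼ + l eᵢ; only meaningful for k ≤ αⱼ.
move : ∀ {n} → Exponent n → Fin n → ℕ → Fin n → ℕ → Exponent n
move α j k i l = updateAt (updateAt α j (_∸ k)) i (l ℕ.+_)

degree-add : ∀ {n} (α : Exponent n) i l → degree (updateAt α i (l ℕ.+_)) ≡ l ℕ.+ degree α
degree-add (k ∷ α) Fin.zero    l = ℕₚ.+-assoc l k (degree α)
degree-add (k ∷ α) (Fin.suc i) l = ≡.trans (≡.cong (k ℕ.+_) (degree-add α i l)) (begin
  k ℕ.+ (l ℕ.+ degree α)  ≡⟨ ℕₚ.+-assoc k l _ ⟨
  k ℕ.+ l ℕ.+ degree α    ≡⟨ ≡.cong (ℕ._+ degree α) (ℕₚ.+-comm k l) ⟩
  l ℕ.+ k ℕ.+ degree α    ≡⟨ ℕₚ.+-assoc l k _ ⟩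
  l ℕ.+ (k ℕ.+ degree α)  ∎)
  where open ≡.≡-Reasoning

degree-sub : ∀ {n} (α : Exponent n) j k → k ℕ.≤ lookup α j →
             k ℕ.+ degree (updateAt α j (_∸ k)) ≡ degree α
degree-sub (l ∷ α) Fin.zero    k k≤ = ≡.trans (≡.sym (ℕₚ.+-assoc k (l ∸ k) _))
  (≡.cong (ℕ._+ degree α) (ℕₚ.m+[n∸m]≡n k≤))
degree-sub (l ∷ α) (Fin.suc j) k k≤ = begin
  k ℕ.+ (l ℕ.+ d)   ≡⟨ ℕₚ.+-assoc k l d ⟨
  k ℕ.+ l ℕ.+ d     ≡⟨ ≡.cong (ℕ._+ d) (ℕₚ.+-comm k l) ⟩
  l ℕ.+ k ℕ.+ d     ≡⟨ ℕₚ.+-assoc l k d ⟩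
  l ℕ.+ (k ℕ.+ d)   ≡⟨ ≡.cong (l ℕ.+_) (degree-sub α j k k≤) ⟩
  l ℕ.+ degree α    ∎
  where open ≡.≡-Reasoning
        d = degree (updateAt α j (_∸ k))

degree-move : ∀ {n} (α : Exponent n) i j k → k ℕ.≤ lookup α j →
              degree (move α j k i (suc k)) ≡ suc (degree α)
degree-move α i j k k≤ = ≡.trans (degree-add (updateAt α j (_∸ k)) i (suc k)) (≡.cong suc (degree-sub α j k k≤))

degree-𝟎 : ∀ n → degree (𝟎 {n}) ≡ 0
degree-𝟎 zero    = ≡.refl
degree-𝟎 (suc n) = degree-𝟎 n

degree-·e : ∀ {n} k (j : Fin n) → degree (k ·e j) ≡ k
degree-·e {suc n} k Fin.zero    = ≡.trans (≡.cong (k ℕ.+_) (degree-𝟎 n)) (ℕₚ.+-identityʳ k)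
degree-·e         k (Fin.suc j) = degree-·e k j

degree-zipWith-+ : ∀ {n} (α β : Exponent n) → degree (zipWith ℕ._+_ α β) ≡ degree α ℕ.+ degree β
degree-zipWith-+ []      []      = ≡.refl
degree-zipWith-+ (k ∷ α) (l ∷ β) = ≡.trans (≡.cong (k ℕ.+ l ℕ.+_) (degree-zipWith-+ α β))
  (interchange k l (degree α) (degree β))
  where open import Algebra.Properties.CommutativeSemigroup ℕₚ.+-commutativeSemigroup

0·e≡𝟎 : ∀ {n} (j : Fin n) → 0 ·e j ≡ 𝟎
0·e≡𝟎 Fin.zero    = ≡.refl
0·e≡𝟎 (Fin.suc j) = ≡.cong (0 ∷_) (0·e≡𝟎 j)

suc·e≢𝟎 : ∀ {n} (α : Exponent n) j → updateAt α j suc ≢ 𝟎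
suc·e≢𝟎 (_ ∷ α) (Fin.suc j) eq = suc·e≢𝟎 α j (Vecₚ.∷-injectiveʳ eq)

add-sub : ∀ {n} (α : Exponent n) j → lookup α j ≢ 0 → α ≡ updateAt (updateAt α j (_∸ 1)) j suc
add-sub (zero  ∷ α) Fin.zero    ≢0 = contradiction ≡.refl ≢0
add-sub (suc k ∷ α) Fin.zero    ≢0 = ≡.refl
add-sub (k ∷ α)     (Fin.suc j) ≢0 = ≡.cong (k ∷_) (add-sub α j ≢0)

suc-·e : ∀ {n} k (j : Fin n) → updateAt (k ·e j) j suc ≡ suc k ·e j
suc-·e k j = Vecₚ.updateAt-updateAt j 𝟎

lookup-·e : ∀ {n} k (j : Fin n) → lookup (k ·e j) j ≡ k
lookup-·e k j = Vecₚ.lookup∘updateAt j 𝟎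

·e-support : ∀ {n} k (j : Fin n) β → updateAt β j suc ≡ k ·e j → β ≡ lookup β j ·e j
·e-support k j β eq = begin
  β                                     ≡⟨ Vecₚ.updateAt-id j β ⟨
  updateAt β j (_∸ 0)                   ≡⟨ Vecₚ.updateAt-updateAt j β ⟨
  updateAt (updateAt β j suc) j (_∸ 1)  ≡⟨ ≡.cong (λ γ → updateAt γ j (_∸ 1)) eq ⟩
  updateAt (k ·e j) j (_∸ 1)            ≡⟨ Vecₚ.updateAt-updateAt j 𝟎 ⟩
  (k ∸ 1) ·e j                          ≡⟨ ≡.cong (λ l → (l ∸ 1) ·e j) k≡ ⟩
  lookup β j ·e j                       ∎
  where
  open ≡.≡-Reasoning
  k≡ : k ≡ suc (lookup β j)
  k≡ = ≡.trans (≡.sym (lookup-·e k j)) (≡.trans (≡.cong (λ γ → lookup γ j) (≡.sym eq)) (Vecₚ.lookup∘updateAt j β))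

module Series (K : CommutativeRing c ℓ) where
  private module K = CommutativeRing K
  open K using (Carrier; _≈_; 0#; 1#)
  open Algebra.Properties.Semiring.Sum K.semiring
  open Algebra.Definitions.RawSemiring (Semiring.rawSemiring K.semiring) using (_^_)
  open Relation.Binary.Reasoning.Setoid K.setoid

  Series : ℕ → Set _
  Series n = Exponent n → Carrier

  infix  4 _≈ₛ_
  infixl 6 _+ₛ_
  infixl 7 _*ₛ_
  infix  8 -ₛ_

  _≈ₛ_ : ∀ {n} → Series n → Series n → Set _
  f ≈ₛ g = ∀ α → f α ≈ g α

  _+ₛ_ _*ₛ_ : ∀ {n} → Series n → Series n → Series n
  (f +ₛ g) α = f α K.+ g α

  -- The coefficient of zᵞ is the sum of f α * g β over all α + β = γ.
  (f *ₛ g) []      = f [] K.* g []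
  (f *ₛ g) (k ∷ γ) =
    ∑[ i ≤ k ] ((λ α → f (toℕ i ∷ α)) *ₛ (λ β → g (k ∸ toℕ i ∷ β))) γ

  -ₛ_ : ∀ {n} → Series n → Series n
  (-ₛ f) α = K.- f α

  monomial : ∀ {n} → Carrier → Exponent n → Series n
  monomial u β α = if does (α ≟ᵉ β) then u else 0#

  constant : ∀ {n} → Carrier → Series n
  constant u = monomial u 𝟎

  indeterminate : ∀ {n} → Fin n → Series n
  indeterminate i = monomial 1# (1 ·e i)

  -- 1 / (1 - u zⱼ) = ∑ₖ uᵏ zⱼᵏ (see geometric-inverse)
  geometric : ∀ {n} → Carrier → Fin n → Series n
  geometric u j α = if does (α ≟ᵉ lookup α j ·e j) then u ^ lookup α j else 0#

  -- The quotient of p by zᵢ - zⱼ (i ≢ j): the equation p = (zᵢ - zⱼ) q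
  -- reads p (α + eᵢ) = q α - q (α + eᵢ - eⱼ), and solving it recursively
  -- gives this finite sum (see divDiff-unique).
  divDiff : ∀ {n} → Fin n → Fin n → Series n → Series n
  divDiff i j p α = ∑[ k ≤ lookup α j ] p (move α j (toℕ k) i (suc (toℕ k)))

  -- Unordered summation of a family of series: every coefficient receives
  -- only finitely many nonzero contributions.
  HasSum : ∀ {i} {I : Set i} {n} → (I → Series n) → Series n → Set _
  HasSum {I = I} F S = ∀ α → Σ[ L ∈ List I ]
    Unique L ×
    (∀ i → i ∉ L → F i α ≈ 0#) ×
    List.foldr (λ i t → F i α K.+ t) 0# L ≈ S α

  private
    antidiagonal : (ℕ → ℕ → Carrier) → ℕ → Carrier
    antidiagonal h k = ∑[ i ≤ k ] h (toℕ i) (k ∸ toℕ i)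

    antidiagonal-cong : ∀ {h h′} → (∀ i j → h i j ≈ h′ i j) → ∀ k → antidiagonal h k ≈ antidiagonal h′ k
    antidiagonal-cong eq k = sum-cong-≋ {suc k} (λ i → eq (toℕ i) (k ∸ toℕ i))

    antidiagonal-+ : ∀ h h′ k → antidiagonal (λ i j → h i j K.+ h′ i j) k ≈ antidiagonal h k K.+ antidiagonal h′ k
    antidiagonal-+ h h′ k = ∑-distrib-+ {suc k} (λ i → h (toℕ i) (k ∸ toℕ i)) (λ i → h′ (toℕ i) (k ∸ toℕ i))

    antidiagonal-last : ∀ h k → antidiagonal h (suc k) ≈ antidiagonal (λ i j → h i (suc j)) k K.+ h (suc k) 0
    antidiagonal-last h zero    = begin
      h 0 1 K.+ (h 1 0 K.+ 0#)  ≈⟨ K.+-assoc _ _ _ ⟨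
      h 0 1 K.+ h 1 0 K.+ 0#    ≈⟨ K.+-identityʳ _ ⟩
      h 0 1 K.+ h 1 0           ≈⟨ K.+-congʳ (K.+-identityʳ _) ⟨
      h 0 1 K.+ 0# K.+ h 1 0    ∎
    antidiagonal-last h (suc k) =
      K.trans (K.+-congˡ (antidiagonal-last (h ∘ suc) k)) (K.sym (K.+-assoc _ _ _))

    antidiagonal-flip : ∀ h k → antidiagonal h k ≈ antidiagonal (λ i j → h j i) k
    antidiagonal-flip h zero    = K.refl
    antidiagonal-flip h (suc k) = begin
      h 0 (suc k) K.+ antidiagonal (h ∘ suc) k              ≈⟨ K.+-comm _ _ ⟩
      antidiagonal (h ∘ suc) k K.+ h 0 (suc k)              ≈⟨ K.+-congʳ (antidiagonal-flip (h ∘ suc) k) ⟩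
      antidiagonal (λ i j → h (suc j) i) k K.+ h 0 (suc k)  ≈⟨ antidiagonal-last (λ i j → h j i) k ⟨
      antidiagonal (λ i j → h j i) (suc k)                  ∎

    antidiagonal-assoc : ∀ (t : ℕ → ℕ → ℕ → Carrier) k →
      antidiagonal (λ i r → antidiagonal (λ j l → t j l r) i) k ≈
      antidiagonal (λ j r → antidiagonal (t j) r) k
    antidiagonal-assoc t zero    = K.refl
    antidiagonal-assoc t (suc k) = begin
      (t 0 0 (suc k) K.+ 0#) K.+ antidiagonal (λ i r → t 0 (suc i) r K.+ antidiagonal (λ j l → t (suc j) l r) i) k
        ≈⟨ K.+-cong (K.+-identityʳ _) (antidiagonal-+ (λ i r → t 0 (suc i) r) (λ i r → antidiagonal (λ j l → t (suc j) l r) i) k) ⟩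
      t 0 0 (suc k) K.+ (antidiagonal (λ i r → t 0 (suc i) r) k K.+ antidiagonal (λ i r → antidiagonal (λ j l → t (suc j) l r) i) k)
        ≈⟨ K.+-assoc _ _ _ ⟨
      antidiagonal (t 0) (suc k) K.+ antidiagonal (λ i r → antidiagonal (λ j l → t (suc j) l r) i) k
        ≈⟨ K.+-congˡ (antidiagonal-assoc (t ∘ suc) k) ⟩
      antidiagonal (λ j r → antidiagonal (t j) r) (suc k) ∎

    _at_ : ∀ {n} → Series (suc n) → ℕ → Series n
    (f at i) α = f (i ∷ α)

    sumₛ : ∀ {n} N → (Fin N → Series n) → Series n
    sumₛ N F α = ∑[ i < N ] F i α

  *ₛ-cong : ∀ {n} {f f′ g g′ : Series n} → f ≈ₛ f′ → g ≈ₛ g′ → f *ₛ g ≈ₛ f′ *ₛ g′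
  *ₛ-cong p q []      = K.*-cong (p []) (q [])
  *ₛ-cong p q (k ∷ γ) = sum-cong-≋ {suc k} (λ i → *ₛ-cong (λ α → p (toℕ i ∷ α)) (λ α → q (k ∸ toℕ i ∷ α)) γ)

  *ₛ-comm : ∀ {n} (f g : Series n) → f *ₛ g ≈ₛ g *ₛ f
  *ₛ-comm f g []      = K.*-comm _ _
  *ₛ-comm f g (k ∷ γ) = K.trans
    (antidiagonal-cong (λ i j → *ₛ-comm (f at i) (g at j) γ) k)
    (antidiagonal-flip (λ i j → ((g at j) *ₛ (f at i)) γ) k)

  *ₛ-distribˡ : ∀ {n} (f g h : Series n) → f *ₛ (g +ₛ h) ≈ₛ f *ₛ g +ₛ f *ₛ h
  *ₛ-distribˡ f g h []      = K.distribˡ _ _ _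
  *ₛ-distribˡ f g h (k ∷ γ) = K.trans
    (antidiagonal-cong (λ i j → *ₛ-distribˡ (f at i) (g at j) (h at j) γ) k)
    (antidiagonal-+ (λ i j → ((f at i) *ₛ (g at j)) γ) (λ i j → ((f at i) *ₛ (h at j)) γ) k)

  *ₛ-distribʳ : ∀ {n} (f g h : Series n) → (g +ₛ h) *ₛ f ≈ₛ g *ₛ f +ₛ h *ₛ f
  *ₛ-distribʳ f g h α = K.trans (*ₛ-comm (g +ₛ h) f α)
    (K.trans (*ₛ-distribˡ f g h α) (K.+-cong (*ₛ-comm f g α) (*ₛ-comm f h α)))

  *ₛ-vanish : ∀ {n} (f g : Series n) γ →
              (∀ α β → zipWith ℕ._+_ α β ≡ γ → f α K.* g β ≈ 0#) → (f *ₛ g) γ ≈ 0#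
  *ₛ-vanish f g []      z = z [] [] ≡.refl
  *ₛ-vanish f g (k ∷ γ) z = K.trans
    (sum-cong-≋ {suc k} (λ i → *ₛ-vanish (f at toℕ i) (g at (k ∸ toℕ i)) γ
      (λ α β eq → z (toℕ i ∷ α) (k ∸ toℕ i ∷ β) (≡.cong₂ _∷_ (ℕₚ.m+[n∸m]≡n (toℕ≤pred[n] i)) eq))))
    (sum-replicate-zero (suc k))

  *ₛ-zeroˡ : ∀ {n} (f g : Series n) → f ≈ₛ (λ _ → 0#) → f *ₛ g ≈ₛ (λ _ → 0#)
  *ₛ-zeroˡ f g z γ = *ₛ-vanish f g γ (λ α β _ → K.trans (K.*-congʳ (z α)) (K.zeroˡ _))

  private
    *ₛ-sumʳ : ∀ {n} N (F : Fin N → Series n) g → sumₛ N F *ₛ g ≈ₛ sumₛ N (λ i → F i *ₛ g)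
    *ₛ-sumʳ zero    F g γ = *ₛ-zeroˡ _ g (λ _ → K.refl) γ
    *ₛ-sumʳ (suc N) F g γ = K.trans (*ₛ-distribʳ g (F Fin.zero) (sumₛ N (F ∘ Fin.suc)) γ)
      (K.+-congˡ (*ₛ-sumʳ N (F ∘ Fin.suc) g γ))

    *ₛ-sumˡ : ∀ {n} N f (G : Fin N → Series n) → f *ₛ sumₛ N G ≈ₛ sumₛ N (λ i → f *ₛ G i)
    *ₛ-sumˡ N f G γ = K.trans (*ₛ-comm f _ γ)
      (K.trans (*ₛ-sumʳ N G f γ) (sum-cong-≋ {N} (λ i → *ₛ-comm (G i) f γ)))

  *ₛ-assoc : ∀ {n} (f g h : Series n) → (f *ₛ g) *ₛ h ≈ₛ f *ₛ (g *ₛ h)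
  *ₛ-assoc f g h []      = K.*-assoc _ _ _
  *ₛ-assoc f g h (k ∷ γ) = begin
    antidiagonal (λ i r → (((f *ₛ g) at i) *ₛ (h at r)) γ) k
      ≈⟨ antidiagonal-cong (λ i r → *ₛ-sumʳ (suc i) (λ j → (f at toℕ j) *ₛ (g at (i ∸ toℕ j))) (h at r) γ) k ⟩
    antidiagonal (λ i r → antidiagonal (λ j l → (((f at j) *ₛ (g at l)) *ₛ (h at r)) γ) i) k
      ≈⟨ antidiagonal-assoc (λ j l r → (((f at j) *ₛ (g at l)) *ₛ (h at r)) γ) k ⟩
    antidiagonal (λ j r → antidiagonal (λ l q → (((f at j) *ₛ (g at l)) *ₛ (h at q)) γ) r) k
      ≈⟨ antidiagonal-cong (λ j r → antidiagonal-cong (λ l q → *ₛ-assoc (f at j) (g at l) (h at q) γ) r) k ⟩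
    antidiagonal (λ j r → antidiagonal (λ l q → ((f at j) *ₛ ((g at l) *ₛ (h at q))) γ) r) k
      ≈⟨ antidiagonal-cong (λ j r → *ₛ-sumˡ (suc r) (f at j) (λ l → (g at toℕ l) *ₛ (h at (r ∸ toℕ l))) γ) k ⟨
    antidiagonal (λ j r → ((f at j) *ₛ ((g *ₛ h) at r)) γ) k ∎

  *ₛ-constantˡ : ∀ {n} u (g : Series n) → constant u *ₛ g ≈ₛ (λ α → u K.* g α)
  *ₛ-constantˡ u g []      = K.refl
  *ₛ-constantˡ u g (k ∷ γ) = K.trans
    (K.+-cong (*ₛ-constantˡ u (g at k) γ)
      (K.trans (sum-cong-≋ {k} (λ i → *ₛ-zeroˡ _ (g at (k ∸ suc (toℕ i))) (λ _ → K.refl) γ)) (sum-replicate-zero k)))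
    (K.+-identityʳ _)

  *ₛ-identityˡ : ∀ {n} (g : Series n) → constant 1# *ₛ g ≈ₛ g
  *ₛ-identityˡ g α = K.trans (*ₛ-constantˡ 1# g α) (K.*-identityˡ _)

  commutativeRing : ℕ → CommutativeRing _ _
  commutativeRing n = record
    { Carrier = Series n ; _≈_ = _≈ₛ_ ; _+_ = _+ₛ_ ; _*_ = _*ₛ_ ; -_ = -ₛ_
    ; 0# = λ _ → 0# ; 1# = constant 1#
    ; isCommutativeRing = record
      { isRing = record
        { +-isAbelianGroup = record
          { isGroup = record
            { isMonoid = record
              { isSemigroup = record
                { isMagma = record
                  { isEquivalence = record
                    { refl = λ _ → K.refl ; sym = λ p α → K.sym (p α) ; trans = λ p q α → K.trans (p α) (q α) }
                  ; ∙-cong = λ p q α → K.+-cong (p α) (q α) }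
                ; assoc = λ f g h α → K.+-assoc _ _ _ }
              ; identity = (λ f α → K.+-identityˡ _) , (λ f α → K.+-identityʳ _) }
            ; inverse = (λ f α → K.-‿inverseˡ _) , (λ f α → K.-‿inverseʳ _)
            ; ⁻¹-cong = λ p α → K.-‿cong (p α) }
          ; comm = λ f g α → K.+-comm _ _ }
        ; *-cong = *ₛ-cong
        ; *-assoc = *ₛ-assoc
        ; *-identity = *ₛ-identityˡ , λ g α → K.trans (*ₛ-comm g _ α) (*ₛ-identityˡ g α)
        ; distrib = *ₛ-distribˡ , *ₛ-distribʳ }
      ; *-comm = *ₛ-comm } }

  *ₛ-variable-suc : ∀ {n} i (g : Series n) α → (indeterminate i *ₛ g) (updateAt α i suc) ≈ g α
  *ₛ-variable-suc Fin.zero g (k ∷ α) = begin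
    ((λ _ → 0#) *ₛ (g at suc k)) α K.+ ((constant 1# *ₛ (g at k)) α K.+
      ∑[ i < k ] ((λ _ → 0#) *ₛ (g at (k ∸ suc (toℕ i)))) α)
      ≈⟨ K.+-cong (*ₛ-zeroˡ _ (g at suc k) (λ _ → K.refl) α)
          (K.+-cong (*ₛ-identityˡ (g at k) α)
            (K.trans (sum-cong-≋ {k} (λ i → *ₛ-zeroˡ _ (g at (k ∸ suc (toℕ i))) (λ _ → K.refl) α))
              (sum-replicate-zero k))) ⟩
    0# K.+ (g (k ∷ α) K.+ 0#)  ≈⟨ K.+-identityˡ _ ⟩
    g (k ∷ α) K.+ 0#           ≈⟨ K.+-identityʳ _ ⟩
    g (k ∷ α)                  ∎
  *ₛ-variable-suc (Fin.suc i) g (k ∷ α) = K.trans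
    (K.+-cong (*ₛ-variable-suc i (g at k) α)
      (K.trans (sum-cong-≋ {k} (λ t → *ₛ-zeroˡ _ (g at (k ∸ suc (toℕ t))) (λ _ → K.refl) (updateAt α i suc))) (sum-replicate-zero k)))
    (K.+-identityʳ _)

  *ₛ-variable-zero : ∀ {n} i (g : Series n) α → lookup α i ≡ 0 → (indeterminate i *ₛ g) α ≈ 0#
  *ₛ-variable-zero Fin.zero g (zero ∷ α) _ =
    K.trans (K.+-identityʳ _) (*ₛ-zeroˡ _ (g at 0) (λ _ → K.refl) α)
  *ₛ-variable-zero (Fin.suc i) g (k ∷ α) eq = K.trans
    (K.+-cong (*ₛ-variable-zero i (g at k) α eq)
      (K.trans (sum-cong-≋ {k} (λ i → *ₛ-zeroˡ _ (g at (k ∸ suc (toℕ i))) (λ _ → K.refl) α)) (sum-replicate-zero k)))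
    (K.+-identityʳ _)

  private
    telescope : ∀ (f g : ℕ → Carrier) N → (∀ k → k ℕ.< N → g k ≈ f (suc k)) → g N ≈ 0# →
                ∑[ k ≤ N ] (f (toℕ k) K.- g (toℕ k)) ≈ f 0
    telescope f g zero    eq z = begin
      f 0 K.- g 0 K.+ 0#  ≈⟨ K.+-identityʳ _ ⟩
      f 0 K.- g 0         ≈⟨ K.+-congˡ (K.-‿cong z) ⟩
      f 0 K.- 0#          ≈⟨ K.+-congˡ -0#≈0# ⟩
      f 0 K.+ 0#          ≈⟨ K.+-identityʳ _ ⟩
      f 0                 ∎
      where open Algebra.Properties.Ring K.ring
    telescope f g (suc N) eq z = begin
      f 0 K.- g 0 K.+ ∑[ k ≤ N ] (f (suc (toℕ k)) K.- g (suc (toℕ k)))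
        ≈⟨ K.+-congˡ (telescope (f ∘ suc) (g ∘ suc) N (λ k k< → eq (suc k) (s≤s k<)) z) ⟩
      f 0 K.- g 0 K.+ f 1      ≈⟨ K.+-assoc _ _ _ ⟩
      f 0 K.+ (K.- g 0 K.+ f 1)  ≈⟨ K.+-congˡ (K.+-congˡ (eq 0 (s≤s z≤n))) ⟨
      f 0 K.+ (K.- g 0 K.+ g 0)  ≈⟨ K.+-congˡ (K.-‿inverseˡ _) ⟩
      f 0 K.+ 0#                 ≈⟨ K.+-identityʳ _ ⟩
      f 0                        ∎

  private
    updateAt-∸-suc : ∀ {n} (α : Exponent n) j k → k ℕ.< lookup α j →
                     updateAt α j (_∸ k) ≡ updateAt (updateAt α j (_∸ suc k)) j suc
    updateAt-∸-suc α j k k< = ≡.sym (Vecₚ.updateAt-updateAt-local j α (lemma k<))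
      where
      lemma : ∀ {k l} → k ℕ.< l → suc (l ∸ suc k) ≡ l ∸ k
      lemma {k} {l} k<l = ≡.sym (ℕₚ.+-∸-assoc 1 k<l)

  divDiff-unique : ∀ {n} {i j : Fin n} → i ≢ j → ∀ p q →
                   (indeterminate i +ₛ -ₛ indeterminate j) *ₛ q ≈ₛ p → divDiff i j p ≈ₛ q
  divDiff-unique {n} {i} {j} i≢j p q eq α = begin
    ∑[ k ≤ N ] p (δ′ (toℕ k))
      ≈⟨ sum-cong-≋ {suc N} (λ k → K.sym (expand (δ′ (toℕ k)))) ⟩
    ∑[ k ≤ N ] ((indeterminate i *ₛ q) (δ′ (toℕ k)) K.- (indeterminate j *ₛ q) (δ′ (toℕ k)))
      ≈⟨ telescope (λ k → (indeterminate i *ₛ q) (δ′ k)) (λ k → (indeterminate j *ₛ q) (δ′ k)) N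
           (λ k k< → K.trans (right k k<) (K.sym (left (suc k)))) last ⟩
    (indeterminate i *ₛ q) (δ′ 0)
      ≈⟨ left 0 ⟩
    q (δ 0)
      ≡⟨ ≡.cong q (≡.trans (Vecₚ.updateAt-id i _) (Vecₚ.updateAt-id j α)) ⟩
    q α ∎
    where
    N = lookup α j
    δ δ′ : ℕ → Exponent n
    δ  k = move α j k i k
    δ′ k = move α j k i (suc k)

    expand : ∀ β → (indeterminate i *ₛ q) β K.- (indeterminate j *ₛ q) β ≈ p β
    expand β = begin
      (indeterminate i *ₛ q) β K.- (indeterminate j *ₛ q) β
        ≈⟨ K.+-congˡ (-‿distribˡ-* (indeterminate j) q β) ⟩
      (indeterminate i *ₛ q) β K.+ ((-ₛ indeterminate j) *ₛ q) β
        ≈⟨ *ₛ-distribʳ q (indeterminate i) (-ₛ indeterminate j) β ⟨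
      ((indeterminate i +ₛ -ₛ indeterminate j) *ₛ q) β
        ≈⟨ eq β ⟩
      p β ∎
      where open Algebra.Properties.Ring (CommutativeRing.ring (commutativeRing n))

    left : ∀ k → (indeterminate i *ₛ q) (δ′ k) ≈ q (δ k)
    left k = K.trans
      (K.reflexive (≡.cong (indeterminate i *ₛ q) (≡.sym (Vecₚ.updateAt-updateAt i (updateAt α j (_∸ k))))))
      (*ₛ-variable-suc i q (δ k))

    right : ∀ k → k ℕ.< N → (indeterminate j *ₛ q) (δ′ k) ≈ q (δ (suc k))
    right k k< = K.trans
      (K.reflexive (≡.cong (indeterminate j *ₛ q) (≡.trans
        (≡.cong (λ β → updateAt β i (suc k ℕ.+_)) (updateAt-∸-suc α j k k<))
        (Vecₚ.updateAt-commutes i j i≢j (updateAt α j (_∸ suc k))))))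
      (*ₛ-variable-suc j q (δ (suc k)))

    last : (indeterminate j *ₛ q) (δ′ N) ≈ 0#
    last = *ₛ-variable-zero j q (δ′ N) (≡.trans
      (Vecₚ.lookup∘updateAt′ j i (i≢j ∘ ≡.sym) (updateAt α j (_∸ N)))
      (≡.trans (Vecₚ.lookup∘updateAt j α) (ℕₚ.n∸n≡0 N)))

  private
    if-true : ∀ {A : Set} (d : Dec A) {x y : Carrier} → A → (if does d then x else y) ≡ x
    if-true (yes _) a = ≡.refl
    if-true (no ¬a) a = contradiction a ¬a

    if-false : ∀ {A : Set} (d : Dec A) {x y : Carrier} → ¬ A → (if does d then x else y) ≡ y
    if-false (yes a) ¬a = contradiction a ¬a
    if-false (no _)  _  = ≡.refl

    geometric-suc : ∀ {n} u (j : Fin n) β → geometric u j (updateAt β j suc) ≈ u K.* geometric u j β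
    geometric-suc u j β with β ≟ᵉ lookup β j ·e j
    ... | yes eq = begin
      geometric u j (updateAt β j suc)           ≡⟨ if-true (_ ≟ᵉ _) (step (lookup β j) eq) ⟩
      u ^ lookup (updateAt β j suc) j            ≡⟨ ≡.cong (u ^_) (Vecₚ.lookup∘updateAt j β) ⟩
      u K.* u ^ lookup β j                       ∎
      where
      step : ∀ k → β ≡ k ·e j → updateAt β j suc ≡ lookup (updateAt β j suc) j ·e j
      step k ≡.refl = ≡.trans (suc-·e k j) (≡.cong (_·e j) (≡.sym
        (≡.trans (Vecₚ.lookup∘updateAt j (k ·e j)) (≡.cong suc (lookup-·e k j)))))
    ... | no ¬eq = K.trans
      (K.reflexive (if-false (_ ≟ᵉ _) (¬eq ∘ ·e-support (lookup (updateAt β j suc) j) j β)))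
      (K.sym (K.zeroʳ u))

  geometric-inverse : ∀ {n} u (j : Fin n) →
    (constant 1# +ₛ -ₛ (constant u *ₛ indeterminate j)) *ₛ geometric u j ≈ₛ constant 1#
  geometric-inverse {n} u j α = begin
    ((constant 1# +ₛ -ₛ (constant u *ₛ indeterminate j)) *ₛ g) α
      ≈⟨ *ₛ-distribʳ g (constant 1#) (-ₛ (constant u *ₛ indeterminate j)) α ⟩
    (constant 1# *ₛ g) α K.+ ((-ₛ (constant u *ₛ indeterminate j)) *ₛ g) α
      ≈⟨ K.+-cong (*ₛ-identityˡ g α) (K.sym (-‿distribˡ-* (constant u *ₛ indeterminate j) g α)) ⟩
    g α K.- ((constant u *ₛ indeterminate j) *ₛ g) α
      ≈⟨ K.+-congˡ (K.-‿cong (K.trans (*ₛ-assoc (constant u) (indeterminate j) g α) (*ₛ-constantˡ u (indeterminate j *ₛ g) α))) ⟩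
    g α K.- u K.* (indeterminate j *ₛ g) α
      ≈⟨ cases (lookup α j ℕₚ.≟ 0) ⟩
    constant 1# α ∎
    where
    open Algebra.Properties.Ring (CommutativeRing.ring (commutativeRing n)) using (-‿distribˡ-*)
    open Algebra.Properties.Ring K.ring using (-0#≈0#)
    g = geometric u j

    suc-case : ∀ β → g (updateAt β j suc) K.- u K.* (indeterminate j *ₛ g) (updateAt β j suc)
                     ≈ constant 1# (updateAt β j suc)
    suc-case β = begin
      g (updateAt β j suc) K.- u K.* (indeterminate j *ₛ g) (updateAt β j suc)
        ≈⟨ K.+-cong (geometric-suc u j β) (K.-‿cong (K.*-congˡ (*ₛ-variable-suc j g β))) ⟩
      u K.* g β K.- u K.* g β           ≈⟨ K.-‿inverseʳ _ ⟩
      0#                                ≡⟨ if-false (_ ≟ᵉ _) (suc·e≢𝟎 β j) ⟨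
      constant 1# (updateAt β j suc)    ∎

    geometric-0 : ∀ k → k ≡ 0 → (if does (α ≟ᵉ k ·e j) then u ^ k else 0#) ≡ constant 1# α
    geometric-0 k ≡.refl = ≡.cong (λ β → if does (α ≟ᵉ β) then 1# else 0#) (0·e≡𝟎 j)

    cases : Dec (lookup α j ≡ 0) → g α K.- u K.* (indeterminate j *ₛ g) α ≈ constant 1# α
    cases (yes eq) = begin
      g α K.- u K.* (indeterminate j *ₛ g) α  ≈⟨ K.+-congˡ (K.-‿cong (K.trans (K.*-congˡ (*ₛ-variable-zero j g α eq)) (K.zeroʳ u))) ⟩
      g α K.- 0#                          ≈⟨ K.trans (K.+-congˡ -0#≈0#) (K.+-identityʳ _) ⟩
      g α                                 ≡⟨ geometric-0 (lookup α j) eq ⟩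
      constant 1# α                       ∎
    cases (no ≢0) = ≡.subst (λ β → g β K.- u K.* (indeterminate j *ₛ g) β ≈ constant 1# β)
      (≡.sym (add-sub α j ≢0)) (suc-case (updateAt α j (_∸ 1)))

-- A polynomial is a power series of bounded total degree. The bound is
-- not part of its identity: equality is equality of coefficients.
module Polynomials (K : CommutativeRing c ℓ) where
  private module K = CommutativeRing K
  open K using (Carrier; _≈_; 0#; 1#)
  open Series K hiding (commutativeRing)
  open Algebra.Properties.Semiring.Sum K.semiring

  record Polynomial (n : ℕ) : Set (c ⊔ ℓ) where
    constructor polynomial
    field
      coeff  : Series n
      bound  : ℕ
      vanish : ∀ α → bound ℕ.< degree α → coeff α ≈ 0#
  open Polynomial public

  constantₚ : ∀ {n} → Carrier → Polynomial n
  constantₚ u .coeff = constant u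
  constantₚ u .bound = 0
  constantₚ {n} u .vanish α 0<α with α ≟ᵉ 𝟎
  ... | yes ≡.refl = contradiction (≡.sym (degree-𝟎 n)) (ℕₚ.<⇒≢ 0<α)
  ... | no _       = K.refl

  indeterminateₚ : ∀ {n} → Fin n → Polynomial n
  indeterminateₚ i .coeff = indeterminate i
  indeterminateₚ i .bound = 1
  indeterminateₚ i .vanish α 1<α with α ≟ᵉ 1 ·e i
  ... | yes ≡.refl = contradiction (≡.sym (degree-·e 1 i)) (ℕₚ.<⇒≢ 1<α)
  ... | no _       = K.refl

  divDiffₚ : ∀ {n} → Fin n → Fin n → Polynomial n → Polynomial n
  divDiffₚ i j p .coeff = divDiff i j (p .coeff)
  divDiffₚ i j p .bound = p .bound
  divDiffₚ i j p .vanish α b<α = K.trans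
    (sum-cong-≋ {suc (lookup α j)} (λ k → p .vanish (move α j (toℕ k) i (suc (toℕ k)))
      (≡.subst (p .bound ℕ.<_) (≡.sym (degree-move α i j (toℕ k) (toℕ≤pred[n] k))) (ℕₚ.m<n⇒m<1+n b<α))))
    (sum-replicate-zero (suc (lookup α j)))

  commutativeRing : ℕ → CommutativeRing _ _
  commutativeRing n = record
    { Carrier = Polynomial n
    ; _≈_ = λ p q → p .coeff ≈ₛ q .coeff
    ; _+_ = λ p q → polynomial (p .coeff +ₛ q .coeff) (p .bound ℕ.⊔ q .bound)
        (λ α b<α → K.trans (K.+-cong (p .vanish α (ℕₚ.m⊔n<o⇒m<o _ _ b<α)) (q .vanish α (ℕₚ.m⊔n<o⇒n<o _ _ b<α))) (K.+-identityˡ 0#))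
    ; _*_ = λ p q → polynomial (p .coeff *ₛ q .coeff) (p .bound ℕ.+ q .bound) (*-vanish p q)
    ; -_ = λ p → polynomial (-ₛ p .coeff) (p .bound)
        (λ α b<α → K.trans (K.-‿cong (p .vanish α b<α)) -0#≈0#)
    ; 0# = polynomial (λ _ → 0#) 0 (λ _ _ → K.refl)
    ; 1# = constantₚ 1#
    ; isCommutativeRing = record
      { isRing = record
        { +-isAbelianGroup = record
          { isGroup = record
            { isMonoid = record
              { isSemigroup = record
                { isMagma = record
                  { isEquivalence = record { refl = S.refl ; sym = S.sym ; trans = S.trans }
                  ; ∙-cong = S.+-cong }
                ; assoc = λ p q r → S.+-assoc (p .coeff) (q .coeff) (r .coeff) }
              ; identity = (λ p → S.+-identityˡ (p .coeff)) , (λ p → S.+-identityʳ (p .coeff)) }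
            ; inverse = (λ p → S.-‿inverseˡ (p .coeff)) , (λ p → S.-‿inverseʳ (p .coeff))
            ; ⁻¹-cong = S.-‿cong }
          ; comm = λ p q → S.+-comm (p .coeff) (q .coeff) }
        ; *-cong = S.*-cong
        ; *-assoc = λ p q r → S.*-assoc (p .coeff) (q .coeff) (r .coeff)
        ; *-identity = (λ p → S.*-identityˡ (p .coeff)) , (λ p → S.*-identityʳ (p .coeff))
        ; distrib = (λ p q r → S.distribˡ (p .coeff) (q .coeff) (r .coeff))
                  , (λ p q r → S.distribʳ (p .coeff) (q .coeff) (r .coeff)) }
      ; *-comm = λ p q → S.*-comm (p .coeff) (q .coeff) } }
    where
    module S = CommutativeRing (Series.commutativeRing K n)
    open Algebra.Properties.Ring K.ring using (-0#≈0#)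

    *-vanish : (p q : Polynomial n) → ∀ γ → p .bound ℕ.+ q .bound ℕ.< degree γ →
               (p .coeff *ₛ q .coeff) γ ≈ 0#
    *-vanish p q γ b<γ = *ₛ-vanish (p .coeff) (q .coeff) γ zeros
      where
      zeros : ∀ α β → zipWith ℕ._+_ α β ≡ γ → p .coeff α K.* q .coeff β ≈ 0#
      zeros α β ≡.refl with p .bound ℕₚ.<? degree α | q .bound ℕₚ.<? degree β
      ... | yes b<α | _       = K.trans (K.*-congʳ (p .vanish α b<α)) (K.zeroˡ _)
      ... | no _    | yes b<β = K.trans (K.*-congˡ (q .vanish β b<β)) (K.zeroʳ _)
      ... | no b≮α  | no b≮β  = contradiction (≡.subst (_ ℕ.<_) (degree-zipWith-+ α β) b<γ)
        (ℕₚ.≤⇒≯ (ℕₚ.+-mono-≤ (ℕₚ.≮⇒≥ b≮α) (ℕₚ.≮⇒≥ b≮β)))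

module Determinants (R : CommutativeRing c ℓ) where
  open CommutativeRing R
  open Algebra.Definitions.RawSemiring (Semiring.rawSemiring semiring) using (sum; _^_)

  det : ∀ {n} → (Fin n → Fin n → Carrier) → Carrier
  det {zero}  A = 1#
  det {suc n} A = sum λ j →
    (- 1#) ^ toℕ j * A Fin.zero j * det (λ r s → A (Fin.suc r) (punchIn j s))

increasingPairs : ∀ n → List (Fin n × Fin n)
increasingPairs n = filter (λ (i , j) → i Finₚ.<? j) (cartesianProduct (allFin n) (allFin n))

-- divide i j p plays the role of p / (zᵢ - zⱼ), so that p /Δ is the
-- quotient of p by ∏_{i<j} (zᵢ - zⱼ) (see /Δ-unique). It is only applied
-- below to determinants that are alternating in z, for which the quotient
-- exists.
module Vandermonde (R : CommutativeRing c ℓ) {n : ℕ} (z : Fin n → CommutativeRing.Carrier R)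
  (divide : Fin n → Fin n → CommutativeRing.Carrier R → CommutativeRing.Carrier R) where
  open CommutativeRing R

  Δ : Carrier
  Δ = foldr (λ (i , j) p → (z i - z j) * p) 1# (increasingPairs n)

  _/Δ : Carrier → Carrier
  p /Δ = foldl (λ q (i , j) → divide i j q) p (increasingPairs n)

  /Δ-unique : (∀ {i j} → i ≢ j → ∀ p q → (z i - z j) * q ≈ p → divide i j p ≈ q) →
              ∀ p q → Δ * q ≈ p → p /Δ ≈ q
  /Δ-unique unique = go (increasingPairs n)
    (All.map Finₚ.<⇒≢ (all-filter (λ (i , j) → i Finₚ.<? j) (cartesianProduct (allFin n) (allFin n))))
    where
    go : ∀ ps → All (λ (i , j) → i ≢ j) ps → ∀ p q →
         foldr (λ (i , j) p → (z i - z j) * p) 1# ps * q ≈ p →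
         foldl (λ q (i , j) → divide i j q) p ps ≈ q
    go []       []           p q eq = trans (sym eq) (*-identityˡ q)
    go (_ ∷ ps) (i≢j ∷ ps≢) p q eq = go ps ps≢ _ q
      (sym (unique i≢j p _ (trans (sym (*-assoc _ _ q)) eq)))

record Partition : Set where
  field
    parts      : List ℕ
    positive   : All (0 ℕ.<_) parts
    decreasing : Linked ℕ._≥_ parts

part : List ℕ → ℕ → ℕ
part []       _       = 0
part (p ∷ _)  zero    = p
part (_ ∷ ps) (suc j) = part ps j

-- Rows are numbered from 0: row μ j is the part with index j + 1.
row : Partition → ℕ → ℕ
row μ = part (Partition.parts μ)

len : Partition → ℕ
len μ = length (Partition.parts μ)

-- The diagram contains the box (j , j) exactly when j ≤ μⱼ.
diagonal : Partition → ℕ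
diagonal μ = length (filter (λ j → suc j ℕₚ.≤? row μ j) (upTo (len μ)))

-- Indices i, j of variables and columns are elements of Fin n, so they
-- are one less than in the usual formulas.
module Schur (K : CommutativeRing c ℓ) (a : ℤ → CommutativeRing.Carrier K) where

  K[x_] : ℕ → CommutativeRing _ _
  K[x n ] = Polynomials.commutativeRing K n

  K[[y_]] : ℕ → CommutativeRing _ _
  K[[y m ]] = Series.commutativeRing K m

  K[x_][[y_]] : ℕ → ℕ → CommutativeRing _ _
  K[x n ][[y m ]] = Series.commutativeRing K[x n ] m

  module _ (n : ℕ) where
    open Polynomials K using (Polynomial; coeff; constantₚ; indeterminateₚ; divDiffₚ)
    open CommutativeRing K[x n ]
    open Algebra.Definitions.RawSemiring (Semiring.rawSemiring semiring) using (product)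
    open Determinants K[x n ] using (det)

    -- (xᵢ‖a)ʳ, that is (xᵢ - aₙ)(xᵢ - aₙ₋₁)⋯(xᵢ - aₙ₋ᵣ₊₁)
    factorialPower : Fin n → ℕ → Polynomial n
    factorialPower i r = product {r} λ k → indeterminateₚ i - constantₚ (a (ℤ.+ n ℤ.- ℤ.+ toℕ k))

    open Vandermonde K[x n ] indeterminateₚ divDiffₚ public
      using () renaming (Δ to Δˣ; _/Δ to _/Δˣ)

    /Δˣ-unique : ∀ p q → Δˣ * q ≈ p → p /Δˣ ≈ q
    /Δˣ-unique = Vandermonde./Δ-unique K[x n ] indeterminateₚ divDiffₚ
      (λ i≢j p q → Series.divDiff-unique K i≢j (p .coeff) (q .coeff))

    doubleSchur : Partition → Polynomial n
    doubleSchur μ = if does (len μ ℕₚ.≤? n)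
      then det (λ i j → factorialPower i (row μ (toℕ j) ℕ.+ (n ∸ suc (toℕ j)))) /Δˣ
      else 0#

  module _ (m : ℕ) where
    open Series K using (Series; constant; geometric; divDiff) renaming (indeterminate to y)
    open CommutativeRing K[[y m ]]
    open Algebra.Definitions.RawSemiring (Semiring.rawSemiring semiring) using (product; _^_)
    open Determinants K[[y m ]] using (det)

    open Vandermonde K[[y m ]] y divDiff public
      using () renaming (Δ to Δʸ; _/Δ to _/Δʸ)

    /Δʸ-unique : ∀ p q → Δʸ * q ≈ p → p /Δʸ ≈ q
    /Δʸ-unique = Vandermonde./Δ-unique K[[y m ]] y divDiff (Series.divDiff-unique K)

    dualEntry : Partition → Fin m → Fin m → Series m
    dualEntry μ i j = y i ^ (row μ (toℕ j) ℕ.+ (m ∸ suc (toℕ j))) *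
      (if does (suc (toℕ j) ℕₚ.≤? diagonal μ)
        then product {row μ (toℕ j) ∸ toℕ j} (λ k → geometric (a (ℤ.- ℤ.+ toℕ k)) i)
        else product {toℕ j ∸ row μ (toℕ j)} (λ k → 1# - constant (a (ℤ.+ suc (toℕ k))) * y i))

    dualSchur : Partition → Series m
    dualSchur μ = if does (len μ ℕₚ.≤? m) then det (dualEntry μ) /Δʸ else 0#

  infixl 7 _⊛_
  _⊛_ : ∀ {n m} → Polynomials.Polynomial K n → Series.Series K m → Series.Series K[x n ] m
  _⊛_ {n} p f α = p * Polynomials.constantₚ K (f α)
    where open CommutativeRing K[x n ]

  module _ (n m : ℕ) where
    open Polynomials K using (constantₚ; indeterminateₚ)
    open Series K[x n ] using (Series; constant; geometric) renaming (indeterminate to y)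
    open CommutativeRing K[x n ][[y m ]]
    open Algebra.Definitions.RawSemiring (Semiring.rawSemiring semiring) using (product)

    cauchyProduct : Series m
    cauchyProduct = product {n} λ i → product {m} λ j →
      (1# - constant (constantₚ (a (ℤ.+ suc (toℕ i)))) * y j) * geometric (indeterminateₚ i) j

open Schur ℚ[a] ind public
  renaming (K[x_] to ℚ[a][x_]; K[[y_]] to ℚ[a][[y_]]; K[x_][[y_]] to ℚ[a][x_][[y_]])

{-# OPTIONS --safe #-}

-- For a ring with nilpotent y, the double Schur numerator det[(xᵢ‖a)^l]
-- and the dual one det[y^l q_{l+1}(y)] depend on λ only through the
-- exponents l₁ > l₂ > ⋯, and the factors q satisfy qₗ = (1 - aₙ₋ₗ y) qₗ₊₁.
-- Hence ∑ₗ (x‖a)ˡ yˡ qₗ₊₁ telescopes to (1 - a₁ y)⋯(1 - aₙ y) / (1 - x y),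
-- and Cauchy–Binet turns ∑_λ of the products of numerators into a single
-- determinant. If n ≠ m, the parts of λ beyond min(n , m) vanish and give
-- |n - m| fixed rows; row operations reduce these to monomials, and what
-- is left is the (mixed) Cauchy determinant
-- Δ(x) Δ(y) ∏ 1 / (1 - xᵢ yⱼ).
--
-- Division by Δ(x) and Δ(y) is an iterated divided difference, hence
-- additive, so it can be applied to the whole sum Δ(x) Δ(y) ∏ (⋯) at once:
-- only the uniqueness of the quotient is needed, never its existence for
-- an individual alternant. Convergence in y is dealt with by working
-- modulo the terms of large degree in y, where all sums are finite.

module Submission where

open import Defs
open import Data.Nat.Base using (ℕ)

open import Algebra.Bundles using (CommutativeMonoid; CommutativeRing; RawRing; Semiring)
import Algebra.Definitions.RawSemiring
import Algebra.Morphism.Construct.Identity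
open import Algebra.Morphism.Structures using (module RingMorphisms)
import Algebra.Properties.AbelianGroup
import Algebra.Properties.CommutativeSemigroup
import Algebra.Properties.Ring
import Algebra.Properties.Semiring.Exp
import Algebra.Properties.Semiring.Mult.TCOptimised
import Algebra.Properties.Semiring.Sum
import Algebra.Solver.Ring
import Algebra.Solver.Ring.AlmostCommutativeRing as ACR
open import Data.Bool.Base using (if_then_else_)
open import Data.Fin.Base as Fin using (Fin; toℕ; punchIn)
import Data.Fin.Properties as Finₚ
open import Data.Integer.Base as ℤ using (ℤ)
import Data.Integer.Properties as ℤₚ
open import Data.List.Base as List
  using (List; []; _∷_; _++_; map; foldl; length; drop; downFrom; filter; applyUpTo; tabulate; allFin; cartesianProduct)
open import Data.List.Membership.Propositional using (_∈_; _∉_)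
open import Data.List.Membership.Propositional.Properties using (∈-++⁺ˡ; ∈-++⁺ʳ; ∈-map⁺; ∈-map⁻)
import Data.List.Properties as Listₚ
open import Data.List.Relation.Binary.Pointwise as Pointwise using (Pointwise; []; _∷_)
open import Data.List.Relation.Unary.All as All using (All; []; _∷_)
import Data.List.Relation.Unary.All.Properties as Allₚ
open import Data.List.Relation.Unary.AllPairs using ([]; _∷_)
open import Data.List.Relation.Unary.Any using (here; there)
open import Data.List.Relation.Unary.Linked as Linked using (Linked; []; [-]; _∷_)
open import Data.List.Relation.Unary.Unique.Propositional using (Unique)
import Data.List.Relation.Unary.Unique.Propositional.Properties as Uniqueₚ
open import Data.Maybe.Base using (Maybe; nothing; just)
open import Data.Nat.Base as ℕ using (zero; suc; _∸_; z≤n; s≤s)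
import Data.Nat.Properties as ℕₚ
open import Data.Product.Base using (_×_; _,_; proj₁; proj₂; Σ-syntax)
open import Data.Sum.Base using (inj₁; inj₂)
open import Data.Vec.Base using ([]; _∷_; lookup; zipWith)
open import Function.Base using (_∘_; flip; id)
open import Level using (Level; _⊔_)
open import Relation.Binary.PropositionalEquality as ≡ using (_≡_)
import Relation.Binary.Reasoning.Setoid
open import Relation.Nullary using (Dec; does; yes; no; ¬_; contradiction)
open import Relation.Unary using (Pred; Decidable)

-- The obstacle is that the sum over λ is infinite while Cauchy-Binet is finite. Truncation keeps
-- the carrier of K[x][[y]] and only coarsens its equality to agreement up to total degree D in y,
-- so no series has to be converted. There every y to the power D + 1 vanishes, and the partitions
-- that matter form the finite box λ₁ + min(n , m) ≤ D + 1. One coefficient of the quotient by Δ(y)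
-- needs one more degree for every factor of Δ(y), so D is the degree of that coefficient plus the
-- number of these factors. Row operations are carried out for an arbitrary alternating function of
-- a list of rows: with some rows held fixed it is again alternating, so an induction on the list
-- reaches any row without index arithmetic. The fixed rows belong to the dual alternant if n < m
-- and to the double alternant if n > m. In the second case telescoping yields only m of the n
-- numerator factors for each y, and the reduction of the rows in x supplies the others.

private variable
  c ℓ c′ ℓ′ ℓ₁ ℓ₂ : Level
  A : Set ℓ₁
  B : Set ℓ₂

-- A ring solver with integer coefficients

-- The coefficient (p , q) of the solver stands for the integer p − q.
module IntegerSolver (R : CommutativeRing c ℓ) where
  open CommutativeRing R
  open Algebra.Properties.Ring ring using (x[y-z]≈xy-xz; [y-z]x≈yx-zx; -0#≈0#)
  open Algebra.Properties.AbelianGroup +-abelianGroup using (⁻¹-anti-homo‿-; ⁻¹-∙-comm)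
  open Algebra.Properties.Semiring.Mult.TCOptimised semiring using (×-homo-+; ×1-homo-*) renaming (_×_ to _·_)
  open Relation.Binary.Reasoning.Setoid setoid

  private
    module +-CS = Algebra.Properties.CommutativeSemigroup (CommutativeMonoid.commutativeSemigroup +-commutativeMonoid)

    Difference : RawRing _ _
    Difference = record
      { Carrier = ℕ × ℕ
      ; _≈_ = _≡_
      ; _+_ = λ (p , q) (r , s) → p ℕ.+ r , q ℕ.+ s
      ; _*_ = λ (p , q) (r , s) → p ℕ.* r ℕ.+ q ℕ.* s , p ℕ.* s ℕ.+ q ℕ.* r
      ; -_ = λ (p , q) → q , p
      ; 0# = 0 , 0
      ; 1# = 1 , 0
      }

    ν : ℕ → Carrier
    ν n = n · 1#

    difference-+ : ∀ u v x y → (u + x) - (v + y) ≈ (u - v) + (x - y)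
    difference-+ u v x y = trans (+-congˡ (sym (⁻¹-∙-comm v y))) (+-CS.interchange u x (- v) (- y))

    difference-cong : ∀ {u v x y} → u + y ≈ v + x → u - v ≈ x - y
    difference-cong {u} {v} {x} {y} eq = begin
      u - v                ≈⟨ +-identityʳ _ ⟨
      (u - v) + 0#         ≈⟨ +-congˡ (-‿inverseʳ y) ⟨
      (u - v) + (y - y)    ≈⟨ difference-+ u v y y ⟨
      (u + y) - (v + y)    ≈⟨ +-congʳ eq ⟩
      (v + x) - (v + y)    ≈⟨ difference-+ v v x y ⟩
      (v - v) + (x - y)    ≈⟨ +-congʳ (-‿inverseʳ v) ⟩
      0# + (x - y)         ≈⟨ +-identityˡ _ ⟩
      x - y                ∎

    difference-* : ∀ u v x y → (u * x + v * y) - (u * y + v * x) ≈ (u - v) * (x - y)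
    difference-* u v x y = begin
      (u * x + v * y) - (u * y + v * x)    ≈⟨ difference-+ (u * x) (u * y) (v * y) (v * x) ⟩
      (u * x - u * y) + (v * y - v * x)    ≈⟨ +-congˡ (⁻¹-anti-homo‿- (v * x) (v * y)) ⟨
      (u * x - u * y) - (v * x - v * y)    ≈⟨ +-cong (x[y-z]≈xy-xz u x y) (-‿cong (x[y-z]≈xy-xz v x y)) ⟨
      u * (x - y) - v * (x - y)            ≈⟨ [y-z]x≈yx-zx (x - y) u v ⟨
      (u - v) * (x - y)                    ∎

    ν-sum-of-products : ∀ p r q s → ν (p ℕ.* r ℕ.+ q ℕ.* s) ≈ ν p * ν r + ν q * ν s
    ν-sum-of-products p r q s = trans (×-homo-+ 1# (p ℕ.* r) (q ℕ.* s)) (+-cong (×1-homo-* p r) (×1-homo-* q s))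

    open ACR using (_-Raw-AlmostCommutative⟶_; fromCommutativeRing)

    -- The case `zero` is separate so that the literals `𝟙` and `𝟘` evaluate to `1#` and `0#` by
    -- computation, with no difference left over; goals that contain these constants then match.
    ⟦_⟧ : ℕ × ℕ → Carrier
    ⟦ p , zero ⟧  = ν p
    ⟦ p , suc q ⟧ = ν p - ν (suc q)

    ⟦⟧-difference : ∀ p q → ⟦ p , q ⟧ ≈ ν p - ν q
    ⟦⟧-difference p zero    = trans (sym (+-identityʳ (ν p))) (+-congˡ (sym -0#≈0#))
    ⟦⟧-difference p (suc q) = refl

    interpretation : Difference -Raw-AlmostCommutative⟶ fromCommutativeRing R
    interpretation = record
      { ⟦_⟧ = ⟦_⟧
      ; +-homo = λ (p , q) (r , s) → begin
          ⟦ p ℕ.+ r , q ℕ.+ s ⟧          ≈⟨ ⟦⟧-difference (p ℕ.+ r) (q ℕ.+ s) ⟩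
          ν (p ℕ.+ r) - ν (q ℕ.+ s)      ≈⟨ +-cong (×-homo-+ 1# p r) (-‿cong (×-homo-+ 1# q s)) ⟩
          (ν p + ν r) - (ν q + ν s)      ≈⟨ difference-+ (ν p) (ν q) (ν r) (ν s) ⟩
          (ν p - ν q) + (ν r - ν s)      ≈⟨ +-cong (⟦⟧-difference p q) (⟦⟧-difference r s) ⟨
          ⟦ p , q ⟧ + ⟦ r , s ⟧          ∎
      ; *-homo = λ (p , q) (r , s) → begin
          ⟦ p ℕ.* r ℕ.+ q ℕ.* s , p ℕ.* s ℕ.+ q ℕ.* r ⟧
            ≈⟨ ⟦⟧-difference (p ℕ.* r ℕ.+ q ℕ.* s) (p ℕ.* s ℕ.+ q ℕ.* r) ⟩
          ν (p ℕ.* r ℕ.+ q ℕ.* s) - ν (p ℕ.* s ℕ.+ q ℕ.* r)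
            ≈⟨ +-cong (ν-sum-of-products p r q s) (-‿cong (ν-sum-of-products p s q r)) ⟩
          (ν p * ν r + ν q * ν s) - (ν p * ν s + ν q * ν r)
            ≈⟨ difference-* (ν p) (ν q) (ν r) (ν s) ⟩
          (ν p - ν q) * (ν r - ν s)
            ≈⟨ *-cong (⟦⟧-difference p q) (⟦⟧-difference r s) ⟨
          ⟦ p , q ⟧ * ⟦ r , s ⟧ ∎
      ; -‿homo = λ (p , q) → begin
          ⟦ q , p ⟧        ≈⟨ ⟦⟧-difference q p ⟩
          ν q - ν p        ≈⟨ ⁻¹-anti-homo‿- (ν p) (ν q) ⟨
          - (ν p - ν q)    ≈⟨ -‿cong (⟦⟧-difference p q) ⟨
          - ⟦ p , q ⟧      ∎
      ; 0-homo = refl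
      ; 1-homo = refl
      }

    _≟ᶜ_ : ∀ u v → Maybe (⟦ u ⟧ ≈ ⟦ v ⟧)
    (p , q) ≟ᶜ (r , s) with p ℕ.+ s ℕₚ.≟ q ℕ.+ r
    ... | no _   = nothing
    ... | yes eq = just (begin
      ⟦ p , q ⟧    ≈⟨ ⟦⟧-difference p q ⟩
      ν p - ν q    ≈⟨ difference-cong (trans (sym (×-homo-+ 1# p s)) (trans (reflexive (≡.cong ν eq)) (×-homo-+ 1# q r))) ⟩
      ν r - ν s    ≈⟨ ⟦⟧-difference r s ⟨
      ⟦ r , s ⟧    ∎)

  open Algebra.Solver.Ring Difference (fromCommutativeRing R) interpretation _≟ᶜ_ public
    using (solve; _:+_; _:*_; _:-_; :-_; _:=_; Polynomial) renaming (con to literal)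

  𝟙 𝟘 : ∀ {n} → Polynomial n
  𝟙 = literal (1 , 0)
  𝟘 = literal (0 , 0)

-- Finite sums and products over lists

module ListOperations (M : CommutativeMonoid c ℓ) where
  open CommutativeMonoid M
  open Algebra.Properties.CommutativeSemigroup commutativeSemigroup using (interchange)

  big : List A → (A → Carrier) → Carrier
  big xs f = List.foldr (λ x t → f x ∙ t) ε xs

  big-cong : ∀ (xs : List A) {f g} → (∀ x → f x ≈ g x) → big xs f ≈ big xs g
  big-cong []       eq = refl
  big-cong (x ∷ xs) eq = ∙-cong (eq x) (big-cong xs eq)

  big-cong-All : ∀ {xs : List A} {f g : A → Carrier} → All (λ x → f x ≈ g x) xs → big xs f ≈ big xs g
  big-cong-All []         = refl
  big-cong-All (eq ∷ eqs) = ∙-cong eq (big-cong-All eqs)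

  big-ε : ∀ (xs : List A) → big xs (λ _ → ε) ≈ ε
  big-ε []       = refl
  big-ε (x ∷ xs) = trans (identityˡ _) (big-ε xs)

  big-∙ : ∀ (xs : List A) f g → big xs (λ x → f x ∙ g x) ≈ big xs f ∙ big xs g
  big-∙ []       f g = sym (identityˡ ε)
  big-∙ (x ∷ xs) f g = trans (∙-congˡ (big-∙ xs f g)) (interchange (f x) (g x) _ _)

  big-comm : ∀ (xs : List A) (ys : List B) (f : A → B → Carrier) →
             big xs (λ x → big ys (f x)) ≈ big ys (λ y → big xs (λ x → f x y))
  big-comm []       ys f = sym (big-ε ys)
  big-comm (x ∷ xs) ys f = trans (∙-congˡ (big-comm xs ys f)) (sym (big-∙ ys (f x) _))

  big-++ : ∀ (xs ys : List A) f → big (xs ++ ys) f ≈ big xs f ∙ big ys f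
  big-++ []       ys f = sym (identityˡ _)
  big-++ (x ∷ xs) ys f = trans (∙-congˡ (big-++ xs ys f)) (sym (assoc (f x) _ _))

  big-map : ∀ (g : A → B) xs f → big (map g xs) f ≡ big xs (f ∘ g)
  big-map g []       f = ≡.refl
  big-map g (x ∷ xs) f = ≡.cong (f (g x) ∙_) (big-map g xs f)

-- Determinants and alternating functions of lists of rows

module ListDeterminants (R : CommutativeRing c ℓ) where
  open CommutativeRing R hiding (zero)
  open IntegerSolver R
  open Relation.Binary.Reasoning.Setoid setoid
  open ListOperations +-commutativeMonoid public
    renaming (big to Σᴸ; big-cong to Σᴸ-cong; big-cong-All to Σᴸ-cong-All; big-ε to Σᴸ-0; big-∙ to Σᴸ-+; big-++ to Σᴸ-++; big-map to Σᴸ-map)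
  open ListOperations *-commutativeMonoid public
    renaming (big to Πᴸ; big-cong to Πᴸ-cong; big-ε to Πᴸ-1; big-∙ to Πᴸ-*; big-comm to Πᴸ-comm; big-++ to Πᴸ-++; big-map to Πᴸ-map)

  -- Laplace expansion without indices: each member is taken out in turn, `f` also receives the
  -- others in their order, and the nested subtractions produce the signs.
  altsum : (A → List A → Carrier) → List A → Carrier
  altsum f []       = 0#
  altsum f (x ∷ xs) = f x xs - altsum (λ y ys → f y (x ∷ ys)) xs

  altsum-cong : ∀ {f g : A → List A → Carrier} → (∀ x xs → f x xs ≈ g x xs) → ∀ xs → altsum f xs ≈ altsum g xs
  altsum-cong eq []       = refl
  altsum-cong eq (x ∷ xs) = +-cong (eq x xs) (-‿cong (altsum-cong (λ y ys → eq y (x ∷ ys)) xs))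

  altsum-0 : ∀ (xs : List A) → altsum (λ _ _ → 0#) xs ≈ 0#
  altsum-0 []       = refl
  altsum-0 (x ∷ xs) = trans (+-congˡ (-‿cong (altsum-0 xs))) (-‿inverseʳ 0#)

  altsum-linear : ∀ k (f g : A → List A → Carrier) xs →
                  altsum (λ x ys → f x ys + k * g x ys) xs ≈ altsum f xs + k * altsum g xs
  altsum-linear k f g []       = solve 1 (λ k → 𝟘 := 𝟘 :+ k :* 𝟘) refl k
  altsum-linear k f g (x ∷ xs) = trans (+-congˡ (-‿cong (altsum-linear k _ _ xs)))
    (solve 5 (λ p q k r s → (p :+ k :* q) :- (r :+ k :* s) := (p :- r) :+ k :* (q :- s)) refl _ _ _ _ _)

  altsum-sub : ∀ (f g : A → List A → Carrier) xs →
               altsum (λ x ys → f x ys - g x ys) xs ≈ altsum f xs - altsum g xs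
  altsum-sub f g xs = begin
    altsum (λ x ys → f x ys - g x ys) xs
      ≈⟨ altsum-cong (λ x ys → solve 2 (λ p q → p :- q := p :+ (:- 𝟙) :* q) refl _ _) xs ⟩
    altsum (λ x ys → f x ys + - 1# * g x ys) xs    ≈⟨ altsum-linear (- 1#) f g xs ⟩
    altsum f xs + - 1# * altsum g xs               ≈⟨ solve 2 (λ p q → p :+ (:- 𝟙) :* q := p :- q) refl _ _ ⟩
    altsum f xs - altsum g xs                      ∎

  altsum-*ˡ : ∀ k (f : A → List A → Carrier) xs → altsum (λ x ys → k * f x ys) xs ≈ k * altsum f xs
  altsum-*ˡ k f xs = begin
    altsum (λ x ys → k * f x ys) xs          ≈⟨ altsum-cong (λ x ys → +-identityˡ _) xs ⟨
    altsum (λ x ys → 0# + k * f x ys) xs     ≈⟨ altsum-linear k (λ _ _ → 0#) f xs ⟩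
    altsum (λ _ _ → 0#) xs + k * altsum f xs ≈⟨ +-congʳ (altsum-0 xs) ⟩
    0# + k * altsum f xs                     ≈⟨ +-identityˡ _ ⟩
    k * altsum f xs                          ∎

  altsum-comm : ∀ (f : A → List A → B → List B → Carrier) xs ys →
    altsum (λ x xs′ → altsum (f x xs′) ys) xs ≈ altsum (λ y ys′ → altsum (λ x xs′ → f x xs′ y ys′) xs) ys
  altsum-comm f []       ys = sym (altsum-0 ys)
  altsum-comm f (x ∷ xs) ys = trans
    (+-congˡ (-‿cong (altsum-comm (λ z zs → f z (x ∷ zs)) xs ys)))
    (sym (altsum-sub (f x xs) _ ys))

  altsum-map : ∀ (g : A → B) (f : B → List B → Carrier) xs →
               altsum f (map g xs) ≈ altsum (λ x ys → f (g x) (map g ys)) xs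
  altsum-map g f []       = refl
  altsum-map g f (x ∷ xs) = +-congˡ (-‿cong (altsum-map g (λ y ys → f y (g x ∷ ys)) xs))

  -- Whichever member is taken out, the factors of that member and of the remaining ones multiply to
  -- the same product over the whole list.
  altsum-scale : ∀ h (f : A → List A → Carrier) xs →
                 altsum (λ x ys → h x * Πᴸ ys h * f x ys) xs ≈ Πᴸ xs h * altsum f xs
  altsum-scale h f []       = sym (*-identityˡ 0#)
  altsum-scale h f (x ∷ xs) = begin
    h x * Πᴸ xs h * f x xs - altsum (λ y ys → h y * (h x * Πᴸ ys h) * f y (x ∷ ys)) xs
      ≈⟨ +-congˡ (-‿cong (altsum-cong (λ y ys → solve 4 (λ p q r s → p :* (q :* r) :* s := q :* (p :* r :* s)) refl _ _ _ _) xs)) ⟩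
    h x * Πᴸ xs h * f x xs - altsum (λ y ys → h x * (h y * Πᴸ ys h * f y (x ∷ ys))) xs
      ≈⟨ +-congˡ (-‿cong (trans (altsum-*ˡ (h x) _ xs) (*-congˡ (altsum-scale h (λ y ys → f y (x ∷ ys)) xs)))) ⟩
    h x * Πᴸ xs h * f x xs - h x * (Πᴸ xs h * altsum (λ y ys → f y (x ∷ ys)) xs)
      ≈⟨ solve 4 (λ p q r s → p :* q :* r :- p :* (q :* s) := p :* q :* (r :- s)) refl _ _ _ _ ⟩
    h x * Πᴸ xs h * (f x xs - altsum (λ y ys → f y (x ∷ ys)) xs) ∎

  -- The determinant of the matrix with the given rows, restricted to a
  -- list of columns; 0 if the matrix is not square.
  detᴸ : List (A → Carrier) → List A → Carrier
  detᴸ []       []      = 1#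
  detᴸ []       (_ ∷ _) = 0#
  detᴸ (v ∷ vs) xs      = altsum (λ x ys → v x * detᴸ vs ys) xs

  -- `detᴸ` expands along the first row. All terms but the first keep the column `x`, so induction
  -- expands their minors along it, and the two alternating sums commute.
  column-expansion : ∀ (vs : List (A → Carrier)) x xs →
                     detᴸ vs (x ∷ xs) ≈ altsum (λ v us → v x * detᴸ us xs) vs
  column-expansion []       x xs = refl
  column-expansion (v ∷ vs) x xs = +-congˡ (-‿cong (begin
    altsum (λ y ys → v y * detᴸ vs (x ∷ ys)) xs
      ≈⟨ altsum-cong (λ y ys → trans (*-congˡ (column-expansion vs x ys)) (sym (altsum-*ˡ (v y) _ vs))) xs ⟩
    altsum (λ y ys → altsum (λ u us → v y * (u x * detᴸ us ys)) vs) xs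
      ≈⟨ altsum-comm (λ y ys u us → v y * (u x * detᴸ us ys)) xs vs ⟩
    altsum (λ u us → altsum (λ y ys → v y * (u x * detᴸ us ys)) xs) vs
      ≈⟨ altsum-cong (λ u us → trans
           (altsum-cong (λ y ys → solve 3 (λ p q r → p :* (q :* r) := q :* (p :* r)) refl _ _ _) xs)
           (altsum-*ˡ (u x) _ xs)) vs ⟩
    altsum (λ u us → u x * detᴸ (v ∷ us) xs) vs ∎))

  -- The expansion of one side along its first column is, by induction on the minors, the expansion
  -- of the other side along its first row.
  transpose : ∀ (M : A → B → Carrier) xs ys → detᴸ (map M xs) ys ≈ detᴸ (map (flip M) ys) xs
  transpose M []       []       = refl
  transpose M (_ ∷ _)  []       = refl
  transpose M xs       (y ∷ ys) = begin
    detᴸ (map M xs) (y ∷ ys)                           ≈⟨ column-expansion (map M xs) y ys ⟩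
    altsum (λ v us → v y * detᴸ us ys) (map M xs)       ≈⟨ altsum-map M _ xs ⟩
    altsum (λ x zs → M x y * detᴸ (map M zs) ys) xs     ≈⟨ altsum-cong (λ x zs → *-congˡ (transpose M zs ys)) xs ⟩
    altsum (λ x zs → M x y * detᴸ (map (flip M) ys) zs) xs ∎

  scale-columns : ∀ (h : A → Carrier) vs xs →
                  detᴸ (map (λ v x → h x * v x) vs) xs ≈ Πᴸ xs h * detᴸ vs xs
  scale-columns h []       []      = sym (*-identityˡ 1#)
  scale-columns h []       (_ ∷ _) = sym (zeroʳ _)
  scale-columns h (v ∷ vs) xs      = begin
    altsum (λ x ys → h x * v x * detᴸ (map (λ u z → h z * u z) vs) ys) xs
      ≈⟨ altsum-cong (λ x ys → trans (*-congˡ (scale-columns h vs ys))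
           (solve 4 (λ p q r s → p :* q :* (r :* s) := p :* r :* (q :* s)) refl _ _ _ _)) xs ⟩
    altsum (λ x ys → h x * Πᴸ ys h * (v x * detᴸ vs ys)) xs
      ≈⟨ altsum-scale h (λ x ys → v x * detᴸ vs ys) xs ⟩
    Πᴸ xs h * altsum (λ x ys → v x * detᴸ vs ys) xs ∎

  infix 4 _≈ᵣ_
  _≈ᵣ_ : ∀ {A : Set ℓ₁} → (A → Carrier) → (A → Carrier) → Set _
  u ≈ᵣ v = ∀ x → u x ≈ v x

  -- `linear` takes a pointwise equation, so it also gives invariance under pointwise equal rows
  -- (`head-cong`), which an arbitrary function of functions need not have. `vanish` is required
  -- instead of a change of sign because 2 may be a zero divisor.
  record Alternating {A : Set ℓ₁} (Φ : List (A → Carrier) → Carrier) : Set (ℓ₁ ⊔ c ⊔ ℓ) where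
    field
      linear : ∀ us ws {v v₁ v₂ k} → (∀ x → v x ≈ v₁ x + k * v₂ x) →
               Φ (us ++ v ∷ ws) ≈ Φ (us ++ v₁ ∷ ws) + k * Φ (us ++ v₂ ∷ ws)
      vanish : ∀ us v ws → Φ (us ++ v ∷ v ∷ ws) ≈ 0#

    after : ∀ v → Alternating (Φ ∘ (v ∷_))
    after v = record { linear = linear ∘ (v ∷_) ; vanish = vanish ∘ (v ∷_) }

    before : ∀ ws → Alternating (λ us → Φ (us ++ ws))
    before ws = record
      { linear = λ us vs {v} {v₁} {v₂} {k} eq → begin
          Φ ((us ++ v ∷ vs) ++ ws)    ≡⟨ ≡.cong Φ (Listₚ.++-assoc us (v ∷ vs) ws) ⟩
          Φ (us ++ v ∷ vs ++ ws)      ≈⟨ linear us (vs ++ ws) eq ⟩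
          Φ (us ++ v₁ ∷ vs ++ ws) + k * Φ (us ++ v₂ ∷ vs ++ ws)
            ≡⟨ ≡.cong₂ (λ us us′ → Φ us + k * Φ us′) (Listₚ.++-assoc us (v₁ ∷ vs) ws) (Listₚ.++-assoc us (v₂ ∷ vs) ws) ⟨
          Φ ((us ++ v₁ ∷ vs) ++ ws) + k * Φ ((us ++ v₂ ∷ vs) ++ ws) ∎
      ; vanish = λ us v vs → trans (reflexive (≡.cong Φ (Listₚ.++-assoc us (v ∷ v ∷ vs) ws))) (vanish us v (vs ++ ws))
      }

    multiplied : ∀ (h : A → Carrier) → Alternating (Φ ∘ map (λ v x → h x * v x))
    multiplied h = record
      { linear = λ us ws {v} {v₁} {v₂} {k} eq → begin
          Φ (map H (us ++ v ∷ ws))         ≡⟨ ≡.cong Φ (Listₚ.map-++ H us (v ∷ ws)) ⟩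
          Φ (map H us ++ H v ∷ map H ws)
            ≈⟨ linear (map H us) (map H ws) (λ x → trans (*-congˡ (eq x))
                 (solve 4 (λ p q r s → p :* (q :+ r :* s) := p :* q :+ r :* (p :* s)) refl _ _ _ _)) ⟩
          Φ (map H us ++ H v₁ ∷ map H ws) + k * Φ (map H us ++ H v₂ ∷ map H ws)
            ≡⟨ ≡.cong₂ (λ us us′ → Φ us + k * Φ us′) (Listₚ.map-++ H us (v₁ ∷ ws)) (Listₚ.map-++ H us (v₂ ∷ ws)) ⟨
          Φ (map H (us ++ v₁ ∷ ws)) + k * Φ (map H (us ++ v₂ ∷ ws)) ∎
      ; vanish = λ us v ws → trans (reflexive (≡.cong Φ (Listₚ.map-++ H us (v ∷ v ∷ ws)))) (vanish (map H us) (H v) (map H ws))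
      }
      where
      H : (A → Carrier) → A → Carrier
      H v x = h x * v x

    zero-row : ∀ {v} ws → (∀ x → v x ≈ 0#) → Φ (v ∷ ws) ≈ 0#
    zero-row {v} ws eq = trans
      (linear [] ws {v} {v} {v} {k = - 1#} (λ x → solve-row x))
      (solve 1 (λ p → p :+ (:- 𝟙) :* p := 𝟘) refl _)
      where
      solve-row : ∀ x → v x ≈ v x + - 1# * v x
      solve-row x = trans (eq x) (solve 1 (λ p → 𝟘 := p :+ (:- 𝟙) :* p) refl _)

    -- `linear` always has a first summand with coefficient 1, so k u is written as u + (k - 1) u.
    scale : ∀ {v u k} ws → (∀ x → v x ≈ k * u x) → Φ (v ∷ ws) ≈ k * Φ (u ∷ ws)
    scale {v} {u} {k} ws eq = trans
      (linear [] ws {v} {u} {u} {k = k - 1#} (λ x → trans (eq x) (solve 2 (λ p q → p :* q := q :+ (p :- 𝟙) :* q) refl _ _)))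
      (solve 2 (λ p q → q :+ (p :- 𝟙) :* q := p :* q) refl _ _)

    head-cong : ∀ {v u} ws → v ≈ᵣ u → Φ (v ∷ ws) ≈ Φ (u ∷ ws)
    head-cong ws eq = trans (scale ws (λ x → trans (eq x) (sym (*-identityˡ _)))) (*-identityˡ _)

    -- Polarization: with w = u + v the value at the rows w, w is 0, and two of its four terms have
    -- equal rows and vanish.
    swap : ∀ u v ws → Φ (u ∷ v ∷ ws) ≈ - Φ (v ∷ u ∷ ws)
    swap u v ws = begin
      Φ (u ∷ v ∷ ws)
        ≈⟨ solve 4 (λ p q r s → p := (r :+ 𝟙 :* p) :+ 𝟙 :* (q :+ 𝟙 :* s) :- r :- s :- q) refl _ (Φ (v ∷ u ∷ ws)) (Φ (u ∷ u ∷ ws)) (Φ (v ∷ v ∷ ws)) ⟩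
      (Φ (u ∷ u ∷ ws) + 1# * Φ (u ∷ v ∷ ws)) + 1# * (Φ (v ∷ u ∷ ws) + 1# * Φ (v ∷ v ∷ ws)) - Φ (u ∷ u ∷ ws) - Φ (v ∷ v ∷ ws) - Φ (v ∷ u ∷ ws)
        ≈⟨ +-congʳ (+-cong (+-cong expand (-‿cong (vanish [] u ws))) (-‿cong (vanish [] v ws))) ⟩
      0# - 0# - 0# - Φ (v ∷ u ∷ ws)
        ≈⟨ solve 1 (λ p → 𝟘 :- 𝟘 :- 𝟘 :- p := :- p) refl _ ⟩
      - Φ (v ∷ u ∷ ws) ∎
      where
      w : A → Carrier
      w x = u x + 1# * v x
      expand : (Φ (u ∷ u ∷ ws) + 1# * Φ (u ∷ v ∷ ws)) + 1# * (Φ (v ∷ u ∷ ws) + 1# * Φ (v ∷ v ∷ ws)) ≈ 0#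
      expand = begin
        (Φ (u ∷ u ∷ ws) + 1# * Φ (u ∷ v ∷ ws)) + 1# * (Φ (v ∷ u ∷ ws) + 1# * Φ (v ∷ v ∷ ws))
          ≈⟨ +-cong (linear (u ∷ []) ws (λ _ → refl)) (*-congˡ (linear (v ∷ []) ws (λ _ → refl))) ⟨
        Φ (u ∷ w ∷ ws) + 1# * Φ (v ∷ w ∷ ws)    ≈⟨ linear [] (w ∷ ws) (λ _ → refl) ⟨
        Φ (w ∷ w ∷ ws)                          ≈⟨ vanish [] w ws ⟩
        0#                                      ∎

  open Alternating

  module _ {A : Set ℓ₁} where
    private
      V = A → Carrier

    alternating-cong : ∀ {Φ : List V → Carrier} → Alternating Φ → ∀ {us vs} → Pointwise _≈ᵣ_ us vs → Φ us ≈ Φ vs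
    alternating-cong alt []         = refl
    alternating-cong alt (eq ∷ eqs) = trans (head-cong alt _ eq) (alternating-cong (after alt _) eqs)

    repeated : ∀ {Φ : List V → Carrier} → Alternating Φ → ∀ v us ws → Φ (v ∷ us ++ v ∷ ws) ≈ 0#
    repeated alt v []       ws = vanish alt [] v ws
    repeated alt v (u ∷ us) ws = trans (swap alt v u _)
      (trans (-‿cong (repeated (after alt u) v us ws)) (solve 0 (:- 𝟘 := 𝟘) refl))

    repeated-∈ : ∀ {Φ : List V → Carrier} → Alternating Φ → ∀ (f : B → V) {l} {ls} → l ∈ ls → Φ (f l ∷ map f ls) ≈ 0#
    repeated-∈ alt f (here ≡.refl)          = vanish alt [] _ _
    repeated-∈ alt f {l} {k ∷ ls} (there ∈) = trans (swap alt (f l) (f k) _)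
      (trans (-‿cong (repeated-∈ (after alt (f k)) f ∈)) (solve 0 (:- 𝟘 := 𝟘) refl))

    shear : ∀ {Φ : List V → Carrier} → Alternating Φ → ∀ us {v u k} w ws →
            (∀ x → v x ≈ u x + k * w x) → Φ (v ∷ us ++ w ∷ ws) ≈ Φ (u ∷ us ++ w ∷ ws)
    shear alt us w ws eq = trans (linear alt [] _ eq)
      (trans (+-congˡ (*-congˡ (repeated alt w us ws))) (solve 2 (λ p k → p :+ k :* 𝟘 := p) refl _ _))

    shear-second : ∀ {Φ : List V → Carrier} → Alternating Φ → ∀ {v u k} w ws →
                   (∀ x → v x ≈ u x + k * w x) → Φ (w ∷ v ∷ ws) ≈ Φ (w ∷ u ∷ ws)
    shear-second alt {v} {u} w ws eq = trans (swap alt w v ws)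
      (trans (-‿cong (shear alt [] w ws eq)) (sym (swap alt w u ws)))

    det-linear : ∀ xs us ws {v v₁ v₂ : V} {k} → (∀ x → v x ≈ v₁ x + k * v₂ x) →
                 detᴸ (us ++ v ∷ ws) xs ≈ detᴸ (us ++ v₁ ∷ ws) xs + k * detᴸ (us ++ v₂ ∷ ws) xs
    det-linear xs []       ws {k = k} eq = trans
      (altsum-cong (λ x ys → trans (*-congʳ (eq x)) (solve 4 (λ p q r k → (p :+ k :* q) :* r := p :* r :+ k :* (q :* r)) refl _ _ _ _)) xs)
      (altsum-linear k _ _ xs)
    det-linear xs (u ∷ us) ws {k = k} eq = trans
      (altsum-cong (λ x ys → trans (*-congˡ (det-linear ys us ws eq)) (solve 4 (λ p q r k → r :* (p :+ k :* q) := r :* p :+ k :* (r :* q)) refl _ _ _ _)) xs)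
      (altsum-linear k _ _ xs)

    -- When the equal rows come first, expand along the first column: their two minors cancel, and
    -- every other minor contains both rows again and has one column less.
    det-vanish : ∀ xs us (v : V) ws → detᴸ (us ++ v ∷ v ∷ ws) xs ≈ 0#
    det-vanish xs       (u ∷ us) v ws = trans
      (altsum-cong (λ x ys → trans (*-congˡ (det-vanish ys us v ws)) (zeroʳ _)) xs) (altsum-0 xs)
    det-vanish []       []       v ws = refl
    det-vanish (x ∷ xs) []       v ws = begin
      detᴸ (v ∷ v ∷ ws) (x ∷ xs)    ≈⟨ column-expansion (v ∷ v ∷ ws) x xs ⟩
      v x * detᴸ (v ∷ ws) xs - (v x * detᴸ (v ∷ ws) xs - altsum (λ u us → u x * detᴸ (v ∷ v ∷ us) xs) ws)
        ≈⟨ solve 2 (λ p q → p :- (p :- q) := q) refl _ _ ⟩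
      altsum (λ u us → u x * detᴸ (v ∷ v ∷ us) xs) ws
        ≈⟨ altsum-cong (λ u us → trans (*-congˡ (det-vanish xs [] v us)) (zeroʳ _)) ws ⟩
      altsum (λ _ _ → 0#) ws    ≈⟨ altsum-0 ws ⟩
      0#                        ∎

    det-alternating : ∀ xs → Alternating (λ vs → detᴸ {A = A} vs xs)
    det-alternating xs = record { linear = det-linear xs ; vanish = det-vanish xs }

-- The Cauchy-Binet formula

-- All sequences N > l₁ > l₂ > ⋯ > lₖ.
decreasingSequences : ℕ → ℕ → List (List ℕ)
decreasingSequences zero    N       = [] ∷ []
decreasingSequences (suc k) zero    = []
decreasingSequences (suc k) (suc N) = decreasingSequences (suc k) N ++ map (N ∷_) (decreasingSequences k N)

module CauchyBinet (R : CommutativeRing c ℓ) where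
  open CommutativeRing R hiding (zero) renaming (distribˡ to *-distribˡ-+)
  open IntegerSolver R
  open ListDeterminants R
  open Alternating
  open Relation.Binary.Reasoning.Setoid setoid

  Σ< : ℕ → (ℕ → Carrier) → Carrier
  Σ< zero    f = 0#
  Σ< (suc N) f = Σ< N f + f N

  Σ<-cong : ∀ N {f g} → (∀ l → f l ≈ g l) → Σ< N f ≈ Σ< N g
  Σ<-cong zero    eq = refl
  Σ<-cong (suc N) eq = +-cong (Σ<-cong N eq) (eq N)

  Σ<-*ˡ : ∀ N k f → k * Σ< N f ≈ Σ< N (λ l → k * f l)
  Σ<-*ˡ zero    k f = zeroʳ k
  Σ<-*ˡ (suc N) k f = trans (*-distribˡ-+ k _ _) (+-congʳ (Σ<-*ˡ N k f))

  Σᴸ-*ˡ : ∀ k (xs : List A) f → k * Σᴸ xs f ≈ Σᴸ xs (λ x → k * f x)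
  Σᴸ-*ˡ k []       f = zeroʳ k
  Σᴸ-*ˡ k (x ∷ xs) f = trans (*-distribˡ-+ k _ _) (+-congˡ (Σᴸ-*ˡ k xs f))

  Σᴸ-Σ< : ∀ (xs : List A) N (f : A → ℕ → Carrier) → Σᴸ xs (λ x → Σ< N (f x)) ≈ Σ< N (λ l → Σᴸ xs (λ x → f x l))
  Σᴸ-Σ< xs zero    f = Σᴸ-0 xs
  Σᴸ-Σ< xs (suc N) f = trans (Σᴸ-+ xs (λ x → Σ< N (f x)) (λ x → f x N)) (+-congʳ (Σᴸ-Σ< xs N f))

  Σ-remove : (A → List A → Carrier) → List A → Carrier
  Σ-remove f []       = 0#
  Σ-remove f (x ∷ xs) = f x xs + Σ-remove (λ y ys → f y (x ∷ ys)) xs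

  Σ-remove-cong : ∀ {f g : A → List A → Carrier} → (∀ x xs → f x xs ≈ g x xs) → ∀ xs → Σ-remove f xs ≈ Σ-remove g xs
  Σ-remove-cong eq []       = refl
  Σ-remove-cong eq (x ∷ xs) = +-cong (eq x xs) (Σ-remove-cong (λ y ys → eq y (x ∷ ys)) xs)

  Σ-remove-neg : ∀ (f : A → List A → Carrier) xs → Σ-remove (λ x ys → - f x ys) xs ≈ - Σ-remove f xs
  Σ-remove-neg f []       = solve 0 (𝟘 := :- 𝟘) refl
  Σ-remove-neg f (x ∷ xs) = trans (+-congˡ (Σ-remove-neg _ xs)) (solve 2 (λ p q → :- p :+ :- q := :- (p :+ q)) refl _ _)

  -- Choosing a sequence and then one of its members is the same as
  -- choosing a shorter sequence and then a new member.
  Σ-remove-sequences : ∀ k N (f : ℕ → List ℕ → Carrier) → (∀ {l ls} → l ∈ ls → f l ls ≈ 0#) →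
    Σᴸ (decreasingSequences (suc k) N) (Σ-remove f) ≈ Σᴸ (decreasingSequences k N) (λ ls → Σ< N (λ l → f l ls))
  Σ-remove-sequences k zero    f z = sym (Σᴸ-0 (decreasingSequences k zero))
  Σ-remove-sequences k (suc N) f z = begin
    Σᴸ (D (suc k) N ++ map (N ∷_) (D k N)) (Σ-remove f)
      ≈⟨ Σᴸ-++ (D (suc k) N) _ (Σ-remove f) ⟩
    Σᴸ (D (suc k) N) (Σ-remove f) + Σᴸ (map (N ∷_) (D k N)) (Σ-remove f)
      ≈⟨ +-cong (Σ-remove-sequences k N f z) (reflexive (Σᴸ-map (N ∷_) (D k N) (Σ-remove f))) ⟩
    Σᴸ (D k N) (λ ls → Σ< N (λ l → f l ls)) + Σᴸ (D k N) (λ ls → f N ls + Σ-remove f′ ls)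
      ≈⟨ +-congˡ (Σᴸ-+ (D k N) (f N) (Σ-remove f′)) ⟩
    Σᴸ (D k N) (λ ls → Σ< N (λ l → f l ls)) + (Σᴸ (D k N) (f N) + Σᴸ (D k N) (Σ-remove f′))
      ≈⟨ +-assoc _ _ _ ⟨
    Σᴸ (D k N) (λ ls → Σ< N (λ l → f l ls)) + Σᴸ (D k N) (f N) + Σᴸ (D k N) (Σ-remove f′)
      ≈⟨ +-congʳ (Σᴸ-+ (D k N) (λ ls → Σ< N (λ l → f l ls)) (f N)) ⟨
    Σᴸ (D k N) g + Σᴸ (D k N) (Σ-remove f′)
      ≈⟨ last k ⟩
    Σᴸ (D k (suc N)) g ∎
    where
    D = decreasingSequences
    f′ : ℕ → List ℕ → Carrier
    f′ l ls = f l (N ∷ ls)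
    g : List ℕ → Carrier
    g ls = Σ< N (λ l → f l ls) + f N ls
    last : ∀ k → Σᴸ (D k N) g + Σᴸ (D k N) (Σ-remove f′) ≈ Σᴸ (D k (suc N)) g
    last zero    = trans (+-congˡ (+-identityˡ 0#)) (+-identityʳ _)
    last (suc k) = begin
      Σᴸ (D (suc k) N) g + Σᴸ (D (suc k) N) (Σ-remove f′)
        ≈⟨ +-congˡ (Σ-remove-sequences k N f′ (z ∘ there)) ⟩
      Σᴸ (D (suc k) N) g + Σᴸ (D k N) (λ ls → Σ< N (λ l → f′ l ls))
        -- `g` also admits the choice `l = N`, but `N` is already a member of the sequence, so this
        -- term is 0 by `z`.
        ≈⟨ +-congˡ (Σᴸ-cong (D k N) (λ ls → trans (+-congˡ (z (here ≡.refl))) (+-identityʳ _))) ⟨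
      Σᴸ (D (suc k) N) g + Σᴸ (D k N) (λ ls → g (N ∷ ls))
        ≡⟨ ≡.cong (Σᴸ (D (suc k) N) g +_) (Σᴸ-map (N ∷_) (D k N) g) ⟨
      Σᴸ (D (suc k) N) g + Σᴸ (map (N ∷_) (D k N)) g
        ≈⟨ Σᴸ-++ (D (suc k) N) _ g ⟨
      Σᴸ (D (suc k) (suc N)) g ∎

  module _ {A : Set ℓ₁} where
    private
      V = A → Carrier

    -- Moving the row `Y l` to the front costs exactly the sign with which `l` enters the
    -- alternating sum, so all signs disappear.
    altsum-alternating : ∀ {Φ : List V → Carrier} → Alternating Φ → ∀ (Y : B → V) f ls →
      altsum f ls * Φ (map Y ls) ≈ Σ-remove (λ l ks → f l ks * Φ (Y l ∷ map Y ks)) ls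
    altsum-alternating     alt Y f []       = zeroˡ _
    altsum-alternating {Φ = Φ} alt Y f (l ∷ ls) = begin
      (f l ls - altsum (λ k ks → f k (l ∷ ks)) ls) * Φ (Y l ∷ map Y ls)
        ≈⟨ solve 3 (λ p q r → (p :- q) :* r := p :* r :- q :* r) refl _ _ _ ⟩
      f l ls * Φ (Y l ∷ map Y ls) - altsum (λ k ks → f k (l ∷ ks)) ls * Φ (Y l ∷ map Y ls)
        ≈⟨ +-congˡ (-‿cong (altsum-alternating (after alt (Y l)) Y (λ k ks → f k (l ∷ ks)) ls)) ⟩
      f l ls * Φ (Y l ∷ map Y ls) - Σ-remove (λ k ks → f k (l ∷ ks) * Φ (Y l ∷ Y k ∷ map Y ks)) ls
        ≈⟨ +-congˡ (Σ-remove-neg _ ls) ⟨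
      f l ls * Φ (Y l ∷ map Y ls) + Σ-remove (λ k ks → - (f k (l ∷ ks) * Φ (Y l ∷ Y k ∷ map Y ks))) ls
        ≈⟨ +-congˡ (Σ-remove-cong (λ k ks → trans (-‿cong (*-congˡ (swap alt (Y l) (Y k) _)))
             (solve 2 (λ p q → :- (p :* :- q) := p :* q) refl _ _)) ls) ⟩
      f l ls * Φ (Y l ∷ map Y ls) + Σ-remove (λ k ks → f k (l ∷ ks) * Φ (Y k ∷ Y l ∷ map Y ks)) ls ∎

    Σ<-row : ∀ {Φ : List V → Carrier} → Alternating Φ → ∀ N (f : ℕ → Carrier) (Y : ℕ → V) vs →
      Φ ((λ x → Σ< N (λ l → f l * Y l x)) ∷ vs) ≈ Σ< N (λ l → f l * Φ (Y l ∷ vs))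
    Σ<-row alt zero    f Y vs = zero-row alt vs (λ _ → refl)
    Σ<-row alt (suc N) f Y vs = trans (linear alt [] vs (λ _ → refl)) (+-congʳ (Σ<-row alt N f Y vs))

    -- Expand `detᴸ` along the row `f`; the signs are absorbed by the second factor. A sequence with
    -- a distinguished member is then a shorter sequence with a free `l`, since repeated values make
    -- `Φ` vanish, and the sum over the free `l` is linearity in the first row. `Φ` is not
    -- restricted to determinants so that it may carry the fixed rows of the case n ≠ m.
    cauchyBinet : ∀ {Φ : List V → Carrier} → Alternating Φ → ∀ N (Y : ℕ → V) (fs : List (ℕ → Carrier)) →
      Σᴸ (decreasingSequences (length fs) N) (λ ls → detᴸ fs ls * Φ (map Y ls)) ≈
      Φ (map (λ f x → Σ< N (λ l → f l * Y l x)) fs)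
    cauchyBinet {Φ} alt N Y []       = trans (+-identityʳ _) (*-identityˡ _)
    cauchyBinet {Φ} alt N Y (f ∷ fs) = begin
      Σᴸ (D (suc k)) (λ ls → detᴸ (f ∷ fs) ls * Φ (map Y ls))
        ≈⟨ Σᴸ-cong (D (suc k)) (altsum-alternating alt Y (λ l ks → f l * detᴸ fs ks)) ⟩
      Σᴸ (D (suc k)) (Σ-remove (λ l ks → f l * detᴸ fs ks * Φ (Y l ∷ map Y ks)))
        ≈⟨ Σ-remove-sequences k N _ (λ l∈ → trans (*-congˡ (repeated-∈ alt Y l∈)) (zeroʳ _)) ⟩
      Σᴸ (D k) (λ ks → Σ< N (λ l → f l * detᴸ fs ks * Φ (Y l ∷ map Y ks)))
        ≈⟨ Σᴸ-Σ< (D k) N _ ⟩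
      Σ< N (λ l → Σᴸ (D k) (λ ks → f l * detᴸ fs ks * Φ (Y l ∷ map Y ks)))
        ≈⟨ Σ<-cong N (λ l → trans (Σᴸ-cong (D k) (λ ks → *-assoc _ _ _)) (sym (Σᴸ-*ˡ (f l) (D k) _))) ⟩
      Σ< N (λ l → f l * Σᴸ (D k) (λ ks → detᴸ fs ks * Φ (Y l ∷ map Y ks)))
        ≈⟨ Σ<-cong N (λ l → *-congˡ (cauchyBinet (after alt (Y l)) N Y fs)) ⟩
      Σ< N (λ l → f l * Φ (Y l ∷ map F fs))
        ≈⟨ Σ<-row alt N f Y (map F fs) ⟨
      Φ (F f ∷ map F fs) ∎
      where
      k = length fs
      D : ℕ → List (List ℕ)
      D j = decreasingSequences j N
      F : (ℕ → Carrier) → V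
      F f x = Σ< N (λ l → f l * Y l x)

-- Vandermonde and mixed Cauchy determinants

module CauchyDeterminant (R : CommutativeRing c ℓ) where
  open CommutativeRing R hiding (zero)
  open Algebra.Definitions.RawSemiring (Semiring.rawSemiring semiring) using (_^_)
  open IntegerSolver R
  open ListDeterminants R
  open Alternating
  open Relation.Binary.Reasoning.Setoid setoid

  vandermonde : (A → Carrier) → List A → Carrier
  vandermonde z []       = 1#
  vandermonde z (i ∷ is) = Πᴸ is (λ j → z i - z j) * vandermonde z is

  module _ {A : Set ℓ₁} (y : A → Carrier) where
    private
      V = A → Carrier

    monomials : ℕ → List V
    monomials s = map (λ r x → y x ^ r) (downFrom s)

    -- Work from the top: the row y^s removes the term - t y^s from the row below it, which becomes
    -- y^(s-1) and serves for the next one.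
    monomials-multiplied-1-ty : ∀ {Φ : List V → Carrier} → Alternating Φ → ∀ t s →
      Φ ((λ x → y x ^ s) ∷ map (λ v x → (1# - t * y x) * v x) (monomials s)) ≈ Φ (monomials (suc s))
    monomials-multiplied-1-ty alt t zero    = refl
    monomials-multiplied-1-ty alt t (suc s) = trans
      (shear-second alt {u = λ x → y x ^ s} {k = - t} (λ x → y x ^ suc s) _
        (λ x → solve 3 (λ t y p → (𝟙 :- t :* y) :* p := p :+ :- t :* (y :* p)) refl t (y x) (y x ^ s)))
      (monomials-multiplied-1-ty (after alt _) t s)

    -- Here the clearing starts from the constant row at the bottom: once the rows below are
    -- monomials, y^s removes the term - t y^s from (y - t) y^s.
    monomials-multiplied-y-t : ∀ {Φ : List V → Carrier} → Alternating Φ → ∀ t s →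
      Φ (map (λ v x → (y x - t) * v x) (monomials s) ++ (λ _ → 1#) ∷ []) ≈ Φ (monomials (suc s))
    monomials-multiplied-y-t alt t zero    = refl
    monomials-multiplied-y-t alt t (suc s) = trans
      (monomials-multiplied-y-t (after alt _) t s)
      (shear alt [] {u = λ x → y x ^ suc s} {k = - t} (λ x → y x ^ s) (monomials s)
        (λ x → solve 3 (λ t y p → (y :- t) :* p := y :* p :+ :- t :* p) refl t (y x) (y x ^ s)))

    -- Each transposition contributes a sign, which is put into the row that is passed, so no power
    -- of -1 has to be tracked.
    move-last : ∀ {Φ : List V → Carrier} → Alternating Φ → ∀ vs u →
      Φ (vs ++ u ∷ []) ≈ Φ (u ∷ map (λ v x → - v x) vs)
    move-last alt []       u = refl
    move-last {Φ} alt (v ∷ vs) u = begin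
      Φ (v ∷ vs ++ u ∷ [])         ≈⟨ move-last (after alt v) vs u ⟩
      Φ (v ∷ u ∷ map _ vs)         ≈⟨ swap alt v u _ ⟩
      - Φ (u ∷ v ∷ map _ vs)       ≈⟨ solve 1 (λ p → :- p := :- 𝟙 :* p) refl _ ⟩
      - 1# * Φ (u ∷ v ∷ map _ vs)  ≈⟨ scale (after alt u) _ (λ x → solve 1 (λ p → :- p := :- 𝟙 :* p) refl (v x)) ⟨
      Φ (u ∷ (λ x → - v x) ∷ map _ vs) ∎

    det-first-column : ∀ u vs x xs → u x ≈ 1# → All (λ v → v x ≈ 0#) vs → detᴸ (u ∷ vs) (x ∷ xs) ≈ detᴸ vs xs
    det-first-column u vs x xs eq zs = begin
      detᴸ (u ∷ vs) (x ∷ xs)    ≈⟨ column-expansion (u ∷ vs) x xs ⟩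
      u x * detᴸ vs xs - altsum (λ v us → v x * detᴸ (u ∷ us) xs) vs
        ≈⟨ +-cong (trans (*-congʳ eq) (*-identityˡ _)) (-‿cong (altsum-zero vs zs (λ us → detᴸ (u ∷ us) xs))) ⟩
      detᴸ vs xs - 0#           ≈⟨ solve 1 (λ p → p :- 𝟘 := p) refl _ ⟩
      detᴸ vs xs                ∎
      where
      altsum-zero : ∀ vs → All (λ v → v x ≈ 0#) vs → ∀ (f : List V → Carrier) → altsum (λ v us → v x * f us) vs ≈ 0#
      altsum-zero []       []       f = refl
      altsum-zero (v ∷ vs) (z ∷ zs) f = trans
        (+-cong (trans (*-congʳ z) (zeroˡ _)) (-‿cong (altsum-zero vs zs (f ∘ (v ∷_))))) (-‿inverseʳ 0#)

    -- Take t = y x: every row except the constant one then vanishes in column `x`. The signs from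
    -- `move-last` turn y z - y x into y x - y z, the orientation used by `vandermonde`, and these
    -- factors come out of the remaining columns.
    det-monomials : ∀ xs → detᴸ (monomials (length xs)) xs ≈ vandermonde y xs
    det-monomials []       = refl
    det-monomials (x ∷ xs) = begin
      detᴸ (monomials (suc s)) (x ∷ xs)
        ≈⟨ monomials-multiplied-y-t alt (y x) s ⟨
      detᴸ (map (λ v z → (y z - y x) * v z) (monomials s) ++ (λ _ → 1#) ∷ []) (x ∷ xs)
        ≈⟨ move-last alt (map (λ v z → (y z - y x) * v z) (monomials s)) (λ _ → 1#) ⟩
      detᴸ ((λ _ → 1#) ∷ map (λ v z → - v z) (map (λ v z → (y z - y x) * v z) (monomials s))) (x ∷ xs)
        ≈⟨ alternating-cong alt ((λ _ → refl) ∷ negate (monomials s)) ⟩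
      detᴸ ((λ _ → 1#) ∷ map (λ v z → (y x - y z) * v z) (monomials s)) (x ∷ xs)
        ≈⟨ det-first-column (λ _ → 1#) _ x xs refl (zeros (monomials s)) ⟩
      detᴸ (map (λ v z → (y x - y z) * v z) (monomials s)) xs
        ≈⟨ scale-columns (λ z → y x - y z) (monomials s) xs ⟩
      Πᴸ xs (λ z → y x - y z) * detᴸ (monomials s) xs
        ≈⟨ *-congˡ (det-monomials xs) ⟩
      Πᴸ xs (λ z → y x - y z) * vandermonde y xs ∎
      where
      s = length xs
      alt = det-alternating {A = A} (x ∷ xs)
      negate : ∀ vs → Pointwise _≈ᵣ_ (map (λ v z → - v z) (map (λ v z → (y z - y x) * v z) vs)) (map (λ v z → (y x - y z) * v z) vs)
      negate []       = []
      negate (v ∷ vs) = (λ z → solve 3 (λ p q r → :- ((p :- q) :* r) := (q :- p) :* r) refl _ _ _) ∷ negate vs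
      zeros : ∀ vs → All (λ v → v x ≈ 0#) (map (λ v z → (y x - y z) * v z) vs)
      zeros []       = []
      zeros (v ∷ vs) = trans (*-congʳ (-‿inverseʳ (y x))) (zeroˡ _) ∷ zeros vs

    module _ {I : Set ℓ₂} (x : I → Carrier) (inv : I → A → Carrier)
             (inverse : ∀ i k → (1# - x i * y k) * inv i k ≈ 1#) where

      cauchyRow : ℕ → I → V
      cauchyRow s i k = y k ^ s * inv i k

      -- y^s/(1 - x y) - y^s/(1 - x′ y) = (x - x′) y^{s+1}/((1 - x y)(1 - x′ y))
      cauchyRow-difference : ∀ s i j k →
        cauchyRow s i k + - 1# * cauchyRow s j k ≈ (x i - x j) * (inv i k * cauchyRow (suc s) j k)
      cauchyRow-difference s i j k = begin
        p * u + - 1# * (p * v)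
          ≈⟨ solve 3 (λ p u v → p :* u :+ :- 𝟙 :* (p :* v) := p :* u :* 𝟙 :- p :* v :* 𝟙) refl p u v ⟩
        p * u * 1# - p * v * 1#
          ≈⟨ +-cong (*-congˡ (inverse j k)) (-‿cong (*-congˡ (inverse i k))) ⟨
        p * u * ((1# - x j * t) * v) - p * v * ((1# - x i * t) * u)
          ≈⟨ solve 6 (λ p u v xi xj t → p :* u :* ((𝟙 :- xj :* t) :* v) :- p :* v :* ((𝟙 :- xi :* t) :* u)
                                        := (xi :- xj) :* (u :* (t :* p :* v))) refl p u v (x i) (x j) t ⟩
        (x i - x j) * (u * (t * p * v)) ∎
        where
        p = y k ^ s
        t = y k
        u = inv i k
        v = inv j k

      -- The row of `i` passes each row of `j` by the change from (e i , e j) to (e i - e j , e i).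
      -- It has determinant 1, so there is no sign, and the difference contains the factor x i - x
      -- j.
      cauchyRows-reduce : ∀ {Φ : List V → Carrier} → Alternating Φ → ∀ s i is vs →
        Φ (cauchyRow s i ∷ map (cauchyRow s) is ++ vs) ≈
        Πᴸ is (λ j → x i - x j) * Φ (map (λ j k → inv i k * cauchyRow (suc s) j k) is ++ cauchyRow s i ∷ vs)
      cauchyRows-reduce alt s i []       vs = sym (*-identityˡ _)
      cauchyRows-reduce {Φ} alt s i (j ∷ is) vs = begin
        Φ (e i ∷ e j ∷ map e is ++ vs)
          ≈⟨ shear alt [] {u = λ k → e i k + - 1# * e j k} {k = 1#} (e j) _
               (λ k → solve 2 (λ p q → p := p :+ :- 𝟙 :* q :+ 𝟙 :* q) refl (e i k) (e j k)) ⟩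
        Φ ((λ k → e i k + - 1# * e j k) ∷ e j ∷ map e is ++ vs)
          ≈⟨ shear-second alt {u = e i} {k = - 1#} (λ k → e i k + - 1# * e j k) _
               (λ k → solve 2 (λ p q → q := p :+ :- 𝟙 :* (p :+ :- 𝟙 :* q)) refl (e i k) (e j k)) ⟩
        Φ ((λ k → e i k + - 1# * e j k) ∷ e i ∷ map e is ++ vs)
          ≈⟨ scale alt _ (cauchyRow-difference s i j) ⟩
        (x i - x j) * Φ (f j ∷ e i ∷ map e is ++ vs)
          ≈⟨ *-congˡ (cauchyRows-reduce (after alt (f j)) s i is vs) ⟩
        (x i - x j) * (Πᴸ is (λ j → x i - x j) * Φ (f j ∷ map f is ++ e i ∷ vs))
          ≈⟨ *-assoc _ _ _ ⟨
        (x i - x j) * Πᴸ is (λ j → x i - x j) * Φ (f j ∷ map f is ++ e i ∷ vs) ∎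
        where
        e = cauchyRow s
        f : I → V
        f j k = inv i k * cauchyRow (suc s) j k

      -- After the reduction by `i` every column `k` has the factor `inv i k`. Without it the other
      -- Cauchy rows have exponent s + 1, the row of `i` has become the monomial y^s, and the old
      -- monomials carry 1 - x i y, which row operations remove. So one Cauchy row is traded for one
      -- monomial until only a Vandermonde determinant is left; this is why `s` must vary.
      cauchyDeterminant : ∀ s is ks → length ks ≡ length is ℕ.+ s →
        detᴸ (map (cauchyRow s) is ++ monomials s) ks ≈
        vandermonde x is * vandermonde y ks * Πᴸ is (λ i → Πᴸ ks (inv i))
      cauchyDeterminant s []       ks ≡.refl = trans (det-monomials ks) (solve 1 (λ p → p := 𝟙 :* p :* 𝟙) refl _)
      cauchyDeterminant s (i ∷ is) ks eq = begin
        detᴸ (e s i ∷ map (e s) is ++ monomials s) ks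
          ≈⟨ cauchyRows-reduce alt s i is (monomials s) ⟩
        P * detᴸ (map (λ j k → inv i k * e (suc s) j k) is ++ e s i ∷ monomials s) ks
          ≈⟨ *-congˡ (alternating-cong alt (top is)) ⟩
        P * detᴸ (map (λ v k → inv i k * v k) (map (e (suc s)) is ++ (λ k → y k ^ s) ∷ map (λ v k → (1# - x i * y k) * v k) (monomials s))) ks
          ≈⟨ *-congˡ (scale-columns (inv i) (map (e (suc s)) is ++ (λ k → y k ^ s) ∷ map (λ v k → (1# - x i * y k) * v k) (monomials s)) ks) ⟩
        P * (Πᴸ ks (inv i) * detᴸ (map (e (suc s)) is ++ (λ k → y k ^ s) ∷ map (λ v k → (1# - x i * y k) * v k) (monomials s)) ks)
          ≈⟨ *-congˡ (*-congˡ (reduce-monomials alt (map (e (suc s)) is))) ⟩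
        P * (Πᴸ ks (inv i) * detᴸ (map (e (suc s)) is ++ monomials (suc s)) ks)
          ≈⟨ *-congˡ (*-congˡ (cauchyDeterminant (suc s) is ks (≡.trans eq (≡.sym (ℕₚ.+-suc (length is) s))))) ⟩
        P * (Πᴸ ks (inv i) * (vandermonde x is * vandermonde y ks * Πᴸ is (λ i → Πᴸ ks (inv i))))
          ≈⟨ solve 5 (λ p q u v w → p :* (q :* (u :* v :* w)) := p :* u :* v :* (q :* w)) refl _ _ _ _ _ ⟩
        P * vandermonde x is * vandermonde y ks * (Πᴸ ks (inv i) * Πᴸ is (λ i → Πᴸ ks (inv i))) ∎
        where
        e = cauchyRow
        P = Πᴸ is (λ j → x i - x j)
        alt = det-alternating {A = A} ks
        bottom : ∀ vs → Pointwise _≈ᵣ_ vs (map (λ v k → inv i k * v k) (map (λ v k → (1# - x i * y k) * v k) vs))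
        bottom []       = []
        bottom (v ∷ vs) = (λ k → trans (sym (*-identityˡ _)) (trans (*-congʳ (sym (inverse i k)))
          (solve 3 (λ p q r → p :* q :* r := q :* (p :* r)) refl _ _ _))) ∷ bottom vs
        top : ∀ is → Pointwise _≈ᵣ_ (map (λ j k → inv i k * e (suc s) j k) is ++ e s i ∷ monomials s)
          (map (λ v k → inv i k * v k) (map (e (suc s)) is ++ (λ k → y k ^ s) ∷ map (λ v k → (1# - x i * y k) * v k) (monomials s)))
        top []       = (λ k → *-comm _ _) ∷ bottom (monomials s)
        top (j ∷ is) = (λ k → refl) ∷ top is
        reduce-monomials : ∀ {Φ : List V → Carrier} → Alternating Φ → ∀ us →
          Φ (us ++ (λ k → y k ^ s) ∷ map (λ v k → (1# - x i * y k) * v k) (monomials s)) ≈ Φ (us ++ monomials (suc s))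
        reduce-monomials alt []       = monomials-multiplied-1-ty alt (x i) s
        reduce-monomials alt (u ∷ us) = reduce-monomials (after alt u) us

-- Factorial powers, their duals and the telescoping sum

module FactorialPowers (R : CommutativeRing c ℓ) where
  open CommutativeRing R hiding (zero)
  open Algebra.Definitions.RawSemiring (Semiring.rawSemiring semiring) using (_^_)
  open Algebra.Properties.Semiring.Exp semiring using (^-homo-*; ^-congˡ)
  open IntegerSolver R
  open ListDeterminants R
  open CauchyBinet R
  open CauchyDeterminant R
  open Alternating
  open Relation.Binary.Reasoning.Setoid setoid

  Π< : ℕ → (ℕ → Carrier) → Carrier
  Π< zero    f = 1#
  Π< (suc N) f = Π< N f * f N

  Π<-cong : ∀ N {f g} → (∀ l → f l ≈ g l) → Π< N f ≈ Π< N g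
  Π<-cong zero    eq = refl
  Π<-cong (suc N) eq = *-cong (Π<-cong N eq) (eq N)

  Π<-head : ∀ N f → Π< (suc N) f ≈ f 0 * Π< N (f ∘ suc)
  Π<-head zero    f = *-comm 1# (f 0)
  Π<-head (suc N) f = trans (*-congʳ (Π<-head N f)) (*-assoc _ _ _)

  factorial : (ℕ → Carrier) → Carrier → ℕ → Carrier
  factorial b x r = Π< r (λ k → x - b k)

  -- ∑ₗ (x - b₀)⋯(x - bₗ₋₁) tˡ qₗ₊₁ telescopes to q₀ / (1 - x t) when
  -- qₗ = (1 - bₗ t) qₗ₊₁.
  telescope : ∀ {x t inv} (X b q : ℕ → Carrier) → (1# - x * t) * inv ≈ 1# →
    (∀ l → X (suc l) ≈ X l * (x - b l)) → (∀ l → q l ≈ (1# - b l * t) * q (suc l)) → ∀ N →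
    Σ< N (λ l → X l * (t ^ l * q (suc l))) ≈ (X 0 * q 0 - X N * (t ^ N * q N)) * inv
  telescope {x} {t} {inv} X b q inverse X-suc q-suc zero =
    solve 3 (λ X q i → 𝟘 := (X :* q :- X :* (𝟙 :* q)) :* i) refl _ _ _
  telescope {x} {t} {inv} X b q inverse X-suc q-suc (suc N) = begin
    Σ< N (λ l → X l * (t ^ l * q (suc l))) + X N * (t ^ N * q (suc N))
      ≈⟨ +-cong (telescope X b q inverse X-suc q-suc N) (trans (sym (*-identityˡ _)) (*-congʳ (sym inverse))) ⟩
    (X 0 * q 0 - X N * (t ^ N * q N)) * inv + (1# - x * t) * inv * (X N * (t ^ N * q (suc N)))
      ≈⟨ +-congʳ (*-congʳ (+-congˡ (-‿cong (*-congˡ (*-congˡ (q-suc N)))))) ⟩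
    (X 0 * q 0 - X N * (t ^ N * ((1# - b N * t) * q (suc N)))) * inv + (1# - x * t) * inv * (X N * (t ^ N * q (suc N)))
      ≈⟨ solve 8 (λ H X T b t Q i x →
           (H :- X :* (T :* ((𝟙 :- b :* t) :* Q))) :* i :+ (𝟙 :- x :* t) :* i :* (X :* (T :* Q)) :=
           (H :- X :* (x :- b) :* (t :* T :* Q)) :* i)
           refl (X 0 * q 0) (X N) (t ^ N) (b N) t (q (suc N)) inv x ⟩
    (X 0 * q 0 - X N * (x - b N) * (t * t ^ N * q (suc N))) * inv
      ≈⟨ *-congʳ (+-congˡ (-‿cong (*-congʳ (X-suc N)))) ⟨
    (X 0 * q 0 - X (suc N) * (t ^ suc N * q (suc N))) * inv ∎

  module _ (a : ℤ → Carrier) where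

    numerator : ℕ → Carrier → Carrier
    numerator n t = Π< n (λ k → 1# - a (ℤ.+ suc k) * t)

    -- The factor (1 - a₁ t)⋯(1 - aₙ₋ₗ t) or 1 / (1 - a₀ t)⋯(1 - aₙ₋ₗ₊₁ t)
    -- with g k standing for 1 / (1 - aₖ t).
    dualFactor : ℕ → Carrier → (ℤ → Carrier) → ℕ → Carrier
    dualFactor n t g l = Π< (l ∸ n) (λ k → g (ℤ.- ℤ.+ k)) * numerator (n ∸ l) t

    -- The entry of the dual alternant as a function of its exponent l = λⱼ + n - j alone: the
    -- number of inverse factors is λⱼ - j + 1 = l + 1 - n, hence the `suc`.
    dualPower : ℕ → Carrier → (ℤ → Carrier) → ℕ → Carrier
    dualPower n t g l = t ^ l * dualFactor n t g (suc l)

    -- From l to l + 1 the numerator loses its last factor if l < n, and one more inverse factor is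
    -- gained if l ≥ n. In both cases the index of that factor is n - l.
    dualFactor-suc : ∀ n {t g} → (∀ k → (1# - a k * t) * g k ≈ 1#) → ∀ l →
                     dualFactor n t g l ≈ (1# - a (ℤ.+ n ℤ.- ℤ.+ l) * t) * dualFactor n t g (suc l)
    dualFactor-suc n {t} {g} inverse l with ℕₚ.<-≤-connex l n
    ... | inj₁ l<n = begin
      Π< (l ∸ n) g⁻ * numerator (n ∸ l) t
        ≡⟨ ≡.cong₂ (λ i j → Π< i g⁻ * numerator j t) (ℕₚ.m≤n⇒m∸n≡0 (ℕₚ.<⇒≤ l<n)) n∸l ⟩
      1# * (numerator (n ∸ suc l) t * (1# - a (ℤ.+ suc (n ∸ suc l)) * t))
        ≈⟨ solve 2 (λ p q → 𝟙 :* (p :* q) := q :* (𝟙 :* p)) refl _ _ ⟩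
      (1# - a (ℤ.+ suc (n ∸ suc l)) * t) * (1# * numerator (n ∸ suc l) t)
        ≡⟨ ≡.cong₂ (λ k i → (1# - a k * t) * (Π< i g⁻ * numerator (n ∸ suc l) t)) index (ℕₚ.m≤n⇒m∸n≡0 l<n) ⟨
      (1# - a (ℤ.+ n ℤ.- ℤ.+ l) * t) * dualFactor n t g (suc l) ∎
      where
      g⁻ : ℕ → Carrier
      g⁻ k = g (ℤ.- ℤ.+ k)
      n∸l : n ∸ l ≡ suc (n ∸ suc l)
      n∸l = ℕₚ.+-∸-assoc 1 l<n
      index : ℤ.+ n ℤ.- ℤ.+ l ≡ ℤ.+ suc (n ∸ suc l)
      index = ≡.trans (ℤₚ.m-n≡m⊖n n l) (≡.trans (ℤₚ.⊖-≥ (ℕₚ.<⇒≤ l<n)) (≡.cong ℤ.+_ n∸l))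
    ... | inj₂ n≤l = begin
      Π< (l ∸ n) g⁻ * numerator (n ∸ l) t
        ≈⟨ *-congˡ (reflexive (≡.cong (λ j → numerator j t) (ℕₚ.m≤n⇒m∸n≡0 n≤l))) ⟩
      Π< (l ∸ n) g⁻ * 1#
        ≈⟨ *-congˡ (inverse (ℤ.- ℤ.+ (l ∸ n))) ⟨
      Π< (l ∸ n) g⁻ * ((1# - a (ℤ.- ℤ.+ (l ∸ n)) * t) * g⁻ (l ∸ n))
        ≈⟨ solve 3 (λ p q r → p :* (q :* r) := q :* (p :* r :* 𝟙)) refl _ _ _ ⟩
      (1# - a (ℤ.- ℤ.+ (l ∸ n)) * t) * (Π< (suc (l ∸ n)) g⁻ * 1#)
        ≡⟨ ≡.cong₂ (λ k i → (1# - a k * t) * (Π< i g⁻ * 1#)) index (ℕₚ.+-∸-assoc 1 n≤l) ⟨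
      (1# - a (ℤ.+ n ℤ.- ℤ.+ l) * t) * (Π< (suc l ∸ n) g⁻ * 1#)
        ≡⟨ ≡.cong (λ j → (1# - a (ℤ.+ n ℤ.- ℤ.+ l) * t) * (Π< (suc l ∸ n) g⁻ * numerator j t)) (ℕₚ.m≤n⇒m∸n≡0 (ℕₚ.m≤n⇒m≤1+n n≤l)) ⟨
      (1# - a (ℤ.+ n ℤ.- ℤ.+ l) * t) * dualFactor n t g (suc l) ∎
      where
      g⁻ : ℕ → Carrier
      g⁻ k = g (ℤ.- ℤ.+ k)
      index : ℤ.+ n ℤ.- ℤ.+ l ≡ ℤ.- ℤ.+ (l ∸ n)
      index = ≡.trans (ℤₚ.m-n≡m⊖n n l) (ℤₚ.⊖-≤ n≤l)

    dualFactor-shift : ∀ s n t g l → dualFactor (s ℕ.+ n) t g (s ℕ.+ l) ≡ dualFactor n t g l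
    dualFactor-shift s n t g l = ≡.cong₂ (λ i j → Π< i (λ k → g (ℤ.- ℤ.+ k)) * numerator j t)
      (ℕₚ.[m+n]∸[m+o]≡n∸o s l n) (ℕₚ.[m+n]∸[m+o]≡n∸o s n l)

    -- `dualFactor` depends only on the difference of its two numbers, so raising both by `s`
    -- changes nothing but the power of t.
    dualPower-shift : ∀ s n t g l → dualPower (s ℕ.+ n) t g (s ℕ.+ l) ≈ t ^ s * (t ^ l * dualFactor n t g (suc l))
    dualPower-shift s n t g l = begin
      t ^ (s ℕ.+ l) * dualFactor (s ℕ.+ n) t g (suc (s ℕ.+ l))
        ≈⟨ *-cong (^-homo-* t s l) (reflexive (≡.trans (≡.cong (dualFactor (s ℕ.+ n) t g) (≡.sym (ℕₚ.+-suc s l))) (dualFactor-shift s n t g (suc l)))) ⟩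
      t ^ s * t ^ l * dualFactor n t g (suc l)    ≈⟨ *-assoc _ _ _ ⟩
      t ^ s * (t ^ l * dualFactor n t g (suc l))  ∎

    -- The additional indices run from s + m down to m + 1, just beyond those of `numerator m`. This
    -- completes the numerators when there are more x than y.
    numerator-+ : ∀ s m t → numerator m t * Π< s (λ j → 1# - a (ℤ.+ (s ℕ.+ m) ℤ.- ℤ.+ j) * t) ≈ numerator (s ℕ.+ m) t
    numerator-+ zero    m t = *-identityʳ _
    numerator-+ (suc s) m t = begin
      numerator m t * Π< (suc s) (λ j → 1# - a (ℤ.+ suc (s ℕ.+ m) ℤ.- ℤ.+ j) * t)
        ≈⟨ *-congˡ (trans (Π<-head s _) (*-congˡ (Π<-cong s (λ j → reflexive (≡.cong (λ k → 1# - a k * t) (index j)))))) ⟩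
      numerator m t * ((1# - a (ℤ.+ suc (s ℕ.+ m ℕ.+ 0)) * t) * Π< s (λ j → 1# - a (ℤ.+ (s ℕ.+ m) ℤ.- ℤ.+ j) * t))
        ≈⟨ solve 3 (λ p q r → p :* (q :* r) := p :* r :* q) refl _ _ _ ⟩
      numerator m t * Π< s (λ j → 1# - a (ℤ.+ (s ℕ.+ m) ℤ.- ℤ.+ j) * t) * (1# - a (ℤ.+ suc (s ℕ.+ m ℕ.+ 0)) * t)
        ≈⟨ *-cong (numerator-+ s m t) (reflexive (≡.cong (λ k → 1# - a (ℤ.+ suc k) * t) (ℕₚ.+-identityʳ _))) ⟩
      numerator (suc s ℕ.+ m) t ∎
      where
      index : ∀ j → ℤ.+ suc (s ℕ.+ m) ℤ.- ℤ.+ suc j ≡ ℤ.+ (s ℕ.+ m) ℤ.- ℤ.+ j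
      index j = ≡.trans (ℤₚ.m-n≡m⊖n (suc (s ℕ.+ m)) (suc j)) (≡.trans (ℤₚ.[1+m]⊖[1+n]≡m⊖n (s ℕ.+ m) j) (≡.sym (ℤₚ.m-n≡m⊖n (s ℕ.+ m) j)))

    -- Finite sums of products of alternants for nilpotent y

    module Cauchy {I : Set} {K : Set} (x : I → Carrier) (y : K → Carrier)
      (g : ℤ → K → Carrier) (g-inverse : ∀ j k → (1# - a j * y k) * g j k ≈ 1#)
      (inv : I → K → Carrier) (inverse : ∀ i k → (1# - x i * y k) * inv i k ≈ 1#)
      (N : ℕ) (nilpotent : ∀ k → y k ^ N ≈ 0#)
      where

      xRow : ℕ → I → ℕ → Carrier
      xRow n i = factorial (λ k → a (ℤ.+ n ℤ.- ℤ.+ k)) (x i)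

      yRow : ℕ → K → ℕ → Carrier
      yRow m k = dualPower m (y k) (λ j → g j k)

      numerators : ℕ → K → Carrier
      numerators n k = numerator n (y k)

      dualFactor-0 : ∀ n k → dualFactor n (y k) (λ j → g j k) 0 ≈ numerators n k
      dualFactor-0 n k = trans (*-congʳ (reflexive (≡.cong (λ i → Π< i (λ j → g (ℤ.- ℤ.+ j) k)) (ℕₚ.0∸n≡0 n)))) (*-identityˡ _)

      telescope-nilpotent : ∀ {k} (X q : ℕ → Carrier) i → y k ^ N ≈ 0# →
        (X 0 * q 0 - X N * (y k ^ N * q N)) * inv i k ≈ X 0 * q 0 * inv i k
      telescope-nilpotent X q i z = trans (*-congʳ (+-congˡ (-‿cong (*-congˡ (*-congʳ z)))))
        (solve 4 (λ p q r i → (p :- q :* (𝟘 :* r)) :* i := p :* i) refl _ _ _ _)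

      module _ (s : ℕ) where

        -- An entry of the Cauchy-Binet matrix for s + n variables y. The shift takes out y^s and
        -- leaves the telescoping sum for `n`, which starts at (x‖a)⁰ = 1 and whose remainder
        -- contains y^N = 0.
        Σ-xRow-yRow : ∀ n i k → Σ< N (λ l → xRow n i l * yRow (s ℕ.+ n) k (s ℕ.+ l)) ≈
                      numerators n k * cauchyRow y x inv inverse s i k
        Σ-xRow-yRow n i k = begin
          Σ< N (λ l → X l * yRow (s ℕ.+ n) k (s ℕ.+ l))
            ≈⟨ Σ<-cong N (λ l → trans (*-congˡ (dualPower-shift s n (y k) (λ j → g j k) l))
                 (solve 3 (λ p q r → p :* (q :* r) := q :* (p :* r)) refl _ _ _)) ⟩
          Σ< N (λ l → y k ^ s * (X l * (y k ^ l * q (suc l))))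
            ≈⟨ Σ<-*ˡ N (y k ^ s) _ ⟨
          y k ^ s * Σ< N (λ l → X l * (y k ^ l * q (suc l)))
            ≈⟨ *-congˡ (trans (telescope X _ q (inverse i k) (λ l → refl) (dualFactor-suc n (λ j → g-inverse j k)) N)
                 (telescope-nilpotent X q i (nilpotent k))) ⟩
          y k ^ s * (1# * q 0 * inv i k)
            ≈⟨ *-congˡ (*-congʳ (*-congˡ (dualFactor-0 n k))) ⟩
          y k ^ s * (1# * numerators n k * inv i k)
            ≈⟨ solve 3 (λ p q r → p :* (𝟙 :* q :* r) := q :* (p :* r)) refl _ _ _ ⟩
          numerators n k * (y k ^ s * inv i k) ∎
          where
          X = xRow n i
          q = dualFactor n (y k) (λ j → g j k)

        -- Here the telescoping sum starts at the factorial power of exponent `s` instead of 1. The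
        -- parameter at s + l is a with index (s + m) - (s + l) = m - l, just as `dualFactor-suc`
        -- requires for `m`. The initial power depends on x and has to stay in the row.
        Σ-yRow-xRow : ∀ m k i → Σ< N (λ l → yRow m k l * xRow (s ℕ.+ m) i (s ℕ.+ l)) ≈
                      numerators m k * (xRow (s ℕ.+ m) i s * inv i k)
        Σ-yRow-xRow m k i = begin
          Σ< N (λ l → y k ^ l * q (suc l) * X l)
            ≈⟨ Σ<-cong N (λ l → *-comm _ _) ⟩
          Σ< N (λ l → X l * (y k ^ l * q (suc l)))
            ≈⟨ trans (telescope X (λ l → a (ℤ.+ m ℤ.- ℤ.+ l)) q (inverse i k) X-suc (dualFactor-suc m (λ j → g-inverse j k)) N)
                 (telescope-nilpotent X q i (nilpotent k)) ⟩
          X 0 * q 0 * inv i k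
            ≈⟨ *-congʳ (*-cong (reflexive (≡.cong (xRow (s ℕ.+ m) i) (ℕₚ.+-identityʳ s))) (dualFactor-0 m k)) ⟩
          xRow (s ℕ.+ m) i s * numerators m k * inv i k
            ≈⟨ solve 3 (λ p q r → p :* q :* r := q :* (p :* r)) refl _ _ _ ⟩
          numerators m k * (xRow (s ℕ.+ m) i s * inv i k) ∎
          where
          X : ℕ → Carrier
          X l = xRow (s ℕ.+ m) i (s ℕ.+ l)
          q = dualFactor m (y k) (λ j → g j k)
          index : ∀ l → ℤ.+ (s ℕ.+ m) ℤ.- ℤ.+ (s ℕ.+ l) ≡ ℤ.+ m ℤ.- ℤ.+ l
          index l = ≡.trans (ℤₚ.m-n≡m⊖n (s ℕ.+ m) (s ℕ.+ l))
            (≡.trans (ℤₚ.+-cancelˡ-⊖ s m l) (≡.sym (ℤₚ.m-n≡m⊖n m l)))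
          X-suc : ∀ l → X (suc l) ≈ X l * (x i - a (ℤ.+ m ℤ.- ℤ.+ l))
          X-suc l = trans (reflexive (≡.cong (xRow (s ℕ.+ m) i) (ℕₚ.+-suc s l)))
            (*-congˡ (reflexive (≡.cong (λ j → x i - a j) (index l))))

      -- The row of exponent s - 1 is y^(s-1) times the numerator of `n` factors, and each smaller
      -- exponent adds one factor. Induction with s - 1 and n + 1 leaves one surplus factor 1 - aₙ₊₁
      -- y in all rows below the first, and the first row clears it.
      yRows-reduce : ∀ {Φ : List (K → Carrier) → Carrier} → Alternating Φ → ∀ s n →
        Φ (map (flip (yRow (s ℕ.+ n))) (downFrom s)) ≈ Φ (map (λ v k → numerators n k * v k) (monomials y s))
      yRows-reduce alt zero    n = refl
      yRows-reduce {Φ} alt (suc s) n = begin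
        Φ (flip (yRow (suc s ℕ.+ n)) s ∷ map (flip (yRow (suc s ℕ.+ n))) (downFrom s))
          ≡⟨ ≡.cong (λ m → Φ (flip (yRow (suc s ℕ.+ n)) s ∷ map (flip (yRow m)) (downFrom s))) (≡.sym (ℕₚ.+-suc s n)) ⟩
        Φ (flip (yRow (suc s ℕ.+ n)) s ∷ map (flip (yRow (s ℕ.+ suc n))) (downFrom s))
          ≈⟨ yRows-reduce (after alt _) s (suc n) ⟩
        Φ (flip (yRow (suc s ℕ.+ n)) s ∷ map (λ v k → numerators (suc n) k * v k) (monomials y s))
          ≈⟨ alternating-cong alt (top ∷ rest (monomials y s)) ⟩
        Φ (map (λ v k → numerators n k * v k) ((λ k → y k ^ s) ∷ map (λ v k → (1# - a (ℤ.+ suc n) * y k) * v k) (monomials y s)))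
          ≈⟨ monomials-multiplied-1-ty y (multiplied alt (numerators n)) (a (ℤ.+ suc n)) s ⟩
        Φ (map (λ v k → numerators n k * v k) (monomials y (suc s))) ∎
        where
        top : ∀ k → yRow (suc s ℕ.+ n) k s ≈ numerators n k * y k ^ s
        top k = trans (*-congˡ (trans
          (reflexive (≡.trans
            (≡.cong (dualFactor (suc s ℕ.+ n) (y k) (λ j → g j k)) (≡.sym (ℕₚ.+-identityʳ (suc s))))
            (dualFactor-shift (suc s) n (y k) (λ j → g j k) 0)))
          (dualFactor-0 n k))) (*-comm _ _)
        rest : ∀ vs → Pointwise _≈ᵣ_ (map (λ v k → numerators (suc n) k * v k) vs)
                 (map (λ v k → numerators n k * v k) (map (λ v k → (1# - a (ℤ.+ suc n) * y k) * v k) vs))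
        rest []       = []
        rest (v ∷ vs) = (λ k → *-assoc _ _ _) ∷ rest vs

      private
        inverse′ : ∀ k i → (1# - y k * x i) * inv i k ≈ 1#
        inverse′ k i = trans (*-congʳ (+-congˡ (-‿cong (*-comm _ _)))) (inverse i k)

        cauchyRow′ : ℕ → K → I → Carrier
        cauchyRow′ = cauchyRow x y (flip inv) inverse′

      -- (x - b) / (1 - x y) = (1 - b y) x / (1 - x y) - b
      cauchyRow′-reduce : ∀ {Φ : List (I → Carrier) → Carrier} → Alternating Φ → ∀ b s ks →
        Φ (map (λ v i → (x i - b) * v i) (map (cauchyRow′ s) ks ++ monomials x s) ++ (λ _ → 1#) ∷ []) ≈
        Πᴸ ks (λ k → 1# - b * y k) * Φ (map (cauchyRow′ (suc s)) ks ++ monomials x (suc s))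
      cauchyRow′-reduce alt b s []       = trans (monomials-multiplied-y-t x alt b s) (sym (*-identityˡ _))
      cauchyRow′-reduce {Φ} alt b s (k ∷ ks) = begin
        Φ (v ∷ map (λ v i → (x i - b) * v i) (map (cauchyRow′ s) ks ++ monomials x s) ++ (λ _ → 1#) ∷ [])
          ≈⟨ cauchyRow′-reduce (after alt v) b s ks ⟩
        P * Φ (v ∷ map (cauchyRow′ (suc s)) ks ++ monomials x (suc s))
          -- The remainder - b x^s is a multiple of the first row of `monomials x (suc s)`, which is
          -- available because the rows behind have already been reduced.
          ≈⟨ *-congˡ (shear alt (map (cauchyRow′ (suc s)) ks) {k = - b} (λ i → x i ^ s) (monomials x s) split) ⟩
        P * Φ ((λ i → (1# - b * y k) * cauchyRow′ (suc s) k i) ∷ map (cauchyRow′ (suc s)) ks ++ monomials x (suc s))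
          ≈⟨ *-congˡ (scale alt _ (λ _ → refl)) ⟩
        P * ((1# - b * y k) * Φ (map (cauchyRow′ (suc s)) (k ∷ ks) ++ monomials x (suc s)))
          ≈⟨ solve 3 (λ p q r → p :* (q :* r) := q :* p :* r) refl _ _ _ ⟩
        (1# - b * y k) * P * Φ (map (cauchyRow′ (suc s)) (k ∷ ks) ++ monomials x (suc s)) ∎
        where
        P = Πᴸ ks (λ k → 1# - b * y k)
        v : I → Carrier
        v i = (x i - b) * cauchyRow′ s k i
        split : ∀ i → v i ≈ (1# - b * y k) * cauchyRow′ (suc s) k i + - b * x i ^ s
        split i = begin
          (x i - b) * (x i ^ s * inv i k)
            ≈⟨ solve 5 (λ x b p u y → (x :- b) :* (p :* u) := (𝟙 :- b :* y) :* (x :* p :* u) :+ :- b :* (p :* ((𝟙 :- x :* y) :* u)))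
                 refl (x i) b (x i ^ s) (inv i k) (y k) ⟩
          (1# - b * y k) * (x i * x i ^ s * inv i k) + - b * (x i ^ s * ((1# - x i * y k) * inv i k))
            ≈⟨ +-congˡ (*-congˡ (trans (*-congˡ (inverse i k)) (*-identityʳ _))) ⟩
          (1# - b * y k) * (x i * x i ^ s * inv i k) + - b * x i ^ s ∎

      -- Every row but the constant last one contains x - b₀. Without this factor the rows have the
      -- same shape for s - 1 and the shifted sequence `b ∘ suc`; after induction the factor is put
      -- back, which costs 1 - b₀ y for each y.
      xRows-reduce : ∀ {Φ : List (I → Carrier) → Carrier} → Alternating Φ → ∀ b s ks →
        Φ (map (λ k i → factorial b (x i) s * inv i k) ks ++ map (λ r i → factorial b (x i) r) (downFrom s)) ≈
        Πᴸ ks (λ k → Π< s (λ j → 1# - b j * y k)) * Φ (map (cauchyRow′ s) ks ++ monomials x s)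
      xRows-reduce {Φ} alt b zero    ks =
        trans (sym (*-identityˡ _)) (*-congʳ (sym (Πᴸ-1 ks)))
      xRows-reduce {Φ} alt b (suc s) ks = begin
        Φ (map (λ k i → factorial b (x i) (suc s) * inv i k) ks ++ map (λ r i → factorial b (x i) r) (downFrom (suc s)))
          ≡⟨ ≡.cong (λ rs → Φ (map (λ k i → factorial b (x i) (suc s) * inv i k) ks ++ map (λ r i → factorial b (x i) r) rs)) (downFrom-suc s) ⟩
        Φ (map (λ k i → factorial b (x i) (suc s) * inv i k) ks ++ map (λ r i → factorial b (x i) r) (map suc (downFrom s) ++ 0 ∷ []))
          ≈⟨ alternating-cong alt (factors ks) ⟩
        Φ′ (map (λ k i → factorial (b ∘ suc) (x i) s * inv i k) ks ++ map (λ r i → factorial (b ∘ suc) (x i) r) (downFrom s))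
          ≈⟨ xRows-reduce (multiplied (before alt ((λ _ → 1#) ∷ [])) (λ i → x i - b 0)) (b ∘ suc) s ks ⟩
        Πᴸ ks (λ k → Π< s (λ j → 1# - b (suc j) * y k)) * Φ′ (map (cauchyRow′ s) ks ++ monomials x s)
          ≈⟨ *-congˡ (cauchyRow′-reduce alt (b 0) s ks) ⟩
        Πᴸ ks (λ k → Π< s (λ j → 1# - b (suc j) * y k)) * (Πᴸ ks (λ k → 1# - b 0 * y k) * Φ (map (cauchyRow′ (suc s)) ks ++ monomials x (suc s)))
          ≈⟨ solve 3 (λ p q r → p :* (q :* r) := q :* p :* r) refl _ _ _ ⟩
        Πᴸ ks (λ k → 1# - b 0 * y k) * Πᴸ ks (λ k → Π< s (λ j → 1# - b (suc j) * y k)) * Φ (map (cauchyRow′ (suc s)) ks ++ monomials x (suc s))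
          ≈⟨ *-congʳ (Πᴸ-* ks _ _) ⟨
        Πᴸ ks (λ k → (1# - b 0 * y k) * Π< s (λ j → 1# - b (suc j) * y k)) * Φ (map (cauchyRow′ (suc s)) ks ++ monomials x (suc s))
          ≈⟨ *-congʳ (Πᴸ-cong ks (λ k → Π<-head s (λ j → 1# - b j * y k))) ⟨
        Πᴸ ks (λ k → Π< (suc s) (λ j → 1# - b j * y k)) * Φ (map (cauchyRow′ (suc s)) ks ++ monomials x (suc s)) ∎
        where
        H : (I → Carrier) → I → Carrier
        H v i = (x i - b 0) * v i
        Φ′ : List (I → Carrier) → Carrier
        Φ′ vs = Φ (map H vs ++ (λ _ → 1#) ∷ [])
        downFrom-suc : ∀ s → downFrom (suc s) ≡ map suc (downFrom s) ++ 0 ∷ []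
        downFrom-suc zero    = ≡.refl
        downFrom-suc (suc s) = ≡.cong (suc s ∷_) (downFrom-suc s)
        factors-fixed : ∀ rs → Pointwise _≈ᵣ_ (map (λ r i → factorial b (x i) r) (map suc rs ++ 0 ∷ []))
          (map H (map (λ r i → factorial (b ∘ suc) (x i) r) rs) ++ (λ _ → 1#) ∷ [])
        factors-fixed []       = (λ _ → refl) ∷ []
        factors-fixed (r ∷ rs) = (λ i → Π<-head r _) ∷ factors-fixed rs
        factors : ∀ ks → Pointwise _≈ᵣ_
          (map (λ k i → factorial b (x i) (suc s) * inv i k) ks ++ map (λ r i → factorial b (x i) r) (map suc (downFrom s) ++ 0 ∷ []))
          (map H (map (λ k i → factorial (b ∘ suc) (x i) s * inv i k) ks ++ map (λ r i → factorial (b ∘ suc) (x i) r) (downFrom s)) ++ (λ _ → 1#) ∷ [])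
        factors []       = factors-fixed (downFrom s)
        factors (k ∷ ks) = (λ i → trans (*-congʳ (Π<-head s _)) (*-assoc _ _ _)) ∷ factors ks

      scale-rows : ∀ {Φ : List (I → Carrier) → Carrier} → Alternating Φ → ∀ h (f : K → I → Carrier) ks vs →
                   Φ (map (λ k i → h k * f k i) ks ++ vs) ≈ Πᴸ ks h * Φ (map f ks ++ vs)
      scale-rows alt h f []       vs = sym (*-identityˡ _)
      scale-rows alt h f (k ∷ ks) vs = trans (scale alt _ (λ _ → refl))
        (trans (*-congˡ (scale-rows (after alt (f k)) h f ks vs)) (sym (*-assoc _ _ _)))

      -- With m = s + n a partition of at most n parts has the y-exponents s + l for its x-exponents
      -- l, followed by s - 1 , ... , 0. Transposition makes the latter rows that do not depend on
      -- the partition, and Cauchy-Binet runs over the others.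
      cauchy-≤ : ∀ s is ks {n m} → length is ≡ n → length ks ≡ m → m ≡ s ℕ.+ n →
        Σᴸ (decreasingSequences n N) (λ ls →
          detᴸ (map (xRow n) is) ls * detᴸ (map (yRow m) ks) (map (s ℕ.+_) ls ++ downFrom s)) ≈
        vandermonde x is * vandermonde y ks * (Πᴸ ks (numerators n) * Πᴸ is (λ i → Πᴸ ks (inv i)))
      cauchy-≤ s is ks ≡.refl ≡.refl eq = begin
        Σᴸ (decreasingSequences n N) (λ ls → detᴸ (map (xRow n) is) ls * detᴸ (map (yRow (length ks)) ks) (map (s ℕ.+_) ls ++ downFrom s))
          ≈⟨ Σᴸ-cong (decreasingSequences n N) (λ ls → *-congˡ (Y-det ls)) ⟩
        Σᴸ (decreasingSequences n N) (λ ls → detᴸ (map (xRow n) is) ls * Φ (map Y ls))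
          ≡⟨ ≡.cong (λ k → Σᴸ (decreasingSequences k N) (λ ls → detᴸ (map (xRow n) is) ls * Φ (map Y ls))) (Listₚ.length-map (xRow n) is) ⟨
        Σᴸ (decreasingSequences (length (map (xRow n) is)) N) (λ ls → detᴸ (map (xRow n) is) ls * Φ (map Y ls))
          ≈⟨ cauchyBinet (before alt fixed) N Y (map (xRow n) is) ⟩
        detᴸ (map (λ f k → Σ< N (λ l → f l * Y l k)) (map (xRow n) is) ++ fixed) ks
          ≈⟨ alternating-cong alt (rows is) ⟩
        detᴸ (map (λ i k → numerators n k * e i k) is ++ fixed) ks
          ≈⟨ reduce alt is ⟩
        detᴸ (map G (map e is ++ monomials y s)) ks
          ≈⟨ scale-columns (numerators n) (map e is ++ monomials y s) ks ⟩
        Πᴸ ks (numerators n) * detᴸ (map e is ++ monomials y s) ks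
          ≈⟨ *-congˡ (cauchyDeterminant y x inv inverse s is ks (≡.trans eq (ℕₚ.+-comm s n))) ⟩
        Πᴸ ks (numerators n) * (vandermonde x is * vandermonde y ks * Πᴸ is (λ i → Πᴸ ks (inv i)))
          ≈⟨ solve 3 (λ p q r → p :* (q :* r) := q :* (p :* r)) refl _ _ _ ⟩
        vandermonde x is * vandermonde y ks * (Πᴸ ks (numerators n) * Πᴸ is (λ i → Πᴸ ks (inv i))) ∎
        where
        n = length is
        alt = det-alternating {A = K} ks
        e = cauchyRow y x inv inverse s
        Y : ℕ → K → Carrier
        Y l k = yRow (s ℕ.+ n) k (s ℕ.+ l)
        fixed = map (flip (yRow (s ℕ.+ n))) (downFrom s)
        Φ : List (K → Carrier) → Carrier
        Φ vs = detᴸ (vs ++ fixed) ks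
        G : (K → Carrier) → K → Carrier
        G v k = numerators n k * v k
        Y-det : ∀ ls → detᴸ (map (yRow (length ks)) ks) (map (s ℕ.+_) ls ++ downFrom s) ≈ Φ (map Y ls)
        Y-det ls = begin
          detᴸ (map (yRow (length ks)) ks) (map (s ℕ.+_) ls ++ downFrom s)
            ≡⟨ ≡.cong (λ m → detᴸ (map (yRow m) ks) (map (s ℕ.+_) ls ++ downFrom s)) eq ⟩
          detᴸ (map (yRow (s ℕ.+ n)) ks) (map (s ℕ.+_) ls ++ downFrom s)
            ≈⟨ transpose (yRow (s ℕ.+ n)) ks _ ⟩
          detᴸ (map (flip (yRow (s ℕ.+ n))) (map (s ℕ.+_) ls ++ downFrom s)) ks
            ≡⟨ ≡.cong (λ vs → detᴸ vs ks) (≡.trans (Listₚ.map-++ _ (map (s ℕ.+_) ls) (downFrom s))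
                 (≡.cong (_++ fixed) (≡.sym (Listₚ.map-∘ ls)))) ⟩
          Φ (map Y ls) ∎
        rows : ∀ is′ → Pointwise _≈ᵣ_ (map (λ f k → Σ< N (λ l → f l * Y l k)) (map (xRow n) is′) ++ fixed)
                                      (map (λ i k → numerators n k * e i k) is′ ++ fixed)
        rows []        = Pointwise.refl (λ _ → refl)
        rows (i ∷ is′) = Σ-xRow-yRow s n i ∷ rows is′
        reduce : ∀ {Ψ : List (K → Carrier) → Carrier} → Alternating Ψ → ∀ is′ →
          Ψ (map (λ i k → numerators n k * e i k) is′ ++ fixed) ≈ Ψ (map G (map e is′ ++ monomials y s))
        reduce alt []        = yRows-reduce alt s n
        reduce alt (i ∷ is′) = reduce (after alt _) is′

      -- Now the fixed exponents belong to x, so Cauchy-Binet expands the dual determinant and the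
      -- reduced rows are functions of x. Summation supplies the first m numerator factors for each
      -- y, and `xRows-reduce` the other s.
      cauchy-≥ : ∀ s is ks {n m} → length is ≡ n → length ks ≡ m → n ≡ s ℕ.+ m →
        Σᴸ (decreasingSequences m N) (λ ls →
          detᴸ (map (xRow n) is) (map (s ℕ.+_) ls ++ downFrom s) * detᴸ (map (yRow m) ks) ls) ≈
        vandermonde x is * vandermonde y ks * (Πᴸ ks (numerators n) * Πᴸ is (λ i → Πᴸ ks (inv i)))
      cauchy-≥ s is ks ≡.refl ≡.refl eq = begin
        Σᴸ (decreasingSequences m N) (λ ls → detᴸ (map (xRow (length is)) is) (map (s ℕ.+_) ls ++ downFrom s) * detᴸ (map (yRow m) ks) ls)
          ≈⟨ Σᴸ-cong (decreasingSequences m N) (λ ls → trans (*-comm _ _) (*-congˡ (X-det ls))) ⟩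
        Σᴸ (decreasingSequences m N) (λ ls → detᴸ (map (yRow m) ks) ls * Φ (map X ls))
          ≡⟨ ≡.cong (λ k → Σᴸ (decreasingSequences k N) (λ ls → detᴸ (map (yRow m) ks) ls * Φ (map X ls))) (Listₚ.length-map (yRow m) ks) ⟨
        Σᴸ (decreasingSequences (length (map (yRow m) ks)) N) (λ ls → detᴸ (map (yRow m) ks) ls * Φ (map X ls))
          ≈⟨ cauchyBinet (before alt fixed) N X (map (yRow m) ks) ⟩
        detᴸ (map (λ f i → Σ< N (λ l → f l * X l i)) (map (yRow m) ks) ++ fixed) is
          ≈⟨ alternating-cong alt (rows ks) ⟩
        detᴸ (map (λ k i → numerators m k * (xRow n i s * inv i k)) ks ++ fixed) is
          ≈⟨ scale-rows alt (numerators m) (λ k i → xRow n i s * inv i k) ks fixed ⟩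
        Πᴸ ks (numerators m) * detᴸ (map (λ k i → xRow n i s * inv i k) ks ++ fixed) is
          ≈⟨ *-congˡ (xRows-reduce alt _ s ks) ⟩
        Πᴸ ks (numerators m) * (Πᴸ ks (λ k → Π< s (λ j → 1# - a (ℤ.+ n ℤ.- ℤ.+ j) * y k)) * detᴸ (map (cauchyRow′ s) ks ++ monomials x s) is)
          ≈⟨ *-assoc _ _ _ ⟨
        Πᴸ ks (numerators m) * Πᴸ ks (λ k → Π< s (λ j → 1# - a (ℤ.+ n ℤ.- ℤ.+ j) * y k)) * detᴸ (map (cauchyRow′ s) ks ++ monomials x s) is
          ≈⟨ *-cong (trans (sym (Πᴸ-* ks _ _)) (Πᴸ-cong ks (λ k → numerator-+ s m (y k))))
                    (cauchyDeterminant x y (flip inv) inverse′ s ks is (≡.trans eq (ℕₚ.+-comm s m))) ⟩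
        Πᴸ ks (numerators n) * (vandermonde y ks * vandermonde x is * Πᴸ ks (λ k → Πᴸ is (λ i → inv i k)))
          ≈⟨ *-cong (reflexive (≡.cong (λ n → Πᴸ ks (numerators n)) eq)) (*-congˡ (Πᴸ-comm is ks inv)) ⟨
        Πᴸ ks (numerators (length is)) * (vandermonde y ks * vandermonde x is * Πᴸ is (λ i → Πᴸ ks (inv i)))
          ≈⟨ solve 4 (λ p q r t → p :* (q :* r :* t) := r :* q :* (p :* t)) refl _ _ _ _ ⟩
        vandermonde x is * vandermonde y ks * (Πᴸ ks (numerators (length is)) * Πᴸ is (λ i → Πᴸ ks (inv i))) ∎
        where
        m = length ks
        n = s ℕ.+ m
        alt = det-alternating {A = I} is
        X : ℕ → I → Carrier
        X l i = xRow n i (s ℕ.+ l)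
        fixed = map (flip (xRow n)) (downFrom s)
        Φ : List (I → Carrier) → Carrier
        Φ vs = detᴸ (vs ++ fixed) is
        X-det : ∀ ls → detᴸ (map (xRow (length is)) is) (map (s ℕ.+_) ls ++ downFrom s) ≈ Φ (map X ls)
        X-det ls = begin
          detᴸ (map (xRow (length is)) is) (map (s ℕ.+_) ls ++ downFrom s)
            ≡⟨ ≡.cong (λ n → detᴸ (map (xRow n) is) (map (s ℕ.+_) ls ++ downFrom s)) eq ⟩
          detᴸ (map (xRow n) is) (map (s ℕ.+_) ls ++ downFrom s)
            ≈⟨ transpose (xRow n) is _ ⟩
          detᴸ (map (flip (xRow n)) (map (s ℕ.+_) ls ++ downFrom s)) is
            ≡⟨ ≡.cong (λ vs → detᴸ vs is) (≡.trans (Listₚ.map-++ _ (map (s ℕ.+_) ls) (downFrom s))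
                 (≡.cong (_++ fixed) (≡.sym (Listₚ.map-∘ ls)))) ⟩
          Φ (map X ls) ∎
        rows : ∀ ks′ → Pointwise _≈ᵣ_ (map (λ f i → Σ< N (λ l → f l * X l i)) (map (yRow m) ks′) ++ fixed)
                                      (map (λ k i → numerators m k * (xRow n i s * inv i k)) ks′ ++ fixed)
        rows []        = Pointwise.refl (λ _ → refl)
        rows (k ∷ ks′) = Σ-yRow-xRow s m k ∷ rows ks′

  dualPower-cong : ∀ {a a′ t t′ g g′} → (∀ k → a k ≈ a′ k) → t ≈ t′ → (∀ k → g k ≈ g′ k) →
                   ∀ n l → dualPower a n t g l ≈ dualPower a′ n t′ g′ l
  dualPower-cong a≈ t≈ g≈ n l = *-cong (^-congˡ l t≈) (*-cong
    (Π<-cong (suc l ∸ n) (λ k → g≈ (ℤ.- ℤ.+ k)))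
    (Π<-cong (n ∸ suc l) (λ k → +-congˡ (-‿cong (*-cong (a≈ (ℤ.+ suc k)) t≈)))))

-- Partitions and strictly decreasing sequences

infix 4 _≻_
data _≻_ : ℕ → List ℕ → Set where
  []  : ∀ {N} → N ≻ []
  _∷_ : ∀ {N l ls} → l ℕ.< N → l ≻ ls → N ≻ l ∷ ls

≻-weaken : ∀ {M N ls} → M ℕ.≤ N → M ≻ ls → N ≻ ls
≻-weaken M≤N []         = []
≻-weaken M≤N (l<M ∷ d) = ℕₚ.<-≤-trans l<M M≤N ∷ d

≻-length : ∀ {N ls} → N ≻ ls → length ls ℕ.≤ N
≻-length []        = z≤n
≻-length (l<N ∷ d) = ℕₚ.≤-trans (s≤s (≻-length d)) l<N

≻-downFrom : ∀ {N ls} → N ≻ ls → length ls ≡ N → ls ≡ downFrom N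
≻-downFrom []        ≡.refl = ≡.refl
≻-downFrom (_∷_ {l = l} {ls} l<N d) ≡.refl = ≡.cong₂ _∷_ l≡ (≻-downFrom (≡.subst (_≻ ls) l≡ d) ≡.refl)
  where
  l≡ : l ≡ length ls
  l≡ = ℕₚ.≤-antisym (ℕₚ.≤-pred l<N) (≻-length d)

∈-decreasingSequences : ∀ {N ls} → N ≻ ls → ls ∈ decreasingSequences (length ls) N
∈-decreasingSequences []                  = here ≡.refl
∈-decreasingSequences {suc N} (_∷_ {l = l} {ls} l<N d) with l ℕₚ.≟ N
... | yes ≡.refl = ∈-++⁺ʳ (decreasingSequences (suc (length ls)) N) (∈-map⁺ (N ∷_) (∈-decreasingSequences d))
... | no l≢N     = ∈-++⁺ˡ (∈-decreasingSequences (ℕₚ.≤∧≢⇒< (ℕₚ.≤-pred l<N) l≢N ∷ d))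

all-decreasingSequences : ∀ k N → All (λ ls → N ≻ ls × length ls ≡ k) (decreasingSequences k N)
all-decreasingSequences zero    N       = ([] , ≡.refl) ∷ []
all-decreasingSequences (suc k) zero    = []
all-decreasingSequences (suc k) (suc N) = Allₚ.++⁺
  (All.map (λ (d , eq) → ≻-weaken (ℕₚ.n≤1+n N) d , eq) (all-decreasingSequences (suc k) N))
  (Allₚ.map⁺ (All.map (λ (d , eq) → (ℕₚ.n<1+n N ∷ d) , ≡.cong suc eq) (all-decreasingSequences k N)))

unique-decreasingSequences : ∀ k N → Unique (decreasingSequences k N)
unique-decreasingSequences zero    N       = [] ∷ []
unique-decreasingSequences (suc k) zero    = []
unique-decreasingSequences (suc k) (suc N) = Uniqueₚ.++⁺
  (unique-decreasingSequences (suc k) N)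
  (Uniqueₚ.map⁺ Listₚ.∷-injectiveʳ (unique-decreasingSequences k N))
  λ (∈ˡ , ∈ʳ) → disjoint (All.lookup (all-decreasingSequences (suc k) N) ∈ˡ .proj₁) (∈-map⁻ (N ∷_) ∈ʳ .proj₂ .proj₂)
  where
  disjoint : ∀ {ls ls′} → N ≻ ls → ¬ ls ≡ N ∷ ls′
  disjoint (l<N ∷ _) ≡.refl = ℕₚ.<-irrefl ≡.refl l<N

-- The exponents λ₁ + k - 1 > λ₂ + k - 2 > ⋯ > λₖ.
exponents : ℕ → List ℕ → List ℕ
exponents zero    ps = []
exponents (suc k) ps = part ps 0 ℕ.+ k ∷ exponents k (drop 1 ps)

part-drop : ∀ ps j → part (drop 1 ps) j ≡ part ps (suc j)
part-drop []       j = ≡.refl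
part-drop (p ∷ ps) j = ≡.refl

part-≥-length : ∀ ps j → length ps ℕ.≤ j → part ps j ≡ 0
part-≥-length []       j       _         = ≡.refl
part-≥-length (p ∷ ps) (suc j) (s≤s ≤) = part-≥-length ps j ≤

length-exponents : ∀ k ps → length (exponents k ps) ≡ k
length-exponents zero    ps = ≡.refl
length-exponents (suc k) ps = ≡.cong suc (length-exponents k (drop 1 ps))

exponents-tabulate : ∀ k ps → exponents k ps ≡ List.tabulate {n = k} (λ j → part ps (toℕ j) ℕ.+ (k ∸ suc (toℕ j)))
exponents-tabulate zero    ps = ≡.refl
exponents-tabulate (suc k) ps = ≡.cong (part ps 0 ℕ.+ k ∷_) (≡.trans (exponents-tabulate k (drop 1 ps))
  (Listₚ.tabulate-cong (λ j → ≡.cong (ℕ._+ (k ∸ suc (toℕ j))) (part-drop ps (toℕ j)))))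

exponents-[] : ∀ k → exponents k [] ≡ downFrom k
exponents-[] zero    = ≡.refl
exponents-[] (suc k) = ≡.cong (k ∷_) (exponents-[] k)

-- The parts from position k on vanish, so the last s exponents are the same for all such
-- partitions.
exponents-+ : ∀ s k ps → length ps ℕ.≤ k → exponents (s ℕ.+ k) ps ≡ map (s ℕ.+_) (exponents k ps) ++ downFrom s
exponents-+ s zero    []       _  = ≡.trans (≡.cong (λ k → exponents k []) (ℕₚ.+-identityʳ s)) (exponents-[] s)
exponents-+ s (suc k) ps       le rewrite ℕₚ.+-suc s k = ≡.cong₂ _∷_
  (x∙yz≈y∙xz (part ps 0) s k)
  (exponents-+ s k (drop 1 ps) (≡.subst (ℕ._≤ k) (≡.sym (Listₚ.length-drop 1 ps)) (ℕₚ.∸-monoˡ-≤ 1 le)))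
  where open import Algebra.Properties.CommutativeSemigroup ℕₚ.+-commutativeSemigroup

drop-decreasing : ∀ {ps} → Linked ℕ._≥_ ps → Linked ℕ._≥_ (drop 1 ps)
drop-decreasing []       = []
drop-decreasing [-]      = []
drop-decreasing (_ ∷ ds) = ds

part-decreasing : ∀ {ps} → Linked ℕ._≥_ ps → ∀ j → part ps (suc j) ℕ.≤ part ps j
part-decreasing []       j       = z≤n
part-decreasing [-]      j       = z≤n
part-decreasing (≥ ∷ ds) zero    = ≥
part-decreasing (≥ ∷ ds) (suc j) = part-decreasing ds j

≻-exponents : ∀ k {N ps} → Linked ℕ._≥_ ps → part ps 0 ℕ.+ k ℕ.≤ N → N ≻ exponents k ps
≻-exponents zero    ds ≤N = []
≻-exponents (suc k) {N} {ps} ds ≤N = ≡.subst (ℕ._≤ N) (ℕₚ.+-suc (part ps 0) k) ≤N ∷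
  ≻-exponents k (drop-decreasing ds) (ℕₚ.+-monoˡ-≤ k
    (≡.subst (ℕ._≤ part ps 0) (≡.sym (part-drop ps 0)) (part-decreasing ds 0)))

-- The exponents determine the parts only up to trailing zeros, and positivity excludes these.
exponents-injective : ∀ k {ps qs} → All (0 ℕ.<_) ps → All (0 ℕ.<_) qs → length ps ℕ.≤ k → length qs ℕ.≤ k →
                      exponents k ps ≡ exponents k qs → ps ≡ qs
exponents-injective k       []           []           _  _  _  = ≡.refl
exponents-injective (suc k) []           (0<q ∷ _)    _  _  eq =
  contradiction (ℕₚ.+-cancelʳ-≡ k 0 _ (Listₚ.∷-injectiveˡ eq)) (ℕₚ.<⇒≢ 0<q)
exponents-injective (suc k) (0<p ∷ _)    []           _  _  eq =
  contradiction (≡.sym (ℕₚ.+-cancelʳ-≡ k _ 0 (Listₚ.∷-injectiveˡ eq))) (ℕₚ.<⇒≢ 0<p)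
exponents-injective (suc k) (0<p ∷ 0<ps) (0<q ∷ 0<qs) (s≤s p≤) (s≤s q≤) eq = ≡.cong₂ _∷_
  (ℕₚ.+-cancelʳ-≡ k _ _ (Listₚ.∷-injectiveˡ eq))
  (exponents-injective k 0<ps 0<qs p≤ q≤ (Listₚ.∷-injectiveʳ eq))

partition-≡ : ∀ {μ ν : Partition} → Partition.parts μ ≡ Partition.parts ν → μ ≡ ν
partition-≡ {record { positive = 0< ; decreasing = ≥ }} {record { positive = 0<′ ; decreasing = ≥′ }} ≡.refl =
  ≡.cong₂ (λ p d → record { positive = p ; decreasing = d })
    (All.irrelevant ℕₚ.<-irrelevant 0< 0<′) (Linked.irrelevant ℕₚ.≤-irrelevant ≥ ≥′)

-- The inverse of `exponents`: the staircase is subtracted, and the list stops at the first zero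
-- because a partition stores positive parts only.
gaps : List ℕ → List ℕ
gaps []       = []
gaps (l ∷ ls) with l ∸ length ls
... | zero  = []
... | suc p = suc p ∷ gaps ls

gaps-positive : ∀ ls → All (0 ℕ.<_) (gaps ls)
gaps-positive []       = []
gaps-positive (l ∷ ls) with l ∸ length ls
... | zero  = []
... | suc p = s≤s z≤n ∷ gaps-positive ls

gaps-decreasing : ∀ {N ls} → N ≻ ls → Linked ℕ._≥_ (gaps ls)
gaps-decreasing []      = []
gaps-decreasing (_∷_ {l = l} {ls} l<N d) with l ∸ length ls in eq
... | zero  = []
... | suc p = go d eq
  where
  go : ∀ {l ls} → l ≻ ls → l ∸ length ls ≡ suc p → Linked ℕ._≥_ (suc p ∷ gaps ls)
  go []        eq = [-]
  go {l} (_∷_ {l = k} {ks} k<l d) eq with k ∸ length ks in eq′ | gaps-decreasing (k<l ∷ d)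
  ... | zero  | _  = [-]
  ... | suc q | ds = ≡.subst₂ ℕ._≤_ eq′ eq (ℕₚ.∸-monoˡ-≤ (suc (length ks)) k<l) ∷ ds

length-gaps : ∀ ls → length (gaps ls) ℕ.≤ length ls
length-gaps []       = z≤n
length-gaps (l ∷ ls) with l ∸ length ls
... | zero  = z≤n
... | suc p = s≤s (length-gaps ls)

-- Stopping at a zero gap loses nothing: there l equals the number of later members, which are
-- decreasing and below l and hence must be l - 1 , ... , 0.
exponents-gaps : ∀ {N ls} → N ≻ ls → exponents (length ls) (gaps ls) ≡ ls
exponents-gaps []      = ≡.refl
exponents-gaps (_∷_ {l = l} {ls} l<N d) with l ∸ length ls in eq
... | zero  = ≡.cong₂ _∷_ (≡.sym l≡) (≡.trans (exponents-[] (length ls)) (≡.sym (≻-downFrom (≡.subst (_≻ ls) l≡ d) ≡.refl)))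
  where
  l≡ : l ≡ length ls
  l≡ = ℕₚ.≤-antisym (ℕₚ.m∸n≡0⇒m≤n eq) (≻-length d)
... | suc p = ≡.cong₂ _∷_ (≡.trans (≡.cong (ℕ._+ length ls) (≡.sym eq)) (ℕₚ.m∸n+n≡m (≻-length d))) (exponents-gaps d)

module _ (k N : ℕ) where
  private
    fromExponents : ∀ {ls} → N ≻ ls × length ls ≡ k → Partition
    fromExponents {ls} (d , _) = record { parts = gaps ls ; positive = gaps-positive ls ; decreasing = gaps-decreasing d }

  -- The partitions with at most k parts and λ₁ + k ≤ N, in the order of the sequences, so that a
  -- sum over them is the Cauchy-Binet sum term by term.
  boxedPartitions : List Partition
  boxedPartitions = All.reduce fromExponents (all-decreasingSequences k N)

  exponents-boxedPartitions : map (exponents k ∘ Partition.parts) boxedPartitions ≡ decreasingSequences k N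
  exponents-boxedPartitions = go (all-decreasingSequences k N)
    where
    go : ∀ {xs} (ps : All (λ ls → N ≻ ls × length ls ≡ k) xs) → map (exponents k ∘ Partition.parts) (All.reduce fromExponents ps) ≡ xs
    go []                  = ≡.refl
    go ((d , ≡.refl) ∷ ps) = ≡.cong₂ _∷_ (exponents-gaps d) (go ps)

  length-boxedPartitions : All (λ μ → len μ ℕ.≤ k) boxedPartitions
  length-boxedPartitions = go (all-decreasingSequences k N)
    where
    go : ∀ {xs} (ps : All (λ ls → N ≻ ls × length ls ≡ k) xs) → All (λ μ → len μ ℕ.≤ k) (All.reduce fromExponents ps)
    go []                            = []
    go (_∷_ {ls} (d , ≡.refl) ps) = length-gaps ls ∷ go ps

  unique-boxedPartitions : Unique boxedPartitions
  unique-boxedPartitions = Uniqueₚ.map⁻ (≡.subst Unique (≡.sym exponents-boxedPartitions) (unique-decreasingSequences k N))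

  ∉-boxedPartitions : ∀ μ → μ ∉ boxedPartitions → len μ ℕ.≤ k → N ℕ.< row μ 0 ℕ.+ k
  ∉-boxedPartitions μ μ∉ len≤ = ℕₚ.≰⇒> λ ≤N → μ∉ (member (∈-map⁻ (exponents k ∘ Partition.parts)
    (≡.subst (exponents k (Partition.parts μ) ∈_) (≡.sym exponents-boxedPartitions)
      (≡.subst (λ j → exponents k (Partition.parts μ) ∈ decreasingSequences j N) (length-exponents k (Partition.parts μ))
        (∈-decreasingSequences (≻-exponents k (Partition.decreasing μ) ≤N))))))
    where
    member : Σ[ ν ∈ Partition ] ν ∈ boxedPartitions × exponents k (Partition.parts μ) ≡ exponents k (Partition.parts ν) → μ ∈ boxedPartitions
    member (ν , ν∈ , eq) = ≡.subst (_∈ boxedPartitions) (≡.sym (partition-≡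
      (exponents-injective k (Partition.positive μ) (Partition.positive ν) len≤ (All.lookup length-boxedPartitions ν∈) eq))) ν∈

-- The main diagonal of a partition

module _ {p} {P : Pred ℕ p} (P? : Decidable P) where

  -- The indices with a property closed downwards form an initial segment, so comparison with their
  -- number decides the property. The enumeration `f` is arbitrary because the induction shifts it.
  count-down-closed⁻ : ∀ {f : ℕ → ℕ} N → (∀ {i} → P (f (suc i)) → P (f i)) → ∀ j → j ℕ.< length (filter P? (applyUpTo f N)) → P (f j)
  count-down-closed⁻ {f} (suc N) fdown j j< with P? (f 0)
  count-down-closed⁻ {f} (suc N) fdown zero    j<       | yes P0 = P0
  count-down-closed⁻ {f} (suc N) fdown (suc j) (s≤s j<) | yes P0 = count-down-closed⁻ N fdown j j<
  count-down-closed⁻ {f} (suc N) fdown j       j<       | no ¬P0 = contradiction (first (count-down-closed⁻ N fdown j j<)) ¬P0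
    where
    first : ∀ {i} → P (f (suc i)) → P (f 0)
    first {zero}  = fdown
    first {suc i} = first ∘ fdown

  count-down-closed⁺ : ∀ {f : ℕ → ℕ} N → (∀ {i} → P (f (suc i)) → P (f i)) → ∀ j → j ℕ.< N → P (f j) → j ℕ.< length (filter P? (applyUpTo f N))
  count-down-closed⁺ {f} (suc N) fdown j       j<       Pj with P? (f 0)
  count-down-closed⁺ {f} (suc N) fdown zero    j<       Pj | yes P0 = s≤s z≤n
  count-down-closed⁺ {f} (suc N) fdown (suc j) (s≤s j<) Pj | yes P0 = s≤s (count-down-closed⁺ N fdown j j< Pj)
  count-down-closed⁺ {f} (suc N) fdown j       j<       Pj | no ¬P0 = contradiction (first Pj) ¬P0
    where
    first : ∀ {i} → P (f i) → P (f 0)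
    first {zero}  = λ P0 → P0
    first {suc i} = first ∘ fdown

module _ (μ : Partition) where
  private
    down : ∀ {j} → suc (suc j) ℕ.≤ row μ (suc j) → suc j ℕ.≤ row μ j
    down {j} le = ℕₚ.≤-trans (ℕₚ.n≤1+n _) (ℕₚ.≤-trans le (part-decreasing (Partition.decreasing μ) j))

  -- `dualEntry` compares j with the diagonal length, whereas the truncated differences in
  -- `dualFactor` compare j with its row; this and `diagonal⁺` reconcile the two.
  diagonal⁻ : ∀ j → suc j ℕ.≤ diagonal μ → suc j ℕ.≤ row μ j
  diagonal⁻ = count-down-closed⁻ (λ j → suc j ℕₚ.≤? row μ j) (len μ) down

  diagonal⁺ : ∀ j → suc j ℕ.≤ row μ j → suc j ℕ.≤ diagonal μ
  diagonal⁺ j le = count-down-closed⁺ (λ j → suc j ℕₚ.≤? row μ j) (len μ) down j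
    (ℕₚ.≰⇒> λ len≤j → ℕₚ.<⇒≢ (ℕₚ.<-≤-trans (s≤s z≤n) le) (≡.sym (part-≥-length (Partition.parts μ) j len≤j))) le

-- From families indexed by `Fin` to lists

module FiniteFamilies (R : CommutativeRing c ℓ) where
  open CommutativeRing R hiding (zero)
  open Algebra.Definitions.RawSemiring (Semiring.rawSemiring semiring) using (_^_; sum; product)
  open Algebra.Properties.Semiring.Sum semiring using (sum-cong-≋; *-distribˡ-sum)
  open IntegerSolver R
  open ListDeterminants R
  open CauchyDeterminant R
  open FactorialPowers R
  open Determinants R
  open Relation.Binary.Reasoning.Setoid setoid

  product-Πᴸ : ∀ {n} (g : Fin n → A) f → product (f ∘ g) ≡ Πᴸ (tabulate g) f
  product-Πᴸ {n = zero}  g f = ≡.refl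
  product-Πᴸ {n = suc n} g f = ≡.cong (f (g Fin.zero) *_) (product-Πᴸ (g ∘ Fin.suc) f)

  product-Π< : ∀ n f → product {n} (f ∘ toℕ) ≈ Π< n f
  product-Π< zero    f = refl
  product-Π< (suc n) f = trans (*-congˡ (product-Π< n (f ∘ suc))) (sym (Π<-head n f))

  altsum-tabulate : ∀ {n} (g : Fin (suc n) → A) f →
    altsum f (tabulate g) ≈ sum (λ j → (- 1#) ^ toℕ j * f (g j) (tabulate (g ∘ punchIn j)))
  altsum-tabulate {n = zero}  g f = solve 1 (λ p → p :- 𝟘 := 𝟙 :* p :+ 𝟘) refl _
  altsum-tabulate {n = suc n} g f = +-cong (sym (*-identityˡ _)) (begin
    - altsum (λ y ys → f y (g Fin.zero ∷ ys)) (tabulate (g ∘ Fin.suc))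
      ≈⟨ -‿cong (altsum-tabulate (g ∘ Fin.suc) (λ y ys → f y (g Fin.zero ∷ ys))) ⟩
    - sum (λ j → (- 1#) ^ toℕ j * t j)           ≈⟨ solve 1 (λ p → :- p := :- 𝟙 :* p) refl _ ⟩
    - 1# * sum (λ j → (- 1#) ^ toℕ j * t j)      ≈⟨ *-distribˡ-sum (- 1#) (λ j → (- 1#) ^ toℕ j * t j) ⟩
    sum (λ j → - 1# * ((- 1#) ^ toℕ j * t j))
      ≈⟨ sum-cong-≋ {suc n} {λ j → - 1# * ((- 1#) ^ toℕ j * t j)} {λ j → (- 1#) ^ suc (toℕ j) * t j}
           (λ j → sym (*-assoc (- 1#) ((- 1#) ^ toℕ j) (t j))) ⟩
    sum (λ j → (- 1#) ^ suc (toℕ j) * t j) ∎)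
    where
    t : Fin (suc n) → Carrier
    t j = f (g (Fin.suc j)) (g Fin.zero ∷ tabulate (g ∘ Fin.suc ∘ punchIn j))

  det-detᴸ : ∀ {n} (v : Fin n → A → Carrier) (g : Fin n → A) → det (λ i j → v i (g j)) ≈ detᴸ (tabulate v) (tabulate g)
  det-detᴸ {n = zero}  v g = refl
  det-detᴸ {n = suc n} v g = trans
    (sum-cong-≋ {suc n} {λ j → (- 1#) ^ toℕ j * v Fin.zero (g j) * det (λ r s → v (Fin.suc r) (g (punchIn j s)))}
      {λ j → (- 1#) ^ toℕ j * (v Fin.zero (g j) * detᴸ (tabulate (v ∘ Fin.suc)) (tabulate (g ∘ punchIn j)))}
      (λ j → trans (*-congˡ (det-detᴸ (v ∘ Fin.suc) (g ∘ punchIn j))) (*-assoc ((- 1#) ^ toℕ j) (v Fin.zero (g j)) _)))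
    (sym (altsum-tabulate g (λ x xs → v Fin.zero x * detᴸ (tabulate (v ∘ Fin.suc)) xs)))

  det-cong : ∀ {n} {M N : Fin n → Fin n → Carrier} → (∀ i j → M i j ≈ N i j) → det M ≈ det N
  det-cong {zero}          eq = refl
  det-cong {suc n} {M} {N} eq = sum-cong-≋ {suc n} {term M} {term N} (λ j →
    *-cong (*-congˡ {(- 1#) ^ toℕ j} (eq Fin.zero j)) (det-cong (λ r s → eq (Fin.suc r) (punchIn j s))))
    where
    term : (Fin (suc n) → Fin (suc n) → Carrier) → Fin (suc n) → Carrier
    term M j = (- 1#) ^ toℕ j * M Fin.zero j * det (λ r s → M (Fin.suc r) (punchIn j s))

  det-zero-column : ∀ {n} (M : Fin (suc n) → Fin (suc n) → Carrier) → (∀ i → M i Fin.zero ≈ 0#) → det M ≈ 0#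
  det-zero-column {n} M z = begin
    det M                                          ≈⟨ det-detᴸ M id ⟩
    detᴸ (tabulate M) (allFin (suc n))             ≡⟨ ≡.cong (λ vs → detᴸ vs (allFin (suc n))) (Listₚ.map-tabulate id M) ⟨
    detᴸ (map M (allFin (suc n))) (allFin (suc n)) ≈⟨ column-expansion (map M (allFin (suc n))) Fin.zero (tabulate Fin.suc) ⟩
    altsum minor (map M (allFin (suc n)))          ≈⟨ altsum-map M minor (allFin (suc n)) ⟩
    altsum (λ i is → minor (M i) (map M is)) (allFin (suc n))
      ≈⟨ altsum-cong {f = λ i is → minor (M i) (map M is)} {g = λ _ _ → 0#}
           (λ i is → trans (*-congʳ (z i)) (zeroˡ (detᴸ (map M is) (tabulate Fin.suc)))) (allFin (suc n)) ⟩
    altsum (λ _ _ → 0#) (allFin (suc n))           ≈⟨ altsum-0 (allFin (suc n)) ⟩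
    0#                                             ∎
    where
    minor : (Fin (suc n) → Carrier) → List (Fin (suc n) → Carrier) → Carrier
    minor v us = v Fin.zero * detᴸ us (tabulate Fin.suc)

  module _ {I : Set ℓ₁} {p} {P : Pred I p} (P? : Decidable P) (f : I → Carrier) where
    Πᴸ-filter : ∀ xs → Πᴸ (filter P? xs) f ≈ Πᴸ xs (λ x → if does (P? x) then f x else 1#)
    Πᴸ-filter []       = refl
    Πᴸ-filter (x ∷ xs) with P? x
    ... | yes _ = *-congˡ (Πᴸ-filter xs)
    ... | no  _ = trans (Πᴸ-filter xs) (sym (*-identityˡ _))

  Πᴸ-cartesianProduct : ∀ (xs : List A) (ys : List B) f →
    Πᴸ (cartesianProduct xs ys) f ≈ Πᴸ xs (λ x → Πᴸ ys (λ y → f (x , y)))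
  Πᴸ-cartesianProduct []       ys f = refl
  Πᴸ-cartesianProduct (x ∷ xs) ys f = trans (Πᴸ-++ (map (x ,_) ys) _ f)
    (*-cong (reflexive (Πᴸ-map (x ,_) ys f)) (Πᴸ-cartesianProduct xs ys f))

  Πᴸ-increasingPairs : ∀ {n} (z : Fin n → Carrier) → Πᴸ (increasingPairs n) (λ (i , j) → z i - z j) ≈ vandermonde z (allFin n)
  Πᴸ-increasingPairs {n} z = begin
    Πᴸ (increasingPairs n) (λ (i , j) → z i - z j)
      ≈⟨ Πᴸ-filter (λ (i , j) → i Finₚ.<? j) (λ (i , j) → z i - z j) (cartesianProduct (allFin n) (allFin n)) ⟩
    Πᴸ (cartesianProduct (allFin n) (allFin n)) (λ (i , j) → factor z i j)
      ≈⟨ Πᴸ-cartesianProduct (allFin n) (allFin n) _ ⟩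
    Πᴸ (allFin n) (λ i → Πᴸ (allFin n) (factor z i))
      ≡⟨ reindex ⟨
    product (λ i → product (factor z i))
      ≈⟨ go id z ⟩
    vandermonde z (allFin n) ∎
    where
    factor : ∀ {n} → (Fin n → Carrier) → Fin n → Fin n → Carrier
    factor z i j = if does (i Finₚ.<? j) then z i - z j else 1#

    reindex : product (λ i → product (factor z i)) ≡ Πᴸ (allFin n) (λ i → Πᴸ (allFin n) (factor z i))
    reindex = ≡.trans (product-Πᴸ id (λ i → product (factor z i))) (rows (allFin n))
      where
      rows : ∀ is → Πᴸ is (λ i → product (factor z i)) ≡ Πᴸ is (λ i → Πᴸ (allFin n) (factor z i))
      rows []       = ≡.refl
      rows (i ∷ is) = ≡.cong₂ _*_ (product-Πᴸ id (factor z i)) (rows is)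

    product-cong : ∀ {k} {f g : Fin k → Carrier} → (∀ i → f i ≈ g i) → product f ≈ product g
    product-cong {zero}  eq = refl
    product-cong {suc k} eq = *-cong (eq Fin.zero) (product-cong (eq ∘ Fin.suc))

    -- The test `i <? j` computes on `zero` and `suc`: the first row is a `1#` followed by all its
    -- differences, and every later row begins with a `1#`.
    go : ∀ {k} (g : Fin k → A) (w : A → Carrier) → product (λ i → product (factor (w ∘ g) i)) ≈ vandermonde w (tabulate g)
    go {k = zero}  g w = refl
    go {k = suc k} g w = *-cong
      (trans (*-identityˡ _) (reflexive (product-Πᴸ (g ∘ Fin.suc) (λ j → w (g Fin.zero) - w j))))
      (trans (product-cong {k} (λ i → *-identityˡ (product (factor (w ∘ g ∘ Fin.suc) i)))) (go (g ∘ Fin.suc) w))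

-- Ring homomorphisms and the constructions above

module Homomorphisms (R : CommutativeRing c ℓ) (S : CommutativeRing c′ ℓ′) where
  private
    module R = CommutativeRing R
    module S = CommutativeRing S
    module Rᵣ = Algebra.Definitions.RawSemiring (Semiring.rawSemiring R.semiring)
    module Sᵣ = Algebra.Definitions.RawSemiring (Semiring.rawSemiring S.semiring)
  open RingMorphisms R.rawRing S.rawRing public using (IsRingHomomorphism)

  module Preserves {φ : R.Carrier → S.Carrier} (isHom : IsRingHomomorphism φ) where
    open IsRingHomomorphism isHom public using (⟦⟧-cong; +-homo; *-homo; -‿homo; 0#-homo; 1#-homo)
    open S using (_≈_; trans; sym; refl)

    sub-homo : ∀ x y → φ (x R.- y) ≈ φ x S.- φ y
    sub-homo x y = trans (+-homo x (R.- y)) (S.+-congˡ (-‿homo y))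

    ^-homo : ∀ x n → φ (x Rᵣ.^ n) ≈ φ x Sᵣ.^ n
    ^-homo x zero    = 1#-homo
    ^-homo x (suc n) = trans (*-homo x _) (S.*-congˡ (^-homo x n))

    sum-homo : ∀ n (f : Fin n → R.Carrier) → φ (Rᵣ.sum f) ≈ Sᵣ.sum (φ ∘ f)
    sum-homo zero    f = 0#-homo
    sum-homo (suc n) f = trans (+-homo (f Fin.zero) _) (S.+-congˡ (sum-homo n (f ∘ Fin.suc)))

    Πᴸ-homo : ∀ (xs : List A) f → φ (ListDeterminants.Πᴸ R xs f) ≈ ListDeterminants.Πᴸ S xs (φ ∘ f)
    Πᴸ-homo []       f = 1#-homo
    Πᴸ-homo (x ∷ xs) f = trans (*-homo (f x) _) (S.*-congˡ (Πᴸ-homo xs f))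

    Π<-homo : ∀ n f → φ (FactorialPowers.Π< R n f) ≈ FactorialPowers.Π< S n (φ ∘ f)
    Π<-homo zero    f = 1#-homo
    Π<-homo (suc n) f = trans (*-homo _ (f n)) (S.*-congʳ (Π<-homo n f))

    det-homo : ∀ n (M : Fin n → Fin n → R.Carrier) → φ (Determinants.det R M) ≈ Determinants.det S (λ i j → φ (M i j))
    det-homo zero    M = 1#-homo
    det-homo (suc n) M = trans (sum-homo (suc n) t) (sum-cong-≋ {suc n} {φ ∘ t} {t′} λ j →
      trans (*-homo _ _) (S.*-cong
        (trans (*-homo _ _) (S.*-congʳ (trans (^-homo (R.- R.1#) (toℕ j))
          (^-congˡ (toℕ j) (trans (-‿homo R.1#) (S.-‿cong 1#-homo))))))
        (det-homo n (λ r s → M (Fin.suc r) (punchIn j s)))))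
      where
      open Algebra.Properties.Semiring.Sum S.semiring using (sum-cong-≋)
      open Algebra.Properties.Semiring.Exp S.semiring using (^-congˡ)
      t : Fin (suc n) → R.Carrier
      t j = (R.- R.1#) Rᵣ.^ toℕ j R.* M Fin.zero j R.* Determinants.det R (λ r s → M (Fin.suc r) (punchIn j s))
      t′ : Fin (suc n) → S.Carrier
      t′ j = (S.- S.1#) Sᵣ.^ toℕ j S.* φ (M Fin.zero j) S.* Determinants.det S (λ r s → φ (M (Fin.suc r) (punchIn j s)))

    factor-homo : ∀ u t → φ (R.1# R.- u R.* t) ≈ S.1# S.- φ u S.* φ t
    factor-homo u t = trans (sub-homo R.1# _) (S.+-cong 1#-homo (S.-‿cong (*-homo u t)))

    factorial-homo : ∀ b x r → φ (FactorialPowers.factorial R b x r) ≈ FactorialPowers.factorial S (φ ∘ b) (φ x) r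
    factorial-homo b x r = trans (Π<-homo r _) (FactorialPowers.Π<-cong S r (λ k → sub-homo x (b k)))

    dualPower-homo : ∀ a n t g l → φ (FactorialPowers.dualPower R a n t g l) ≈
                                    FactorialPowers.dualPower S (φ ∘ a) n (φ t) (φ ∘ g) l
    dualPower-homo a n t g l = trans (*-homo _ _) (S.*-cong (^-homo t l)
      (trans (*-homo _ _) (S.*-cong (Π<-homo (suc l ∸ n) _)
        (trans (Π<-homo (n ∸ suc l) _) (FactorialPowers.Π<-cong S (n ∸ suc l) (λ k → factor-homo (a (ℤ.+ suc k)) t))))))

-- Power series modulo terms of large degree

module TruncatedSeries (K : CommutativeRing c ℓ) where
  private module K = CommutativeRing K
  open K using (Carrier; _≈_; 0#; 1#)
  open Series K
  open Algebra.Properties.Semiring.Sum K.semiring using (sum-cong-≋; ∑-distrib-+; sum-replicate-zero)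
  open ListDeterminants K using (Σᴸ)

  constant-homomorphism : ∀ n → Homomorphisms.IsRingHomomorphism K (commutativeRing n) constant
  constant-homomorphism n = record
    { isSemiringHomomorphism = record
      { isNearSemiringHomomorphism = record
        { +-isMonoidHomomorphism = record
          { isMagmaHomomorphism = record
            { isRelHomomorphism = record { cong = λ eq α → constant-cong eq α }
            ; homo = λ u v α → constant-+ u v α }
          ; ε-homo = constant-0 }
        ; *-homo = λ u v α → K.sym (K.trans (*ₛ-constantˡ u (constant v) α) (constant-* u v α)) }
      ; 1#-homo = λ α → K.refl }
    ; -‿homo = λ u α → constant-neg u α }
    where
    open Algebra.Properties.Ring K.ring using (-0#≈0#)
    constant-cong : ∀ {u v} → u ≈ v → constant {n} u ≈ₛ constant v
    constant-cong eq α with α ≟ᵉ 𝟎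
    ... | yes _ = eq
    ... | no  _ = K.refl
    constant-+ : ∀ u v → constant {n} (u K.+ v) ≈ₛ constant u +ₛ constant v
    constant-+ u v α with α ≟ᵉ 𝟎
    ... | yes _ = K.refl
    ... | no  _ = K.sym (K.+-identityˡ 0#)
    constant-0 : constant {n} 0# ≈ₛ (λ _ → 0#)
    constant-0 α with α ≟ᵉ 𝟎
    ... | yes _ = K.refl
    ... | no  _ = K.refl
    constant-* : ∀ u v (α : Exponent n) → u K.* constant v α ≈ constant (u K.* v) α
    constant-* u v α with α ≟ᵉ 𝟎
    ... | yes _ = K.refl
    ... | no  _ = K.zeroʳ u
    constant-neg : ∀ u → constant {n} (K.- u) ≈ₛ -ₛ constant u
    constant-neg u α with α ≟ᵉ 𝟎
    ... | yes _ = K.refl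
    ... | no  _ = K.sym -0#≈0#

  infix 4 _≈[_]_
  _≈[_]_ : ∀ {n} → Series n → ℕ → Series n → Set _
  f ≈[ D ] g = ∀ α → degree α ℕ.≤ D → f α ≈ g α

  -- The difference of the products is (f - f′) g + f′ (g - g′). Degrees add, so a coefficient of
  -- degree at most D involves only coefficients of degree at most D of the differences, and these
  -- vanish.
  *ₛ-cong-≤ : ∀ {n D} {f f′ g g′ : Series n} → f ≈[ D ] f′ → g ≈[ D ] g′ → f *ₛ g ≈[ D ] f′ *ₛ g′
  *ₛ-cong-≤ {n} {D} {f} {f′} {g} {g′} f≈f′ g≈g′ γ γ≤D = begin
    (f *ₛ g) γ
      ≈⟨ S.solve 4 (λ f f′ g g′ → f S.:* g S.:= (f S.:- f′) S.:* g S.:+ f′ S.:* (g S.:- g′) S.:+ f′ S.:* g′) (λ _ → K.refl) f f′ g g′ γ ⟩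
    ((f +ₛ -ₛ f′) *ₛ g) γ K.+ (f′ *ₛ (g +ₛ -ₛ g′)) γ K.+ (f′ *ₛ g′) γ
      ≈⟨ K.+-congʳ (K.+-cong
           (*ₛ-vanish (f +ₛ -ₛ f′) g γ (λ α β eq → K.trans (K.*-congʳ (difference f f′ f≈f′ α (left α β eq))) (K.zeroˡ _)))
           (*ₛ-vanish f′ (g +ₛ -ₛ g′) γ (λ α β eq → K.trans (K.*-congˡ (difference g g′ g≈g′ β (right α β eq))) (K.zeroʳ _)))) ⟩
    0# K.+ 0# K.+ (f′ *ₛ g′) γ
      ≈⟨ K.trans (K.+-congʳ (K.+-identityˡ 0#)) (K.+-identityˡ _) ⟩
    (f′ *ₛ g′) γ ∎
    where
    module S = IntegerSolver (commutativeRing n)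
    open Relation.Binary.Reasoning.Setoid K.setoid
    difference : ∀ h h′ → h ≈[ D ] h′ → ∀ α → degree α ℕ.≤ D → (h +ₛ -ₛ h′) α ≈ 0#
    difference h h′ eq α α≤D = K.trans (K.+-congʳ (eq α α≤D)) (K.-‿inverseʳ _)
    degree-≤ : ∀ α β → zipWith ℕ._+_ α β ≡ γ → degree α ℕ.+ degree β ℕ.≤ D
    degree-≤ α β eq = ≡.subst (ℕ._≤ D) (≡.trans (≡.cong degree (≡.sym eq)) (degree-zipWith-+ α β)) γ≤D
    left : ∀ α β → zipWith ℕ._+_ α β ≡ γ → degree α ℕ.≤ D
    left α β eq = ℕₚ.m+n≤o⇒m≤o (degree α) (degree-≤ α β eq)
    right : ∀ α β → zipWith ℕ._+_ α β ≡ γ → degree β ℕ.≤ D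
    right α β eq = ℕₚ.m+n≤o⇒n≤o (degree α) (degree-≤ α β eq)

  -- K[[z]] modulo the terms of total degree > D, without changing the carrier.
  truncatedRing : ℕ → ℕ → CommutativeRing _ _
  truncatedRing n D = record
    { Carrier = Series n ; _≈_ = _≈[ D ]_ ; _+_ = _+ₛ_ ; _*_ = _*ₛ_ ; -_ = -ₛ_
    ; 0# = λ _ → 0# ; 1# = constant 1#
    ; isCommutativeRing = record
      { isRing = record
        { +-isAbelianGroup = record
          { isGroup = record
            { isMonoid = record
              { isSemigroup = record
                { isMagma = record
                  { isEquivalence = record
                    { refl = λ _ _ → K.refl ; sym = λ p α d → K.sym (p α d) ; trans = λ p q α d → K.trans (p α d) (q α d) }
                  ; ∙-cong = λ p q α d → K.+-cong (p α d) (q α d) }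
                ; assoc = λ f g h α _ → S.+-assoc f g h α }
              ; identity = (λ f α _ → S.+-identityˡ f α) , (λ f α _ → S.+-identityʳ f α) }
            ; inverse = (λ f α _ → S.-‿inverseˡ f α) , (λ f α _ → S.-‿inverseʳ f α)
            ; ⁻¹-cong = λ p α d → K.-‿cong (p α d) }
          ; comm = λ f g α _ → S.+-comm f g α }
        ; *-cong = *ₛ-cong-≤
        ; *-assoc = λ f g h α _ → S.*-assoc f g h α
        ; *-identity = (λ f α _ → S.*-identityˡ f α) , (λ f α _ → S.*-identityʳ f α)
        ; distrib = (λ f g h α _ → S.distribˡ f g h α) , (λ f g h α _ → S.distribʳ f g h α) }
      ; *-comm = λ f g α _ → S.*-comm f g α } }
    where module S = CommutativeRing (commutativeRing n)

  truncate-homomorphism : ∀ {c′ ℓ′} {R : CommutativeRing c′ ℓ′} {n} D {φ : CommutativeRing.Carrier R → Series n} →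
    Homomorphisms.IsRingHomomorphism R (commutativeRing n) φ → Homomorphisms.IsRingHomomorphism R (truncatedRing n D) φ
  truncate-homomorphism {R = R} {n} D isHom = record
    { isSemiringHomomorphism = record
      { isNearSemiringHomomorphism = record
        { +-isMonoidHomomorphism = record
          { isMagmaHomomorphism = record
            { isRelHomomorphism = record { cong = λ eq α _ → ⟦⟧-cong eq α }
            ; homo = λ u v α _ → +-homo u v α }
          ; ε-homo = λ α _ → 0#-homo α }
        ; *-homo = λ u v α _ → *-homo u v α }
      ; 1#-homo = λ α _ → 1#-homo α }
    ; -‿homo = λ u α _ → -‿homo u α }
    where open Homomorphisms.Preserves R (commutativeRing n) isHom

  module _ {n : ℕ} where
    open Algebra.Definitions.RawSemiring (Semiring.rawSemiring (CommutativeRing.semiring (commutativeRing n))) using (_^_)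

    indeterminate-^ : ∀ (j : Fin n) k α → degree α ℕ.< k → (indeterminate j ^ k) α ≈ 0#
    indeterminate-^ j (suc k) α α<k = *ₛ-vanish (indeterminate j) (indeterminate j ^ k) α zeros
      where
      zeros : ∀ β γ → zipWith ℕ._+_ β γ ≡ α → indeterminate j β K.* (indeterminate j ^ k) γ ≈ 0#
      zeros β γ eq with β ≟ᵉ 1 ·e j
      ... | no  _      = K.zeroˡ _
      ... | yes ≡.refl = K.trans (K.*-congˡ (indeterminate-^ j k γ (ℕ.s≤s⁻¹ (≡.subst (ℕ._< suc k) degree-α α<k)))) (K.zeroʳ _)
        where
        degree-α : degree α ≡ suc (degree γ)
        degree-α = ≡.trans (≡.cong degree (≡.sym eq)) (≡.trans (degree-zipWith-+ (1 ·e j) γ) (≡.cong (ℕ._+ degree γ) (degree-·e 1 j)))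

    divDiffs : List (Fin n × Fin n) → Series n → Series n
    divDiffs ps f = foldl (λ q (i , j) → divDiff i j q) f ps

    -- A coefficient of the quotient is a sum of coefficients of the dividend whose degree is larger
    -- by exactly one, so each division uses up one degree of precision.
    divDiff-≤ : ∀ i j {f g} D → f ≈[ suc D ] g → divDiff {n} i j f ≈[ D ] divDiff i j g
    divDiff-≤ i j {f} {g} D eq α α≤D = sum-cong-≋ {suc (lookup α j)} {f ∘ δ} {g ∘ δ} λ k → eq (δ k)
      (≡.subst (ℕ._≤ suc D) (≡.sym (degree-move α i j (toℕ k) (Finₚ.toℕ≤pred[n] k))) (s≤s α≤D))
      where
      δ : Fin (suc (lookup α j)) → Exponent n
      δ k = move α j (toℕ k) i (suc (toℕ k))

    divDiffs-≤ : ∀ ps {f g} D → f ≈[ length ps ℕ.+ D ] g → divDiffs ps f ≈[ D ] divDiffs ps g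
    divDiffs-≤ []             D eq = eq
    divDiffs-≤ ((i , j) ∷ ps) D eq = divDiffs-≤ ps D (divDiff-≤ i j (length ps ℕ.+ D) eq)

    divDiffs-cong : ∀ ps {f g} → f ≈ₛ g → divDiffs ps f ≈ₛ divDiffs ps g
    divDiffs-cong ps eq α = divDiffs-≤ ps (degree α) (λ β _ → eq β) α ℕₚ.≤-refl

    divDiffs-+ : ∀ ps f g → divDiffs ps (f +ₛ g) ≈ₛ divDiffs ps f +ₛ divDiffs ps g
    divDiffs-+ []             f g α = K.refl
    divDiffs-+ ((i , j) ∷ ps) f g α = K.trans
      (divDiffs-cong ps (λ β → ∑-distrib-+ {suc (lookup β j)} (λ k → f (move β j (toℕ k) i (suc (toℕ k)))) (λ k → g (move β j (toℕ k) i (suc (toℕ k))))) α)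
      (divDiffs-+ ps (divDiff i j f) (divDiff i j g) α)

    divDiffs-0 : ∀ ps → divDiffs ps (λ _ → 0#) ≈ₛ (λ _ → 0#)
    divDiffs-0 []             α = K.refl
    divDiffs-0 ((i , j) ∷ ps) α = K.trans
      (divDiffs-cong ps (λ β → sum-replicate-zero (suc (lookup β j))) α) (divDiffs-0 ps α)

    divDiffs-Σᴸ : ∀ ps (xs : List A) (F : A → Series n) →
                  divDiffs ps (λ α → Σᴸ xs (λ x → F x α)) ≈ₛ (λ α → Σᴸ xs (λ x → divDiffs ps (F x) α))
    divDiffs-Σᴸ ps []       F α = divDiffs-0 ps α
    divDiffs-Σᴸ ps (x ∷ xs) F α = K.trans (divDiffs-+ ps (F x) _ α) (K.+-congˡ (divDiffs-Σᴸ ps xs F α))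

-- Maps applied to the coefficients of a series

module MapSeries (K : CommutativeRing c ℓ) (L : CommutativeRing c′ ℓ′) where
  private
    module K = CommutativeRing K
    module L = CommutativeRing L
    module Kₛ = Series K
    module Lₛ = Series L
    module KΣ = Algebra.Definitions.RawSemiring (Semiring.rawSemiring K.semiring)
    module LΣ = Algebra.Definitions.RawSemiring (Semiring.rawSemiring L.semiring)
  open Homomorphisms K L using (IsRingHomomorphism; module Preserves)

  module Additive {φ : K.Carrier → L.Carrier} (cong : ∀ {u v} → u K.≈ v → φ u L.≈ φ v)
    (0-homo : φ K.0# L.≈ L.0#) (+-homo : ∀ u v → φ (u K.+ v) L.≈ φ u L.+ φ v) where

    sum-additive : ∀ n (f : Fin n → K.Carrier) → φ (KΣ.sum f) L.≈ LΣ.sum (φ ∘ f)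
    sum-additive zero    f = 0-homo
    sum-additive (suc n) f = L.trans (+-homo (f Fin.zero) _) (L.+-congˡ (sum-additive n (f ∘ Fin.suc)))

    -- Divided differences are made of sums only. Hence additivity is enough, and the map may be
    -- multiplication by a fixed element, which is not a ring homomorphism.
    divDiffs-map : ∀ {n} ps (f : Kₛ.Series n) α → φ (TruncatedSeries.divDiffs K ps f α) L.≈ TruncatedSeries.divDiffs L ps (φ ∘ f) α
    divDiffs-map []             f α = L.refl
    divDiffs-map ((i , j) ∷ ps) f α = L.trans (divDiffs-map ps (Kₛ.divDiff i j f) α)
      (TruncatedSeries.divDiffs-cong L ps (λ β → sum-additive (suc (lookup β j)) (λ k → f (move β j (toℕ k) i (suc (toℕ k))))) α)

  module _ {φ : K.Carrier → L.Carrier} (isHom : IsRingHomomorphism φ) where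
    open Preserves isHom

    monomial-map : ∀ {n} u (β α : Exponent n) → φ (Kₛ.monomial u β α) L.≈ Lₛ.monomial (φ u) β α
    monomial-map u β α with α ≟ᵉ β
    ... | yes _ = L.refl
    ... | no  _ = 0#-homo

    *ₛ-map : ∀ {n} (f g : Kₛ.Series n) α → φ ((f Kₛ.*ₛ g) α) L.≈ ((φ ∘ f) Lₛ.*ₛ (φ ∘ g)) α
    *ₛ-map f g []      = *-homo (f []) (g [])
    *ₛ-map f g (k ∷ γ) = L.trans (sum-homo (suc k) (λ i → (fᵢ i Kₛ.*ₛ gᵢ i) γ))
      (sum-cong-≋ {suc k} {λ i → φ ((fᵢ i Kₛ.*ₛ gᵢ i) γ)} {λ i → ((φ ∘ fᵢ i) Lₛ.*ₛ (φ ∘ gᵢ i)) γ} λ i → *ₛ-map (fᵢ i) (gᵢ i) γ)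
      where
      open Algebra.Properties.Semiring.Sum L.semiring using (sum-cong-≋)
      fᵢ gᵢ : Fin (suc k) → Kₛ.Series _
      fᵢ i α = f (toℕ i ∷ α)
      gᵢ i α = g (k ∸ toℕ i ∷ α)

    map-homomorphism : ∀ n → Homomorphisms.IsRingHomomorphism (Kₛ.commutativeRing n) (Lₛ.commutativeRing n) (φ ∘_)
    map-homomorphism n = record
      { isSemiringHomomorphism = record
        { isNearSemiringHomomorphism = record
          { +-isMonoidHomomorphism = record
            { isMagmaHomomorphism = record
              { isRelHomomorphism = record { cong = λ eq α → ⟦⟧-cong (eq α) }
              ; homo = λ f g α → +-homo (f α) (g α) }
            ; ε-homo = λ _ → 0#-homo }
          ; *-homo = *ₛ-map }
        ; 1#-homo = λ α → L.trans (monomial-map K.1# 𝟎 α) (Homomorphisms.Preserves.⟦⟧-cong L (Lₛ.commutativeRing n) (TruncatedSeries.constant-homomorphism L n) 1#-homo α) }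
      ; -‿homo = λ f α → -‿homo (f α) }

    indeterminate-map : ∀ {n} (j : Fin n) α → φ (Kₛ.indeterminate j α) L.≈ Lₛ.indeterminate j α
    indeterminate-map j α with α ≟ᵉ 1 ·e j
    ... | yes _ = 1#-homo
    ... | no  _ = 0#-homo

    geometric-map : ∀ {n} u (j : Fin n) α → φ (Kₛ.geometric u j α) L.≈ Lₛ.geometric (φ u) j α
    geometric-map u j α with α ≟ᵉ lookup α j ·e j
    ... | yes _ = ^-homo u (lookup α j)
    ... | no  _ = 0#-homo

if-yes : ∀ (d : Dec A) {u v : B} → A → (if does d then u else v) ≡ u
if-yes (yes _) p = ≡.refl
if-yes (no ¬p) p = contradiction p ¬p

if-no : ∀ (d : Dec A) {u v : B} → ¬ A → (if does d then u else v) ≡ v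
if-no (yes p) ¬p = contradiction p ¬p
if-no (no _)  ¬p = ≡.refl

-- The Cauchy identity for double and dual Schur functions

module CauchyIdentity (K : CommutativeRing c ℓ) (a : ℤ → CommutativeRing.Carrier K) (n m : ℕ) where
  private
    module K = CommutativeRing K
    module Sch = Schur K a
    Kx = Polynomials.commutativeRing K n
    module Kx = CommutativeRing Kx
    Ky = Series.commutativeRing K m
    module Ky = CommutativeRing Ky
    Kxy = Series.commutativeRing Kx m
    module Kxy = CommutativeRing Kxy
  open Polynomials K using (Polynomial; coeff; constantₚ; indeterminateₚ; divDiffₚ)
  open Algebra.Definitions.RawSemiring (Semiring.rawSemiring Kxy.semiring) using () renaming (product to productₓᵧ)

  exponent : ℕ → Partition → ℕ → ℕ
  exponent N μ j = row μ j ℕ.+ (N ∸ suc j)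

  doubleAlternant : Partition → Polynomial n
  doubleAlternant μ = Determinants.det Kx {n} (λ i j → Sch.factorialPower n i (exponent n μ (toℕ j)))

  dualAlternant : Partition → Series.Series K m
  dualAlternant μ = Determinants.det Ky (Sch.dualEntry m μ)

  doubleSchur-≤ : ∀ μ → len μ ℕ.≤ n → Sch.doubleSchur n μ ≡ Sch._/Δˣ n (doubleAlternant μ)
  doubleSchur-≤ μ le = if-yes (len μ ℕₚ.≤? n) le

  doubleSchur-> : ∀ μ → n ℕ.< len μ → Sch.doubleSchur n μ ≡ Kx.0#
  doubleSchur-> μ gt = if-no (len μ ℕₚ.≤? n) (ℕₚ.<⇒≱ gt)

  dualSchur-≤ : ∀ μ → len μ ℕ.≤ m → Sch.dualSchur m μ ≡ Sch._/Δʸ m (dualAlternant μ)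
  dualSchur-≤ μ le = if-yes (len μ ℕₚ.≤? m) le

  dualSchur-> : ∀ μ → m ℕ.< len μ → Sch.dualSchur m μ ≡ Ky.0#
  dualSchur-> μ gt = if-no (len μ ℕₚ.≤? m) (ℕₚ.<⇒≱ gt)

  private
    xpairs = increasingPairs n
    ypairs = increasingPairs m
    module TK = TruncatedSeries K
    module TKx = TruncatedSeries Kx
    module ΣK = ListDeterminants K
    module ΣKx = ListDeterminants Kx

  coeff-Σᴸ : ∀ (xs : List A) (f : A → Polynomial n) β → ΣKx.Σᴸ xs f .coeff β ≡ ΣK.Σᴸ xs (λ x → f x .coeff β)
  coeff-Σᴸ []       f β = ≡.refl
  coeff-Σᴸ (x ∷ xs) f β = ≡.cong (f x .coeff β K.+_) (coeff-Σᴸ xs f β)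

  coeff-/Δˣ : ∀ p → Sch._/Δˣ n p .coeff ≡ TK.divDiffs xpairs (p .coeff)
  coeff-/Δˣ p = go xpairs p
    where
    go : ∀ ps p → foldl (λ q (i , j) → divDiffₚ i j q) p ps .coeff ≡ TK.divDiffs ps (p .coeff)
    go []             p = ≡.refl
    go ((i , j) ∷ ps) p = go ps (divDiffₚ i j p)

  /Δˣ-cong : ∀ {p q} → p Kx.≈ q → Sch._/Δˣ n p Kx.≈ Sch._/Δˣ n q
  /Δˣ-cong {p} {q} eq β = K.trans (K.reflexive (≡.cong (λ f → f β) (coeff-/Δˣ p)))
    (K.trans (TK.divDiffs-cong xpairs eq β) (K.reflexive (≡.cong (λ f → f β) (≡.sym (coeff-/Δˣ q)))))

  /Δˣ-Σᴸ : ∀ (xs : List A) f → ΣKx.Σᴸ xs (λ x → Sch._/Δˣ n (f x)) Kx.≈ Sch._/Δˣ n (ΣKx.Σᴸ xs f)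
  /Δˣ-Σᴸ xs f β = begin
    ΣKx.Σᴸ xs (λ x → Sch._/Δˣ n (f x)) .coeff β
      ≡⟨ coeff-Σᴸ xs (λ x → Sch._/Δˣ n (f x)) β ⟩
    ΣK.Σᴸ xs (λ x → Sch._/Δˣ n (f x) .coeff β)
      ≈⟨ ΣK.Σᴸ-cong xs (λ x → K.reflexive (≡.cong (λ h → h β) (coeff-/Δˣ (f x)))) ⟩
    ΣK.Σᴸ xs (λ x → TK.divDiffs xpairs (f x .coeff) β)
      ≈⟨ TK.divDiffs-Σᴸ xpairs xs (λ x → f x .coeff) β ⟨
    TK.divDiffs xpairs (λ α → ΣK.Σᴸ xs (λ x → f x .coeff α)) β
      ≈⟨ TK.divDiffs-cong xpairs (λ α → K.reflexive (≡.sym (coeff-Σᴸ xs f α))) β ⟩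
    TK.divDiffs xpairs (ΣKx.Σᴸ xs f .coeff) β
      ≡⟨ ≡.cong (λ h → h β) (coeff-/Δˣ (ΣKx.Σᴸ xs f)) ⟨
    Sch._/Δˣ n (ΣKx.Σᴸ xs f) .coeff β ∎
    where open Relation.Binary.Reasoning.Setoid K.setoid

  *-constantₚ : ∀ p u β → (p Kx.* constantₚ u) .coeff β K.≈ p .coeff β K.* u
  *-constantₚ p u β = K.trans (Series.*ₛ-comm K (p .coeff) (Series.constant K u) β)
    (K.trans (Series.*ₛ-constantˡ K u (p .coeff) β) (K.*-comm _ _))

  /Δˣ-*-constantₚ : ∀ p u → Sch._/Δˣ n p Kx.* constantₚ u Kx.≈ Sch._/Δˣ n (p Kx.* constantₚ u)
  /Δˣ-*-constantₚ p u β = begin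
    (Sch._/Δˣ n p Kx.* constantₚ u) .coeff β               ≈⟨ *-constantₚ (Sch._/Δˣ n p) u β ⟩
    Sch._/Δˣ n p .coeff β K.* u                            ≡⟨ ≡.cong (λ h → h β K.* u) (coeff-/Δˣ p) ⟩
    TK.divDiffs xpairs (p .coeff) β K.* u
      ≈⟨ MapSeries.Additive.divDiffs-map K K {φ = K._* u} K.*-congʳ (K.zeroˡ u) (λ v w → K.distribʳ u v w) xpairs (p .coeff) β ⟩
    TK.divDiffs xpairs (λ α → p .coeff α K.* u) β      ≈⟨ TK.divDiffs-cong xpairs (λ α → K.sym (*-constantₚ p u α)) β ⟩
    TK.divDiffs xpairs ((p Kx.* constantₚ u) .coeff) β ≡⟨ ≡.cong (λ h → h β) (coeff-/Δˣ (p Kx.* constantₚ u)) ⟨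
    Sch._/Δˣ n (p Kx.* constantₚ u) .coeff β               ∎
    where open Relation.Binary.Reasoning.Setoid K.setoid

  constantₚ-homomorphism : Homomorphisms.IsRingHomomorphism K Kx constantₚ
  constantₚ-homomorphism = record
    { isSemiringHomomorphism = record
      { isNearSemiringHomomorphism = record
        { +-isMonoidHomomorphism = record
          { isMagmaHomomorphism = record
            { isRelHomomorphism = record { cong = ⟦⟧-cong }
            ; homo = +-homo }
          ; ε-homo = 0#-homo }
        ; *-homo = *-homo }
      ; 1#-homo = 1#-homo }
    ; -‿homo = -‿homo }
    where open Homomorphisms.Preserves K (Series.commutativeRing K n) (TK.constant-homomorphism n)

  ⊛-divDiffs : ∀ p f α → p Kx.* constantₚ (TK.divDiffs ypairs f α) Kx.≈ TKx.divDiffs ypairs (p Sch.⊛ f) α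
  ⊛-divDiffs p f = MapSeries.Additive.divDiffs-map K Kx {φ = λ u → p Kx.* constantₚ u}
    (λ {u} {v} eq → Kx.*-congˡ {p} {constantₚ u} {constantₚ v} (⟦⟧-cong eq))
    (λ β → K.trans (Kx.*-congˡ {p} {constantₚ K.0#} {Kx.0#} 0#-homo β) (Kx.zeroʳ p β))
    (λ u v β → K.trans (Kx.*-congˡ {p} {constantₚ (u K.+ v)} {constantₚ u Kx.+ constantₚ v} (+-homo u v) β)
      (Kx.distribˡ p (constantₚ u) (constantₚ v) β))
    ypairs f
    where open Homomorphisms.Preserves K Kx constantₚ-homomorphism

  -- At most one of the two products in dualFactor is nonempty, and
  -- dualEntry keeps just that one.
  dualEntry-dualPower : ∀ μ i j → Sch.dualEntry m μ i j Ky.≈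
    FactorialPowers.dualPower Ky (Series.constant K ∘ a) m (Series.indeterminate K i) (λ k → Series.geometric K (a k) i) (exponent m μ (toℕ j))
  dualEntry-dualPower μ i j = Ky.*-congˡ {x = Series.indeterminate K i Kyᵣ.^ e} factor
    where
    module Kyᵣ = Algebra.Definitions.RawSemiring (Semiring.rawSemiring Ky.semiring)
    module P = FactorialPowers Ky
    open FiniteFamilies Ky using (product-Π<)
    r = row μ (toℕ j)
    e = exponent m μ (toℕ j)
    G F : ℕ → Series.Series K m
    G k = Series.geometric K (a (ℤ.- ℤ.+ k)) i
    F k = Ky.1# Ky.- Series.constant K (a (ℤ.+ suc k)) Ky.* Series.indeterminate K i

    -- Since j is counted from 0, `suc e` and `m` are r and j plus the common summand m - j, so the
    -- numbers of factors are the truncated differences of r and j.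
    suc-e : suc e ≡ r ℕ.+ (m ∸ toℕ j)
    suc-e = ≡.trans (≡.sym (ℕₚ.+-suc r (m ∸ suc (toℕ j)))) (≡.cong (r ℕ.+_) (≡.sym (ℕₚ.+-∸-assoc 1 (Finₚ.toℕ<n j))))

    m≡ : m ≡ toℕ j ℕ.+ (m ∸ toℕ j)
    m≡ = ≡.sym (ℕₚ.m+[n∸m]≡n (ℕₚ.<⇒≤ (Finₚ.toℕ<n j)))

    cancel : ∀ p q d → (p ℕ.+ d) ∸ (q ℕ.+ d) ≡ p ∸ q
    cancel p q d = ≡.trans (≡.cong₂ _∸_ (ℕₚ.+-comm p d) (ℕₚ.+-comm q d)) (ℕₚ.[m+n]∸[m+o]≡n∸o d p q)

    inverse-factors : suc e ∸ m ≡ r ∸ toℕ j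
    inverse-factors = ≡.trans (≡.cong₂ _∸_ suc-e m≡) (cancel r (toℕ j) (m ∸ toℕ j))

    factors : m ∸ suc e ≡ toℕ j ∸ r
    factors = ≡.trans (≡.cong₂ _∸_ m≡ suc-e) (cancel (toℕ j) r (m ∸ toℕ j))

    cases : Dec (suc (toℕ j) ℕ.≤ diagonal μ) →
      (if does (suc (toℕ j) ℕₚ.≤? diagonal μ) then Kyᵣ.product {r ∸ toℕ j} (G ∘ toℕ) else Kyᵣ.product {toℕ j ∸ r} (F ∘ toℕ)) Ky.≈
      P.Π< (r ∸ toℕ j) G Ky.* P.Π< (toℕ j ∸ r) F
    cases (yes le) = Ky.trans
      (Ky.reflexive (if-yes (suc (toℕ j) ℕₚ.≤? diagonal μ) le))
      (Ky.trans (product-Π< (r ∸ toℕ j) G) (Ky.trans (Ky.sym (Ky.*-identityʳ _))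
        (Ky.reflexive (≡.cong (λ k → P.Π< (r ∸ toℕ j) G Ky.* P.Π< k F) (≡.sym (ℕₚ.m≤n⇒m∸n≡0 (ℕₚ.<⇒≤ (diagonal⁻ μ (toℕ j) le))))))))
    cases (no ≰) = Ky.trans
      (Ky.reflexive (if-no (suc (toℕ j) ℕₚ.≤? diagonal μ) ≰))
      (Ky.trans (product-Π< (toℕ j ∸ r) F) (Ky.trans (Ky.sym (Ky.*-identityˡ _))
        (Ky.reflexive (≡.cong (λ k → P.Π< k G Ky.* P.Π< (toℕ j ∸ r) F) (≡.sym (ℕₚ.m≤n⇒m∸n≡0 (ℕₚ.≮⇒≥ (≰ ∘ diagonal⁺ μ (toℕ j)))))))))

    factor : (if does (suc (toℕ j) ℕₚ.≤? diagonal μ) then Kyᵣ.product {r ∸ toℕ j} (G ∘ toℕ) else Kyᵣ.product {toℕ j ∸ r} (F ∘ toℕ)) Ky.≈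
      P.Π< (suc e ∸ m) G Ky.* P.Π< (m ∸ suc e) F
    factor = Ky.trans (cases (suc (toℕ j) ℕₚ.≤? diagonal μ))
      (Ky.reflexive (≡.cong₂ (λ p q → P.Π< p G Ky.* P.Π< q F) (≡.sym inverse-factors) (≡.sym factors)))

  -- In contrast to `Δʸ` this has coefficients in K[x]: the quotient in y is taken of the whole sum,
  -- whose coefficients involve x.
  vandermondeʸ : Series.Series Kx m
  vandermondeʸ = Vandermonde.Δ Kxy (Series.indeterminate Kx) (Series.divDiff Kx)

  module Truncated (D : ℕ) where
    private
      T = TKx.truncatedRing m D
      module T = CommutativeRing T
      module Tᵣ = Algebra.Definitions.RawSemiring (Semiring.rawSemiring T.semiring)
    open ListDeterminants T
    open CauchyDeterminant T using (vandermonde)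
    open FactorialPowers T using (Π<; dualPower; dualPower-cong; module Cauchy)
    open FiniteFamilies T using (product-Π<; product-Πᴸ; det-cong; det-detᴸ; Πᴸ-increasingPairs)
    open Relation.Binary.Reasoning.Setoid T.setoid

    private
      C : Polynomial n → Series.Series Kx m
      C = Series.constant Kx

      ι : Series.Series K m → Series.Series Kx m
      ι f = constantₚ ∘ f

      module C = Homomorphisms.Preserves Kx T {φ = C} (TKx.truncate-homomorphism {R = Kx} D (TKx.constant-homomorphism m))
      module ι = Homomorphisms.Preserves Ky T {φ = ι} (TKx.truncate-homomorphism {R = Ky} D (MapSeries.map-homomorphism K Kx constantₚ-homomorphism m))

      as : ℤ → Series.Series Kx m
      as k = C (constantₚ (a k))

      xs : Fin n → Series.Series Kx m
      xs i = C (indeterminateₚ i)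

      ys : Fin m → Series.Series Kx m
      ys = Series.indeterminate Kx

      gs : ℤ → Fin m → Series.Series Kx m
      gs k = Series.geometric Kx (constantₚ (a k))

      inv : Fin n → Fin m → Series.Series Kx m
      inv i = Series.geometric Kx (indeterminateₚ i)

      nilpotent : ∀ j → ys j Tᵣ.^ suc D T.≈ T.0#
      nilpotent j α α≤D β = K.trans (K.sym (truncate.^-homo (ys j) (suc D) α α≤D β)) (TKx.indeterminate-^ j (suc D) α (s≤s α≤D) β)
        where module truncate = Homomorphisms.Preserves Kxy T {φ = id} (TKx.truncate-homomorphism {R = Kxy} D
                (Algebra.Morphism.Construct.Identity.isRingHomomorphism Kxy.rawRing (λ _ _ → K.refl)))

    open Cauchy as xs ys gs (λ k j α _ → Series.geometric-inverse Kx (constantₚ (a k)) j α)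
      inv (λ i j α _ → Series.geometric-inverse Kx (indeterminateₚ i) j α)
      (suc D) nilpotent

    doubleAlternant-detᴸ : ∀ μ → C (doubleAlternant μ) T.≈ detᴸ (map (xRow n) (allFin n)) (exponents n (Partition.parts μ))
    doubleAlternant-detᴸ μ = begin
      C (doubleAlternant μ)
        ≈⟨ C.det-homo n (λ i j → Sch.factorialPower n i (exponent n μ (toℕ j))) ⟩
      Determinants.det T {n} (λ i j → C (Sch.factorialPower n i (exponent n μ (toℕ j))))
        ≈⟨ det-cong {n} (λ i j → entry i (exponent n μ (toℕ j))) ⟩
      Determinants.det T {n} (λ i j → xRow n i (exponent n μ (toℕ j)))
        ≈⟨ det-detᴸ (xRow n) (exponent n μ ∘ toℕ) ⟩
      detᴸ (tabulate (xRow n)) (tabulate (exponent n μ ∘ toℕ))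
        ≡⟨ ≡.cong₂ detᴸ (Listₚ.map-tabulate id (xRow n)) (exponents-tabulate n (Partition.parts μ)) ⟨
      detᴸ (map (xRow n) (allFin n)) (exponents n (Partition.parts μ)) ∎
      where
      entry : ∀ i r → C (Sch.factorialPower n i r) T.≈ xRow n i r
      entry i r = begin
        C (Sch.factorialPower n i r)
          ≈⟨ C.⟦⟧-cong {Sch.factorialPower n i r} {FactorialPowers.factorial Kx b (indeterminateₚ i) r}
               (FiniteFamilies.product-Π< Kx r (λ k → indeterminateₚ i Kx.- b k)) ⟩
        C (FactorialPowers.factorial Kx b (indeterminateₚ i) r)
          ≈⟨ C.factorial-homo b (indeterminateₚ i) r ⟩
        xRow n i r ∎
        where
        b : ℕ → Polynomial n
        b k = constantₚ (a (ℤ.+ n ℤ.- ℤ.+ k))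

    dualAlternant-detᴸ : ∀ μ → ι (dualAlternant μ) T.≈ detᴸ (map (yRow m) (allFin m)) (exponents m (Partition.parts μ))
    dualAlternant-detᴸ μ = begin
      ι (dualAlternant μ)
        ≈⟨ ι.det-homo m (Sch.dualEntry m μ) ⟩
      Determinants.det T {m} (λ i j → ι (Sch.dualEntry m μ i j))
        ≈⟨ det-cong {m} entry ⟩
      Determinants.det T {m} (λ i j → yRow m i (exponent m μ (toℕ j)))
        ≈⟨ det-detᴸ (yRow m) (exponent m μ ∘ toℕ) ⟩
      detᴸ (tabulate (yRow m)) (tabulate (exponent m μ ∘ toℕ))
        ≡⟨ ≡.cong₂ detᴸ (Listₚ.map-tabulate id (yRow m)) (exponents-tabulate m (Partition.parts μ)) ⟨
      detᴸ (map (yRow m) (allFin m)) (exponents m (Partition.parts μ)) ∎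
      where
      entry : ∀ i j → ι (Sch.dualEntry m μ i j) T.≈ yRow m i (exponent m μ (toℕ j))
      entry i j = begin
        ι (Sch.dualEntry m μ i j)
          ≈⟨ ι.⟦⟧-cong (dualEntry-dualPower μ i j) ⟩
        ι (FactorialPowers.dualPower Ky (Series.constant K ∘ a) m (Series.indeterminate K i) (λ k → Series.geometric K (a k) i) e)
          ≈⟨ ι.dualPower-homo (Series.constant K ∘ a) m (Series.indeterminate K i) (λ k → Series.geometric K (a k) i) e ⟩
        dualPower (ι ∘ Series.constant K ∘ a) m (ι (Series.indeterminate K i)) (λ k → ι (Series.geometric K (a k) i)) e
          ≈⟨ dualPower-cong {ι ∘ Series.constant K ∘ a} {as} {ι (Series.indeterminate K i)} {ys i}
               {λ k → ι (Series.geometric K (a k) i)} {λ k → gs k i}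
               (λ k α _ → MapSeries.monomial-map K Kx constantₚ-homomorphism (a k) 𝟎 α)
               (λ α _ → MapSeries.indeterminate-map K Kx constantₚ-homomorphism i α)
               (λ k α _ → MapSeries.geometric-map K Kx constantₚ-homomorphism (a k) i α) m e ⟩
        yRow m i e ∎
        where e = exponent m μ (toℕ j)

    alternants : Partition → Series.Series Kx m
    alternants μ = detᴸ (map (xRow n) (allFin n)) (exponents n (Partition.parts μ)) T.*
                   detᴸ (map (yRow m) (allFin m)) (exponents m (Partition.parts μ))

    ⊛-alternants : ∀ μ → doubleAlternant μ Sch.⊛ dualAlternant μ T.≈ alternants μ
    ⊛-alternants μ = begin
      doubleAlternant μ Sch.⊛ dualAlternant μ
        ≈⟨ (λ α _ → Series.*ₛ-constantˡ Kx (doubleAlternant μ) (ι (dualAlternant μ)) α) ⟨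
      C (doubleAlternant μ) T.* ι (dualAlternant μ)
        ≈⟨ T.*-cong (doubleAlternant-detᴸ μ) (dualAlternant-detᴸ μ) ⟩
      alternants μ ∎

    cauchyProduct-Πᴸ : Sch.cauchyProduct n m T.≈
      Πᴸ (allFin m) (numerators n) T.* Πᴸ (allFin n) (λ i → Πᴸ (allFin m) (inv i))
    cauchyProduct-Πᴸ = begin
      Sch.cauchyProduct n m
        ≡⟨ product-Πᴸ id (λ i → productₓᵧ {m} (λ j → F i j T.* inv i j)) ⟩
      Πᴸ (allFin n) (λ i → productₓᵧ {m} (λ j → F i j T.* inv i j))
        ≈⟨ Πᴸ-cong (allFin n) xFactors ⟩
      Πᴸ (allFin n) (λ i → Πᴸ (allFin m) (F i) T.* Πᴸ (allFin m) (inv i))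
        ≈⟨ Πᴸ-* (allFin n) (λ i → Πᴸ (allFin m) (F i)) (λ i → Πᴸ (allFin m) (inv i)) ⟩
      Πᴸ (allFin n) (λ i → Πᴸ (allFin m) (F i)) T.* Πᴸ (allFin n) (λ i → Πᴸ (allFin m) (inv i))
        ≈⟨ T.*-congʳ (Πᴸ-comm (allFin n) (allFin m) F) ⟩
      Πᴸ (allFin m) (λ j → Πᴸ (allFin n) (λ i → F i j)) T.* Πᴸ (allFin n) (λ i → Πᴸ (allFin m) (inv i))
        ≈⟨ T.*-congʳ (Πᴸ-cong (allFin m) yFactors) ⟩
      Πᴸ (allFin m) (numerators n) T.* Πᴸ (allFin n) (λ i → Πᴸ (allFin m) (inv i)) ∎
      where
      F : Fin n → Fin m → Series.Series Kx m
      F i j = T.1# T.- as (ℤ.+ suc (toℕ i)) T.* ys j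
      xFactors : ∀ i → productₓᵧ {m} (λ j → F i j T.* inv i j) T.≈ Πᴸ (allFin m) (F i) T.* Πᴸ (allFin m) (inv i)
      xFactors i = begin
        productₓᵧ {m} (λ j → F i j T.* inv i j)         ≡⟨ product-Πᴸ id (λ j → F i j T.* inv i j) ⟩
        Πᴸ (allFin m) (λ j → F i j T.* inv i j)         ≈⟨ Πᴸ-* (allFin m) (F i) (inv i) ⟩
        Πᴸ (allFin m) (F i) T.* Πᴸ (allFin m) (inv i)   ∎
      yFactors : ∀ j → Πᴸ (allFin n) (λ i → F i j) T.≈ numerators n j
      yFactors j = begin
        Πᴸ (allFin n) (λ i → F i j)    ≡⟨ product-Πᴸ id (λ i → F i j) ⟨
        productₓᵧ {n} (λ i → F i j)    ≈⟨ product-Π< n (λ k → T.1# T.- as (ℤ.+ suc k) T.* ys j) ⟩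
        numerators n j                 ∎

    -- The factors are arranged in the order of division: Δ(y) is outermost because the quotient in
    -- y is taken first, and Δ(x) is then a constant for y.
    vandermondes : vandermonde xs (allFin n) T.* vandermonde ys (allFin m) T.*
                   (Πᴸ (allFin m) (numerators n) T.* Πᴸ (allFin n) (λ i → Πᴸ (allFin m) (inv i))) T.≈
                   vandermondeʸ T.* (C (Sch.Δˣ n) T.* Sch.cauchyProduct n m)
    vandermondes = begin
      vandermonde xs (allFin n) T.* vandermonde ys (allFin m) T.*
        (Πᴸ (allFin m) (numerators n) T.* Πᴸ (allFin n) (λ i → Πᴸ (allFin m) (inv i)))
        ≈⟨ T.*-cong (T.*-cong Δˣ-vandermonde (Πᴸ-increasingPairs ys)) cauchyProduct-Πᴸ ⟨
      C (Sch.Δˣ n) T.* vandermondeʸ T.* Sch.cauchyProduct n m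
        ≈⟨ T.*-congʳ (T.*-comm (C (Sch.Δˣ n)) vandermondeʸ) ⟩
      vandermondeʸ T.* C (Sch.Δˣ n) T.* Sch.cauchyProduct n m
        ≈⟨ T.*-assoc vandermondeʸ (C (Sch.Δˣ n)) (Sch.cauchyProduct n m) ⟩
      vandermondeʸ T.* (C (Sch.Δˣ n) T.* Sch.cauchyProduct n m) ∎
      where
      Δˣ-vandermonde : C (Sch.Δˣ n) T.≈ vandermonde xs (allFin n)
      Δˣ-vandermonde = begin
        C (Sch.Δˣ n)
          ≈⟨ C.Πᴸ-homo xpairs (λ (i , j) → indeterminateₚ i Kx.- indeterminateₚ j) ⟩
        Πᴸ xpairs (λ (i , j) → C (indeterminateₚ i Kx.- indeterminateₚ j))
          ≈⟨ Πᴸ-cong xpairs (λ (i , j) → C.sub-homo (indeterminateₚ i) (indeterminateₚ j)) ⟩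
        Πᴸ xpairs (λ (i , j) → xs i T.- xs j)
          ≈⟨ Πᴸ-increasingPairs xs ⟩
        vandermonde xs (allFin n) ∎

    Σ-alternants-≤ : n ℕ.≤ m → Σᴸ (boxedPartitions n (suc D)) alternants T.≈ vandermondeʸ T.* (C (Sch.Δˣ n) T.* Sch.cauchyProduct n m)
    Σ-alternants-≤ n≤m = begin
      Σᴸ (boxedPartitions n (suc D)) alternants
        ≈⟨ Σᴸ-cong-All {f = alternants} {g = G ∘ exponents n ∘ Partition.parts} (All.map (λ {μ} len≤n → T.reflexive (≡.cong (λ ls → detᴸ X (exponents n (Partition.parts μ)) T.* detᴸ Y ls)
             (≡.trans (≡.cong (λ k → exponents k (Partition.parts μ)) m≡) (exponents-+ (m ∸ n) n (Partition.parts μ) len≤n))))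
             (length-boxedPartitions n (suc D))) ⟩
      Σᴸ (boxedPartitions n (suc D)) (G ∘ exponents n ∘ Partition.parts)
        ≡⟨ Σᴸ-map (exponents n ∘ Partition.parts) (boxedPartitions n (suc D)) G ⟨
      Σᴸ (map (exponents n ∘ Partition.parts) (boxedPartitions n (suc D))) G
        ≡⟨ ≡.cong (λ lss → Σᴸ lss G) (exponents-boxedPartitions n (suc D)) ⟩
      Σᴸ (decreasingSequences n (suc D)) G
        ≈⟨ cauchy-≤ (m ∸ n) (allFin n) (allFin m) (Listₚ.length-tabulate id) (Listₚ.length-tabulate id) m≡ ⟩
      vandermonde xs (allFin n) T.* vandermonde ys (allFin m) T.*
        (Πᴸ (allFin m) (numerators n) T.* Πᴸ (allFin n) (λ i → Πᴸ (allFin m) (inv i)))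
        ≈⟨ vandermondes ⟩
      vandermondeʸ T.* (C (Sch.Δˣ n) T.* Sch.cauchyProduct n m) ∎
      where
      m≡ : m ≡ (m ∸ n) ℕ.+ n
      m≡ = ≡.sym (ℕₚ.m∸n+n≡m n≤m)
      X = map (xRow n) (allFin n)
      Y = map (yRow m) (allFin m)
      G : List ℕ → Series.Series Kx m
      G ls = detᴸ X ls T.* detᴸ Y (map ((m ∸ n) ℕ.+_) ls ++ downFrom (m ∸ n))

    Σ-alternants-≥ : m ℕ.≤ n → Σᴸ (boxedPartitions m (suc D)) alternants T.≈ vandermondeʸ T.* (C (Sch.Δˣ n) T.* Sch.cauchyProduct n m)
    Σ-alternants-≥ m≤n = begin
      Σᴸ (boxedPartitions m (suc D)) alternants
        ≈⟨ Σᴸ-cong-All {f = alternants} {g = G ∘ exponents m ∘ Partition.parts} (All.map (λ {μ} len≤m → T.reflexive (≡.cong (λ ls → detᴸ X ls T.* detᴸ Y (exponents m (Partition.parts μ)))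
             (≡.trans (≡.cong (λ k → exponents k (Partition.parts μ)) n≡) (exponents-+ (n ∸ m) m (Partition.parts μ) len≤m))))
             (length-boxedPartitions m (suc D))) ⟩
      Σᴸ (boxedPartitions m (suc D)) (G ∘ exponents m ∘ Partition.parts)
        ≡⟨ Σᴸ-map (exponents m ∘ Partition.parts) (boxedPartitions m (suc D)) G ⟨
      Σᴸ (map (exponents m ∘ Partition.parts) (boxedPartitions m (suc D))) G
        ≡⟨ ≡.cong (λ lss → Σᴸ lss G) (exponents-boxedPartitions m (suc D)) ⟩
      Σᴸ (decreasingSequences m (suc D)) G
        ≈⟨ cauchy-≥ (n ∸ m) (allFin n) (allFin m) (Listₚ.length-tabulate id) (Listₚ.length-tabulate id) n≡ ⟩
      vandermonde xs (allFin n) T.* vandermonde ys (allFin m) T.*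
        (Πᴸ (allFin m) (numerators n) T.* Πᴸ (allFin n) (λ i → Πᴸ (allFin m) (inv i)))
        ≈⟨ vandermondes ⟩
      vandermondeʸ T.* (C (Sch.Δˣ n) T.* Sch.cauchyProduct n m) ∎
      where
      n≡ : n ≡ (n ∸ m) ℕ.+ m
      n≡ = ≡.sym (ℕₚ.m∸n+n≡m m≤n)
      X = map (xRow n) (allFin n)
      Y = map (yRow m) (allFin m)
      G : List ℕ → Series.Series Kx m
      G ls = detᴸ X (map ((n ∸ m) ℕ.+_) ls ++ downFrom (n ∸ m)) T.* detᴸ Y ls

  -- The first column has the factor yᵢ to the power λ₁ + m - 1, which has no terms of degree up to
  -- D. For m = 0 there is no first column and the determinant is 1.
  dualAlternant-vanish : ∀ μ D → 0 ℕ.< m → D ℕ.< row μ 0 ℕ.+ (m ∸ 1) → dualAlternant μ TK.≈[ D ] (λ _ → K.0#)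
  dualAlternant-vanish μ D 0<m D< = go m ≡.refl
    where
    T = TK.truncatedRing m D
    module T = CommutativeRing T
    module truncate = Homomorphisms.Preserves Ky T {φ = id} (TK.truncate-homomorphism {R = Ky} D
      (Algebra.Morphism.Construct.Identity.isRingHomomorphism Ky.rawRing (λ _ → K.refl)))

    entry : ∀ i j → toℕ j ≡ 0 → Sch.dualEntry m μ i j T.≈ T.0#
    entry i j eq = T.trans
      (T.*-congʳ (λ α α≤D → TK.indeterminate-^ i (exponent m μ (toℕ j)) α
        (ℕₚ.≤-<-trans α≤D (≡.subst (λ k → D ℕ.< exponent m μ k) (≡.sym eq) D<))))
      (T.zeroˡ _)

    -- `m` is a parameter of the module; the case distinction is made on a copy of it.
    go : ∀ k → k ≡ m → dualAlternant μ T.≈ T.0#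
    go zero    ≡.refl = contradiction 0<m (ℕₚ.<-irrefl ≡.refl)
    go (suc k) ≡.refl = T.trans (truncate.det-homo m (Sch.dualEntry m μ))
      (FiniteFamilies.det-zero-column T (Sch.dualEntry m μ) (λ i → entry i Fin.zero ≡.refl))

  term : Partition → Series.Series Kx m
  term μ = Sch.doubleSchur n μ Sch.⊛ Sch.dualSchur m μ

  term-quotient : ∀ μ α → len μ ℕ.≤ n → len μ ℕ.≤ m →
    term μ α Kx.≈ Sch._/Δˣ n (TKx.divDiffs ypairs (doubleAlternant μ Sch.⊛ dualAlternant μ) α)
  term-quotient μ α len≤n len≤m β = begin
    (Sch.doubleSchur n μ Kx.* constantₚ (Sch.dualSchur m μ α)) .coeff β
      ≡⟨ ≡.cong₂ (λ p f → (p Kx.* constantₚ (f α)) .coeff β) (doubleSchur-≤ μ len≤n) (dualSchur-≤ μ len≤m) ⟩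
    (Sch._/Δˣ n p Kx.* constantₚ u) .coeff β        ≈⟨ /Δˣ-*-constantₚ p u β ⟩
    Sch._/Δˣ n (p Kx.* constantₚ u) .coeff β
      ≈⟨ /Δˣ-cong {p Kx.* constantₚ u} {TKx.divDiffs ypairs (p Sch.⊛ dualAlternant μ) α} (⊛-divDiffs p (dualAlternant μ) α) β ⟩
    Sch._/Δˣ n (TKx.divDiffs ypairs (p Sch.⊛ dualAlternant μ) α) .coeff β ∎
    where
    open Relation.Binary.Reasoning.Setoid K.setoid
    p = doubleAlternant μ
    u = TK.divDiffs ypairs (dualAlternant μ) α

  -- A partition that is too long gives 0 by definition. Otherwise the dual alternant vanishes in
  -- all degrees that the divisions by the factors of Δ(y) can reach from α.
  term-vanish : ∀ μ α → (len μ ℕ.≤ n → len μ ℕ.≤ m → length ypairs ℕ.+ degree α ℕ.< row μ 0 ℕ.+ (m ∸ 1) × 0 ℕ.< m) →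
                term μ α Kx.≈ Kx.0#
  term-vanish μ α large β with len μ ℕₚ.≤? n | len μ ℕₚ.≤? m
  ... | no ≰n     | _         = K.trans
    (K.reflexive (≡.cong (λ p → (p Kx.* constantₚ (Sch.dualSchur m μ α)) .coeff β) (doubleSchur-> μ (ℕₚ.≰⇒> ≰n))))
    (Kx.zeroˡ (constantₚ (Sch.dualSchur m μ α)) β)
  ... | yes len≤n | dec = K.trans
    (Kx.*-congˡ {Sch.doubleSchur n μ} {constantₚ (Sch.dualSchur m μ α)} {constantₚ K.0#} (constant.⟦⟧-cong (zero-coefficient dec)) β)
    (K.trans (Kx.*-congˡ {Sch.doubleSchur n μ} {constantₚ K.0#} {Kx.0#} constant.0#-homo β) (Kx.zeroʳ (Sch.doubleSchur n μ) β))
    where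
    module constant = Homomorphisms.Preserves K Kx constantₚ-homomorphism
    zero-coefficient : Dec (len μ ℕ.≤ m) → Sch.dualSchur m μ α K.≈ K.0#
    zero-coefficient (no ≰m)     = K.reflexive (≡.cong (λ f → f α) (dualSchur-> μ (ℕₚ.≰⇒> ≰m)))
    zero-coefficient (yes len≤m) = K.trans
      (K.reflexive (≡.cong (λ f → f α) (dualSchur-≤ μ len≤m)))
      (K.trans (TK.divDiffs-≤ ypairs (degree α)
        (dualAlternant-vanish μ (length ypairs ℕ.+ degree α) (large len≤n len≤m .proj₂) (large len≤n len≤m .proj₁)) α ℕₚ.≤-refl)
        (TK.divDiffs-0 ypairs α))

  -- With this D the coefficient at α of the quotient in y depends only on terms that the truncated
  -- identity controls, so an equality in the untruncated ring results.
  Σ-term : ∀ α L → All (λ μ → len μ ℕ.≤ n × len μ ℕ.≤ m) L →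
    (let D = length ypairs ℕ.+ degree α in
     ListDeterminants.Σᴸ (TKx.truncatedRing m D) L (Truncated.alternants D) TKx.≈[ D ]
     vandermondeʸ Kxy.* (Series.constant Kx (Sch.Δˣ n) Kxy.* Sch.cauchyProduct n m)) →
    ΣKx.Σᴸ L (λ μ → term μ α) Kx.≈ Sch.cauchyProduct n m α
  Σ-term α L lens identity = begin
    ΣKx.Σᴸ L (λ μ → term μ α)
      ≈⟨ ΣKx.Σᴸ-cong-All {f = λ μ → term μ α} {g = λ μ → Sch._/Δˣ n (TKx.divDiffs ypairs (alternant μ) α)}
           (All.map (λ {μ} (len≤n , len≤m) → term-quotient μ α len≤n len≤m) lens) ⟩
    ΣKx.Σᴸ L (λ μ → Sch._/Δˣ n (TKx.divDiffs ypairs (alternant μ) α))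
      ≈⟨ /Δˣ-Σᴸ L (λ μ → TKx.divDiffs ypairs (alternant μ) α) ⟩
    Sch._/Δˣ n (ΣKx.Σᴸ L (λ μ → TKx.divDiffs ypairs (alternant μ) α))
      ≈⟨ /Δˣ-cong {ΣKx.Σᴸ L (λ μ → TKx.divDiffs ypairs (alternant μ) α)} {Sch.Δˣ n Kx.* P α} quotientʸ ⟩
    Sch._/Δˣ n (Sch.Δˣ n Kx.* P α)
      ≈⟨ Sch./Δˣ-unique n (Sch.Δˣ n Kx.* P α) (P α) (λ _ → K.refl) ⟩
    P α ∎
    where
    open Relation.Binary.Reasoning.Setoid Kx.setoid
    D = length ypairs ℕ.+ degree α
    P = Sch.cauchyProduct n m
    C = Series.constant Kx
    alternant : Partition → Series.Series Kx m
    alternant μ = doubleAlternant μ Sch.⊛ dualAlternant μ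

    Σ-alternant : (λ β → ΣKx.Σᴸ L (λ μ → alternant μ β)) TKx.≈[ D ] vandermondeʸ Kxy.* (C (Sch.Δˣ n) Kxy.* P)
    Σ-alternant β β≤D γ = K.trans (pointwise L γ) (K.trans
      (ListDeterminants.Σᴸ-cong (TKx.truncatedRing m D) L {alternant} {Truncated.alternants D} (Truncated.⊛-alternants D) β β≤D γ)
      (identity β β≤D γ))
      where
      pointwise : ∀ L → ΣKx.Σᴸ L (λ μ → alternant μ β) Kx.≈ ListDeterminants.Σᴸ (TKx.truncatedRing m D) L alternant β
      pointwise []      γ = K.refl
      pointwise (μ ∷ L) γ = K.+-congˡ (pointwise L γ)

    quotientʸ : ΣKx.Σᴸ L (λ μ → TKx.divDiffs ypairs (alternant μ) α) Kx.≈ Sch.Δˣ n Kx.* P α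
    quotientʸ = begin
      ΣKx.Σᴸ L (λ μ → TKx.divDiffs ypairs (alternant μ) α)
        ≈⟨ TKx.divDiffs-Σᴸ ypairs L alternant α ⟨
      TKx.divDiffs ypairs (λ β → ΣKx.Σᴸ L (λ μ → alternant μ β)) α
        ≈⟨ TKx.divDiffs-≤ ypairs (degree α) Σ-alternant α ℕₚ.≤-refl ⟩
      TKx.divDiffs ypairs (vandermondeʸ Kxy.* (C (Sch.Δˣ n) Kxy.* P)) α
        ≈⟨ Vandermonde./Δ-unique Kxy (Series.indeterminate Kx) (Series.divDiff Kx) (Series.divDiff-unique Kx)
             (vandermondeʸ Kxy.* (C (Sch.Δˣ n) Kxy.* P)) (C (Sch.Δˣ n) Kxy.* P) (λ _ _ → K.refl) α ⟩
      (C (Sch.Δˣ n) Kxy.* P) α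
        ≈⟨ Series.*ₛ-constantˡ Kx (Sch.Δˣ n) P α ⟩
      Sch.Δˣ n Kx.* P α ∎

  -- Outside the box λ₁ + k exceeds D + 1, and k ≤ m, so λ₁ + m - 1 exceeds D. If k were 0, the
  -- partition would be empty and λ₁ = 0, against the bound.
  large-exponent : ∀ {k D μ} → k ℕ.≤ m → len μ ℕ.≤ k → suc D ℕ.< row μ 0 ℕ.+ k → D ℕ.< row μ 0 ℕ.+ (m ∸ 1) × 0 ℕ.< m
  large-exponent {zero} {D} {μ} _ len≤0 lt =
    contradiction (≡.subst (suc D ℕ.<_) (≡.cong (ℕ._+ 0) (part-≥-length (Partition.parts μ) 0 len≤0)) lt) ℕₚ.n≮0
  large-exponent {suc k} {D} {μ} k<m _ lt =
    ℕₚ.<-≤-trans (ℕ.s≤s⁻¹ (≡.subst (suc D ℕ.<_) (ℕₚ.+-suc (row μ 0) k) lt)) (ℕₚ.+-monoʳ-≤ (row μ 0) (ℕₚ.∸-monoˡ-≤ 1 k<m)) ,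
    ℕₚ.<-≤-trans (s≤s ℕ.z≤n) k<m

  module _ (k : ℕ) (k≤n : k ℕ.≤ n) (k≤m : k ℕ.≤ m) (minimum : ∀ {l} → l ℕ.≤ n → l ℕ.≤ m → l ℕ.≤ k)
    (identity : ∀ D → ListDeterminants.Σᴸ (TKx.truncatedRing m D) (boxedPartitions k (suc D)) (Truncated.alternants D) TKx.≈[ D ]
      vandermondeʸ Kxy.* (Series.constant Kx (Sch.Δˣ n) Kxy.* Sch.cauchyProduct n m)) where

    hasSum-minimum : Series.HasSum Kx term (Sch.cauchyProduct n m)
    hasSum-minimum α =
      -- Up to degree D the power D + 1 of every y is 0, so exponents below `suc D` suffice in
      -- Cauchy-Binet.
      boxedPartitions k (suc D) ,
      unique-boxedPartitions k (suc D) ,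
      (λ μ μ∉ → term-vanish μ α (λ len≤n len≤m →
        large-exponent {μ = μ} k≤m (minimum len≤n len≤m) (∉-boxedPartitions k (suc D) μ μ∉ (minimum len≤n len≤m)))) ,
      Σ-term α (boxedPartitions k (suc D))
        (All.map (λ len≤k → ℕₚ.≤-trans len≤k k≤n , ℕₚ.≤-trans len≤k k≤m) (length-boxedPartitions k (suc D)))
        (identity D)
      where D = length ypairs ℕ.+ degree α

  hasSum : Series.HasSum Kx term (Sch.cauchyProduct n m)
  hasSum with ℕₚ.≤-total n m
  ... | inj₁ n≤m = hasSum-minimum n ℕₚ.≤-refl n≤m (λ l≤n _ → l≤n) (λ D → Truncated.Σ-alternants-≤ D n≤m)
  ... | inj₂ m≤n = hasSum-minimum m m≤n ℕₚ.≤-refl (λ _ l≤m → l≤m) (λ D → Truncated.Σ-alternants-≥ D m≤n)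

theorem3p1 : (n m : ℕ) →
    Series.HasSum ℚ[a][x n ]
    (λ μ → doubleSchur n μ ⊛ dualSchur m μ)
    (cauchyProduct n m)
theorem3p1 n m = CauchyIdentity.hasSum ℚ[a] ind n m
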